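{- Let $\kappa$ be a power of 2 and let $\mathcal{C}_S,\mathcal{C}_T$ be legal configurations for capacity $\kappa$ with $|\mathcal{C}_S|=|\mathcal{C}_T|$ and with the same underlying multiset of items $U$, all of whose items are powers of 2. Suppose at least one item size is not settled in $\mathcal{C}_S$ (with respect to $\mathcal{C}_T$), and let $\ell(\mathcal{C}_S,\mathcal{C}_T)$ be the size of the largest item in $\mathcal{C}_S$ that must be moved. Then there is a reconfiguration sequence for capacity $\kappa$ from $\mathcal{C}_S$ to $\mathcal{C}_T$ if and only if $$\sum_{B\in\mathcal{C}_S}\mathrm{slack}(B)\ \ge\ \ell(\mathcal{C}_S,\mathcal{C}_T).$$ Moreover, the algorithm \texttt{SettleItems} solves all feasible instances, i.e. whenever a reconfiguration sequence exists, \texttt{SettleItems} reconfigures $\mathcal{C}_S$ to $\mathcal{C}_T$.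
   Context: Powers of 2 include $1=2^0$. Items are positive integers (items of equal size are indistinguishable). A bunch is a finite (possibly empty) multiset of items; $\mathrm{vol}(B)$ is the sum of its items, $\mathrm{slack}(B)=\kappa-\mathrm{vol}(B)$. A configuration is a finite multiset of bunches; $|\mathcal{C}|$ is the number of bunches with multiplicity; its underlying multiset is the multiset union of the items of its bunches. It is legal for capacity $\kappa$ if every bunch has volume at most $\kappa$. Two legal configurations $\mathcal{C},\mathcal{D}$ are adjacent if $\mathcal{D}$ is formed from $\mathcal{C}$ by the move of a single item: $\mathcal{C}\setminus\mathcal{D}$ consists of two bunches $B_d,B_r$, $\mathcal{D}\setminus\mathcal{C}$ of two bunches $B_d',B_r'$, and for some item $u$ in $B_d$, $B_d'$ is $B_d$ with one copy of $u$ removed and $B_r'$ is $B_r$ with one copy of $u$ added. A reconfiguration sequence is a finite sequence of legal configurations for capacity $\kappa$ with consecutive ones adjacent. Settling. For a configuration $\mathcal{D}$, a bunch $B\in\mathcal{D}$ and a size $s$, $\mathit{AtLeast}(s,B,\mathcal{D})$ is the multiset of items of $B$ of size at least $s$. Size $s$ is settled in $\mathcal{D}$ if there is a bijection $\varphi$ from the multiset of bunches of $\mathcal{D}$ containing an item of size at least $s$ to the multiset of bunches of $\mathcal{C}_T$ containing an item of size at least $s$ with $\mathit{AtLeast}(s,B,\mathcal{D})=\mathit{AtLeast}(s,\varphi(B),\mathcal{C}_T)$ for each $B$ in the domain; such $\varphi$ is a settling bijection for size $s$. $\ell(\mathcal{D},\mathcal{C}_T)$, the size of the largest item in $\mathcal{D}$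 that must be moved, is the largest item size that is not settled in $\mathcal{D}$. Slack items and bundles. The slack of each bunch $B$ is partitioned into slack items that are maximal powers of 2 (the distinct powers of 2 in the binary expansion of $\mathrm{slack}(B)$). $\mathit{All}(B)$ is the multiset of all actual items and slack items of $B$ (total $\kappa$). A bundle is a sub-multiset of $\mathit{All}(B)$; its bsum is the sum of its elements. Procedure $\mathrm{Bundles}(B,p)$: start with one singleton bundle for each element of $\mathit{All}(B)$; while there are two bundles both of bsum $2^i$ for some $i<p$, merge them; finally return two (arbitrary) bundles of bsum $2^p$. Procedure $\mathrm{MergeSlack}(B_1,B_2,q)$: call $\mathrm{Bundles}(B_1,q)$, choose one of the two returned bundles that contains an actual item, and move its actual items from $B_1$ to $B_2$. Algorithm \texttt{SettleItems}. Let $u_1>u_2>\dots>u_k$ be the distinct item sizes in $U$. For $i=1,\dots,k$ perform stage $i$, where $\mathcal{C}_i$ is the configuration at the start of stage $i$ ($\mathcal{C}_1=\mathcal{C}_S$). Mapping Step: if every item size at least $u_i$ is settled in $\mathcal{C}_i$ (i.e. $\ell(\mathcal{C}_i,\mathcal{C}_T)<u_i$), end the stage. Otherwise let $\varphi_i$ be a settling bijection for size $u_{i-1}$ (the empty map if $i=1$). Let $\mathcal{C}_i'$ and $\mathcal{C}_T'$ be the multisets of bunches of $\mathcal{C}_i$ and of $\mathcal{C}_T$ whose largest item has size $u_i$; make them equal in number by adding to the smaller one bunches (of $\mathcal{C}_i$, resp. $\mathcal{C}_T$) all of whose items are smaller than $u_i$; extend $\varphi_i$ by an arbitrary bijection $\mathcal{C}_i'\to\mathcal{C}_T'$.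 Action Step: while some bunch $B$ in the domain of $\varphi_i$ has a different number of items of size $u_i$ than $\varphi_i(B)$ (bunches keep their identity as their contents change): choose $B_s$ with more items of size $u_i$ than $\varphi_i(B_s)$ and $B_d$ with fewer items of size $u_i$ than $\varphi_i(B_d)$. Compression phase: while two distinct bunches $B_1,B_2$ each have a slack item of the same size $2^q$ with $q<\log_2 u_i$, execute $\mathrm{MergeSlack}(B_1,B_2,q)$; then let $B_{temp}$ be a bunch containing a slack item of size at least $u_i$. Transfer phase: if $\mathrm{slack}(B_d)\ge u_i$, move an item of size $u_i$ from $B_s$ to $B_d$; otherwise move an item of size $u_i$ from $B_s$ to $B_{temp}$, call $\mathrm{Bundles}(B_d,\log_2(u_i/2))$ and move all actual items of the two returned bundles from $B_d$ to $B_s$, and then move an item of size $u_i$ from $B_{temp}$ to $B_d$. -}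

module Defs where

open import Data.Fin.Base using (Fin)
open import Data.Fin.Subset as Subset using (Subset)
open import Data.List.Base using (List; []; _∷_; [_]; _++_; map; mapMaybe; filter; concat; sum; length; upTo; downFrom)
open import Data.List.Membership.Propositional using (_∈_)
open import Data.List.Membership.DecPropositional using (_∈?_)
open import Data.List.Relation.Binary.Permutation.Propositional using (_↭_; ↭-setoid)
open import Data.List.Relation.Unary.All using (All)
open import Data.List.Relation.Unary.Any using (Any; _─_)
open import Data.Maybe.Base using (Maybe; just; nothing; _<∣>_)
open import Data.Nat.Base using (ℕ; suc; _∸_; _^_; _≤_; _<_)
open import Data.Nat.DivMod using (_/_; _%_)
open import Data.Nat.Properties using (_≟_; _≤?_; m^n≢0)
open import Data.Product.Base using (∃; ∃-syntax; _×_; _,_)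
open import Data.Sum.Base using (_⊎_)
open import Data.Vec.Functional using (Vector; toList; fromList; updateAt)
open import Function.Base using (_∘_; const)
open import Function.Bundles using (_⇔_)
open import Relation.Binary.PropositionalEquality using (_≡_; _≢_)
open import Relation.Nullary.Negation using (¬_)

PowerOfTwo : ℕ → Set
PowerOfTwo n = ∃[ k ] n ≡ 2 ^ k

------------------------------------------------------------------------
-- Bunches and configurations

-- Multisets are lists, compared up to permutation: _↭_ for bunches, and
-- _≋_ (permutation of the bunches, each up to _↭_) for configurations.

Bunch : Set
Bunch = List ℕ

Configuration : Set
Configuration = List Bunch

open import Data.List.Relation.Binary.Permutation.Setoid (↭-setoid {A = ℕ}) public using () renaming (_↭_ to _≋_)
open import Data.List.Relation.Binary.Disjoint.Setoid (↭-setoid {A = ℕ}) public using (Disjoint)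

vol : Bunch → ℕ
vol = sum

slack : ℕ → Bunch → ℕ
slack κ B = κ ∸ vol B

totalSlack : ℕ → Configuration → ℕ
totalSlack κ C = sum (map (slack κ) C)

underlying : Configuration → List ℕ
underlying = concat

Legal : ℕ → Configuration → Set
Legal κ = All (λ B → vol B ≤ κ)

-- X and Y are the multiset differences C ∖ D and D ∖ C.
Differences : (C D X Y : Configuration) → Set
Differences C D X Y =
  ∃[ common ] (C ≋ X ++ common) × (D ≋ Y ++ common) × Disjoint X Y

record Adjacent (C D : Configuration) : Set where
  field
    {Bd Br Bd′ Br′} : Bunch
    {item}          : ℕ
    differences     : Differences C D (Bd ∷ Br ∷ []) (Bd′ ∷ Br′ ∷ [])
    removed         : Bd ↭ item ∷ Bd′
    added           : Br′ ↭ item ∷ Br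

data ReconfigurationSequence (κ : ℕ) : (C D : Configuration) → Set where
  stop : ∀ {C D} → Legal κ C → C ≋ D → ReconfigurationSequence κ C D
  step : ∀ {C C′ D} → Legal κ C → Adjacent C C′ →
         ReconfigurationSequence κ C′ D → ReconfigurationSequence κ C D

------------------------------------------------------------------------
-- Settling

-- From here on a configuration is also given as a vector, so that a bunch
-- is identified by its position and keeps it while its contents change.

PartialMap : ℕ → ℕ → Set
PartialMap n m = Fin n → Maybe (Fin m)

record IsBijection {n m : ℕ} (P : Fin n → Set) (Q : Fin m → Set)
                   (φ : PartialMap n m) : Set where
  field
    domain    : ∀ i → P i ⇔ (∃[ j ] φ i ≡ just j)
    image     : ∀ j → Q j ⇔ (∃[ i ] φ i ≡ just j)
    injective : ∀ {i i′ j} → φ i ≡ just j → φ i′ ≡ just j → i ≡ i′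

atLeast : ℕ → Bunch → List ℕ
atLeast s = filter (s ≤?_)

HasAtLeast : ℕ → Bunch → Set
HasAtLeast s = Any (s ≤_)

record IsSettlingBijection (s : ℕ) {n m : ℕ} (D : Vector Bunch n)
                           (T : Vector Bunch m) (φ : PartialMap n m) : Set where
  field
    isBijection : IsBijection (HasAtLeast s ∘ D) (HasAtLeast s ∘ T) φ
    agrees      : ∀ {i j} → φ i ≡ just j → atLeast s (D i) ↭ atLeast s (T j)

Settled : ℕ → ∀ {n m} → Vector Bunch n → Vector Bunch m → Set
Settled s D T = ∃[ φ ] IsSettlingBijection s D T φ

-- "ℓ is ℓ(D, T)"; in particular some item size is not settled.
record IsLargestUnsettled (D T : Configuration) (ℓ : ℕ) : Set where
  field
    isItemSize : ℓ ∈ underlying D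
    unsettled  : ¬ Settled ℓ (fromList D) (fromList T)
    largest    : ∀ {s} → s ∈ underlying D →
                 ¬ Settled s (fromList D) (fromList T) → s ≤ ℓ

------------------------------------------------------------------------
-- Slack items and bundles

bit : ℕ → ℕ → ℕ
bit q n = ((n / 2 ^ q) {{m^n≢0 2 q}}) % 2

-- Exponents below n suffice, as 2 ^ q ≤ n implies q < n.
binaryPowers : ℕ → List ℕ
binaryPowers n = map (2 ^_) (filter (λ q → bit q n ≟ 1) (upTo n))

slackItems : ℕ → Bunch → List ℕ
slackItems κ B = binaryPowers (slack κ B)

data Element : Set where
  actual slackItem : ℕ → Element

size : Element → ℕ
size (actual u)    = u
size (slackItem s) = s

actualItem : Element → Maybe ℕ
actualItem (actual u)    = just u
actualItem (slackItem _) = nothing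

allElements : ℕ → Bunch → List Element
allElements κ B = map actual B ++ map slackItem (slackItems κ B)

Bundle : Set
Bundle = List Element

bsum : Bundle → ℕ
bsum = sum ∘ map size

actualItems : Bundle → List ℕ
actualItems = mapMaybe actualItem

data MergeStep (p : ℕ) (bs : List Bundle) : List Bundle → Set where
  merge : ∀ {i b₁ b₂ rest} → i < p → bs ↭ b₁ ∷ b₂ ∷ rest →
          bsum b₁ ≡ 2 ^ i → bsum b₂ ≡ 2 ^ i →
          MergeStep p bs ((b₁ ++ b₂) ∷ rest)

------------------------------------------------------------------------
-- SettleItems

-- The distinct item sizes in decreasing order (downFrom is decreasing, and
-- no item exceeds the sum of all items).
sizes : List ℕ → List ℕ
sizes U = filter (λ s → _∈?_ _≟_ s U) (downFrom (suc (sum U)))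

IsLargestItem : ℕ → Bunch → Set
IsLargestItem u B = u ∈ B × All (_≤ u) B

ExactlyLargest : ℕ → ∀ {n} → Vector Bunch n → Subset n → Set
ExactlyLargest u C P = ∀ i → (i Subset.∈ P) ⇔ IsLargestItem u (C i)

PaddedLargest : ℕ → ∀ {n} → Vector Bunch n → Subset n → Set
PaddedLargest u C P =
  (∀ i → IsLargestItem u (C i) → i Subset.∈ P) ×
  (∀ i → i Subset.∈ P → IsLargestItem u (C i) ⊎ All (_< u) (C i))

-- The first argument is the previous size, absent in the first stage.
IsStartingMap : Maybe ℕ → ∀ {n m} → Vector Bunch n → Vector Bunch m →
                PartialMap n m → Set
IsStartingMap nothing  C T ψ = ∀ i → ψ i ≡ nothing
IsStartingMap (just s) C T ψ = IsSettlingBijection s C T ψ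

multiplicity : ℕ → Bunch → ℕ
multiplicity u B = length (filter (u ≟_) B)

-- φ is a possible outcome of the Mapping Step for size u.
record IsStageMap (prev : Maybe ℕ) (u : ℕ) {n m : ℕ} (C : Vector Bunch n)
                  (T : Vector Bunch m) (φ : PartialMap n m) : Set where
  field
    ψ χ       : PartialMap n m
    P         : Subset n
    Q         : Subset m
    starting  : IsStartingMap prev C T ψ
    padding   : (ExactlyLargest u C P × PaddedLargest u T Q)
              ⊎ (PaddedLargest u C P × ExactlyLargest u T Q)
    extension : IsBijection (Subset._∈ P) (Subset._∈ Q) χ
    combined  : ∀ i → φ i ≡ (ψ i <∣> χ i)

-- Commands of the algorithm; Fin n are the bunches of the current
-- configuration and Fin m those of the target.
data Command (n m : ℕ) : Set where
  -- the previous size and the sizes still to be treated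
  stages     : Maybe ℕ → List ℕ → Command n m
  actionLoop : ℕ → PartialMap n m → Command n m
  compress   : ℕ → Command n m
  -- size, B_s, B_d
  transfer   : ℕ → Fin n → Fin n → Command n m
  -- Bundles (B , p), passing the two returned bundles on
  bundles    : Fin n → ℕ → (Bundle → Bundle → Command n m) → Command n m
  -- the loop of Bundles, with the current list of bundles
  merging    : ℕ → List Bundle → (Bundle → Bundle → Command n m) → Command n m
  -- last part of MergeSlack (B₁ , B₂ , q)
  chooseOne  : Fin n → Fin n → Bundle → Bundle → Command n m
  moveAll    : List ℕ → Fin n → Fin n → Command n m
  moveItem   : ℕ → Fin n → Fin n → Command n m

mergeSlack : ∀ {n m} → Fin n → Fin n → ℕ → Command n m
mergeSlack i j q = bundles i q (chooseOne i j)

moveTo : ∀ {n u} (C : Vector Bunch n) (i j : Fin n) → u ∈ C i → Vector Bunch n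
moveTo {u = u} C i j u∈ = updateAt (updateAt C i (const (C i ─ u∈))) j (u ∷_)

module SettleItems (κ : ℕ) {n m : ℕ} (T : Vector Bunch m) where

  -- The pending commands and the current configuration.
  State : Set
  State = List (Command n m) × Vector Bunch n

  AllSettledFrom : ℕ → Vector Bunch n → Set
  AllSettledFrom u C = ∀ s → s ∈ underlying (toList C) → u ≤ s → Settled s C T

  Balanced : ℕ → PartialMap n m → Vector Bunch n → Set
  Balanced u φ C =
    ∀ i j → φ i ≡ just j → multiplicity u (C i) ≡ multiplicity u (T j)

  Surplus Deficit : ℕ → PartialMap n m → Vector Bunch n → Fin n → Set
  Surplus u φ C i = ∃[ j ] φ i ≡ just j × multiplicity u (T j) < multiplicity u (C i)
  Deficit u φ C i = ∃[ j ] φ i ≡ just j × multiplicity u (C i) < multiplicity u (T j)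

  Mergeable : ℕ → Vector Bunch n → Fin n → Fin n → ℕ → Set
  Mergeable u C i j q =
    i ≢ j × 2 ^ q < u × 2 ^ q ∈ slackItems κ (C i) × 2 ^ q ∈ slackItems κ (C j)

  -- Every choice the description leaves open is a nondeterministic choice
  -- between steps.
  infix 4 _⟶_
  data _⟶_ : State → State → Set where

    stages-end : ∀ {prev ks C} → (stages prev [] ∷ ks , C) ⟶ (ks , C)

    stage-skip : ∀ {prev u us ks C} → AllSettledFrom u C →
      (stages prev (u ∷ us) ∷ ks , C) ⟶ (stages (just u) us ∷ ks , C)

    stage-act : ∀ {prev u us ks C φ} → ¬ AllSettledFrom u C →
      IsStageMap prev u C T φ →
      (stages prev (u ∷ us) ∷ ks , C) ⟶
      (actionLoop u φ ∷ stages (just u) us ∷ ks , C)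

    action-end : ∀ {u φ ks C} → Balanced u φ C →
      (actionLoop u φ ∷ ks , C) ⟶ (ks , C)

    action-loop : ∀ {u φ ks C s d} → Surplus u φ C s → Deficit u φ C d →
      (actionLoop u φ ∷ ks , C) ⟶
      (compress u ∷ transfer u s d ∷ actionLoop u φ ∷ ks , C)

    compress-end : ∀ {u ks C} → (∀ i j q → ¬ Mergeable u C i j q) →
      (compress u ∷ ks , C) ⟶ (ks , C)

    compress-loop : ∀ {u ks C i j q} → Mergeable u C i j q →
      (compress u ∷ ks , C) ⟶ (mergeSlack i j q ∷ compress u ∷ ks , C)

    transfer-direct : ∀ {u s d ks C t} → Any (u ≤_) (slackItems κ (C t)) →
      u ≤ slack κ (C d) →
      (transfer u s d ∷ ks , C) ⟶ (moveItem u s d ∷ ks , C)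

    -- p is log₂ (u / 2).
    transfer-via : ∀ {u s d ks C t p} → Any (u ≤_) (slackItems κ (C t)) →
      slack κ (C d) < u → u ≡ 2 ^ suc p →
      (transfer u s d ∷ ks , C) ⟶
      ( moveItem u s t
      ∷ bundles d p (λ b₁ b₂ → moveAll (actualItems b₁ ++ actualItems b₂) d s)
      ∷ moveItem u t d
      ∷ ks , C)

    bundles-start : ∀ {i p return ks C} →
      (bundles i p return ∷ ks , C) ⟶
      (merging p (map [_] (allElements κ (C i))) return ∷ ks , C)

    bundles-merge : ∀ {p bs bs′ return ks C} → MergeStep p bs bs′ →
      (merging p bs return ∷ ks , C) ⟶ (merging p bs′ return ∷ ks , C)

    bundles-return : ∀ {p bs b₁ b₂ rest return ks C} →
      (∀ bs′ → ¬ MergeStep p bs bs′) →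
      bs ↭ b₁ ∷ b₂ ∷ rest → bsum b₁ ≡ 2 ^ p → bsum b₂ ≡ 2 ^ p →
      (merging p bs return ∷ ks , C) ⟶ (return b₁ b₂ ∷ ks , C)

    choose-first : ∀ {i j b₁ b₂ ks C} → actualItems b₁ ≢ [] →
      (chooseOne i j b₁ b₂ ∷ ks , C) ⟶ (moveAll (actualItems b₁) i j ∷ ks , C)

    choose-second : ∀ {i j b₁ b₂ ks C} → actualItems b₂ ≢ [] →
      (chooseOne i j b₁ b₂ ∷ ks , C) ⟶ (moveAll (actualItems b₂) i j ∷ ks , C)

    moveAll-end : ∀ {i j ks C} → (moveAll [] i j ∷ ks , C) ⟶ (ks , C)

    moveAll-next : ∀ {us u i j ks C} (u∈ : u ∈ us) →
      (moveAll us i j ∷ ks , C) ⟶ (moveItem u i j ∷ moveAll (us ─ u∈) i j ∷ ks , C)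

    move-item : ∀ {u i j ks C} → i ≢ j → (u∈ : u ∈ C i) →
      (moveItem u i j ∷ ks , C) ⟶ (ks , moveTo C i j u∈)

    -- B_temp may be B_s.
    move-none : ∀ {u i ks C} → u ∈ C i → (moveItem u i i ∷ ks , C) ⟶ (ks , C)

  -- Every run from the state is finite, never gets stuck, visits only legal
  -- configurations and ends in T.  A step leaves the configuration unchanged
  -- or leads to an adjacent one (moving an item between distinct bunches can
  -- also reproduce the same multiset of bunches).
  data AlwaysReconfigures : State → Set where
    finished : ∀ {C} → Legal κ (toList C) → toList C ≋ toList T →
      AlwaysReconfigures ([] , C)
    continue : ∀ {ks C} → Legal κ (toList C) →
      (∃[ σ ] (ks , C) ⟶ σ) →
      (∀ {ks′ C′} → (ks , C) ⟶ (ks′ , C′) →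
        (toList C ≋ toList C′ ⊎ Adjacent (toList C) (toList C′)) ×
        AlwaysReconfigures (ks′ , C′)) →
      AlwaysReconfigures (ks , C)

SettleItemsReconfigures : ℕ → Configuration → Configuration → Set
SettleItemsReconfigures κ C T =
  SettleItems.AlwaysReconfigures κ (fromList T)
    (stages nothing (sizes (underlying C)) ∷ [] , fromList C)

{-# OPTIONS --safe #-}
module Submission where

-- A move needs a bunch with enough slack for the moved item.  So if the total
-- slack is less than ℓ, no item of size at least ℓ ever moves, and size ℓ
-- would have to be settled from the start.
--
-- Conversely, consider the stage for a size u ≤ ℓ.  Since a binary expansion
-- is the shortest way of writing a number as a sum of powers of two, every
-- MergeSlack decreases the total number of slack items.  When none applies any
-- more, the slack items smaller than u are distinct and thus amount to less
-- than u, so that some bunch has slack at least u.  The bundles needed on the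
-- way exist because 2^p divides κ: when no two bundles of equal sum below 2^p
-- remain, the bundles of sum below 2^p have distinct sums, adding up to a
-- multiple of 2^p that is less than 2^p, so there are none.  Finally every
-- transfer decreases the number of surplus items of size u.

open import Defs
open import Data.Bool.Base using (true; false)
open import Data.Empty using (⊥)
open import Data.Fin.Base using (Fin; zero; suc; cast)
import Data.Fin.Properties as Fin
import Data.Fin.Subset as Subset
import Data.Fin.Subset.Properties as Subset
open import Data.List.Base using (List; []; _∷_; [_]; _++_; map; mapMaybe; filter; concat; length; upTo; downFrom; applyUpTo; allFin; tabulate; replicate; take)
open import Data.List.Properties hiding (sum-++)
open import Data.List.Membership.Propositional using (_∈_; find; lose)
open import Data.List.Membership.Propositional.Properties
open import Data.List.Relation.Binary.Permutation.Propositional using (_↭_; ↭⇒↭ₛ; ↭ₛ⇒↭; ↭⇒↭ₛ′; module PermutationReasoning; ↭-setoid; ↭-refl; ↭-sym; ↭-trans; ↭-reflexive; prep; swap)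
open import Data.List.Relation.Binary.Permutation.Propositional.Properties using (↭-length; ++⁺; ++⁺ˡ; ++⁺ʳ; shift; shifts; drop-∷; All-resp-↭; ∈-resp-↭; filter-↭; map⁺; mapMaybe-↭; ↭-empty-inv)
open import Data.List.Relation.Unary.All as All using (All; []; _∷_)
import Data.List.Relation.Unary.All.Properties as All
open import Data.List.Relation.Unary.AllPairs as AllPairs using (AllPairs; []; _∷_)
import Data.List.Relation.Unary.AllPairs.Properties as AllPairs
open import Data.List.Relation.Unary.Any as Any using (Any; here; there; any?; _─_)
import Data.List.Relation.Unary.Any.Properties as Any
open import Data.List.Relation.Unary.Unique.Propositional using (Unique)
import Data.List.Relation.Unary.Unique.Propositional.Properties as Unique
open import Data.Maybe.Base using (Maybe; just; nothing; _<∣>_; maybe)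
open import Data.Maybe.Properties using (just-injective)
open import Data.Nat.Base using (ℕ; zero; suc; _+_; _*_; _∸_; _^_; _≤_; _<_; _≥_; z≤n; s≤s; >-nonZero)
open import Data.Nat.DivMod
open import Data.Nat.Divisibility
open import Data.Nat.Induction using (<-wellFounded; Acc; acc)
open import Data.Nat.ListAction using (sum)
open import Data.Nat.ListAction.Properties using (sum-++; sum-↭)
open import Data.Nat.Properties
open import Algebra.Properties.CommutativeSemigroup +-commutativeSemigroup using (interchange; x∙yz≈y∙xz)
open import Data.Product.Base using (∃; ∃-syntax; _×_; _,_; proj₁; proj₂)
open import Data.Sum.Base using (_⊎_; inj₁; inj₂)
open import Data.Vec.Functional using (Vector; toList; fromList; updateAt)
open import Data.Vec.Functional.Properties using (updateAt-updates; updateAt-minimal)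
open import Function.Base using (_∘_; id; const; case_of_)
open import Function.Bundles using (_⇔_; mk⇔; module Equivalence; module Inverse)
open import Relation.Binary.PropositionalEquality using (_≡_; _≢_; refl; sym; trans; cong; cong₂; subst; subst₂; module ≡-Reasoning)
open import Relation.Nullary.Decidable using (Dec; yes; no; does; _×-dec_; _→-dec_; ¬?; map′)
open import Relation.Nullary.Negation using (¬_; contradiction)
open import Relation.Binary.Bundles using (Setoid)
open import Relation.Binary.Definitions using (tri<; tri≈; tri>)
open import Relation.Binary.PropositionalEquality.Properties using () renaming (setoid to ≡-setoid)
open import Relation.Unary using (Pred; Decidable)
open import Level using (Level)

-- `SettleItems` is nondeterministic, so two things are proved at every command: each step a run may
-- take keeps the invariants, and some step exists. The second is why so much is decided here:
-- equality of multisets, mergeable pairs of bunches, settledness.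
--
-- Settledness asks for a bijection, which is awkward to search for. It is replaced by an equality:
-- size s is settled exactly when the two configurations, with all items smaller than s deleted from
-- their bunches, are equal as multisets of bunches. This uses the equal number of bunches, since
-- bunches emptied by the deletion have to match as well. The same reformulation serves the
-- necessity proof and the conclusion that the last configuration is the target.
--
-- Within the stage for u, compression and exchange rearrange the items smaller than u in an
-- uncontrolled way. All facts carried through a stage therefore concern only the items of size at
-- least u, together with legality and the underlying multiset.
--
-- Divisibility alone does not give two bundles: the elements of size at most 2^p must also sum to
-- at least twice 2^p. This has a different source in `MergeSlack` (arithmetic modulo 2^(q+1)) and
-- in the transfer (the volume of the target bunch).

private
  variable
    a p : Level
    A B : Set a

-- Permutations of lists and their decidability

∈⇒↭ : ∀ {x : A} {xs} (x∈ : x ∈ xs) → xs ↭ x ∷ (xs ─ x∈)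
∈⇒↭ (here refl)              = ↭-refl
∈⇒↭ {x = x} (there {y} x∈)   = ↭-trans (prep y (∈⇒↭ x∈)) (swap y x ↭-refl)

module _ {c ℓ} (S : Setoid c ℓ) where
  open Setoid S using (_≈_) renaming (Carrier to C; refl to ≈-refl; sym to ≈-sym)
  private module P where
    open import Data.List.Relation.Binary.Permutation.Setoid S public
    open import Data.List.Relation.Binary.Permutation.Setoid.Properties S public hiding (↭-shift)
  open P using () renaming (_↭_ to _↭ₛ_)
  import Data.List.Membership.Setoid S as M

  private
    pull : ∀ {x xs} (x∈ : x M.∈ xs) → xs ↭ₛ x ∷ (xs ─ x∈)
    pull (here x≈)             = P.prep (≈-sym x≈) P.↭-refl
    pull {x = x} (there {y} x∈) = P.trans (P.prep ≈-refl (pull x∈)) (P.swap ≈-refl ≈-refl P.↭-refl)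

  permutation? : (∀ x y → Dec (x ≈ y)) → ∀ xs ys → Dec (xs ↭ₛ ys)
  permutation? _≈?_ []       []       = yes P.↭-refl
  permutation? _≈?_ []       (y ∷ ys) = no (P.¬x∷xs↭[] ∘ P.↭-sym)
  permutation? _≈?_ (x ∷ xs) ys with any? (x ≈?_) ys
  ... | no x∉ys = no λ p → x∉ys (P.∈-resp-↭ p (here ≈-refl))
  ... | yes x∈ys = map′
    (λ p → P.trans (P.prep ≈-refl p) (P.↭-sym (pull x∈ys)))
    (λ p → P.drop-∷ (P.trans p (pull x∈ys)))
    (permutation? _≈?_ xs (ys ─ x∈ys))

_↭?_ : (xs ys : List ℕ) → Dec (xs ↭ ys)
xs ↭? ys = map′ ↭ₛ⇒↭ ↭⇒↭ₛ (permutation? (≡-setoid ℕ) _≟_ xs ys)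

_≋?_ : (C D : Configuration) → Dec (C ≋ D)
_≋?_ = permutation? ↭-setoid _↭?_

unique-resp-↭ : ∀ {xs ys : List A} → xs ↭ ys → Unique xs → Unique ys
unique-resp-↭ {A = A} p = Unique-resp-↭ (↭⇒↭ₛ p)
  where open import Data.List.Relation.Binary.Permutation.Setoid.Properties (≡-setoid A) using (Unique-resp-↭)

-- Turns a bijection known through membership into a permutation, and so into an equality of lengths
-- or of sums.
unique-set⇒↭ : ∀ {xs ys : List A} → Unique xs → Unique ys →
  (∀ {x} → x ∈ xs → x ∈ ys) → (∀ {x} → x ∈ ys → x ∈ xs) → xs ↭ ys
unique-set⇒↭ {xs = []} {[]} _ _ _ _ = ↭-refl
unique-set⇒↭ {xs = []} {y ∷ ys} _ _ _ ⊇ with () ← ⊇ (here refl)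
unique-set⇒↭ {xs = x ∷ xs} {ys} (x∉ ∷ u) v ⊆ ⊇ =
  ↭-trans (prep x (unique-set⇒↭ u v′ ⊆′ ⊇′)) (↭-sym (∈⇒↭ x∈))
  where
  x∈ = ⊆ (here refl)
  w : Unique (x ∷ (ys ─ x∈))
  w = unique-resp-↭ (∈⇒↭ x∈) v
  v′ : Unique (ys ─ x∈)
  v′ = AllPairs.tail w
  ⊆′ : ∀ {z} → z ∈ xs → z ∈ (ys ─ x∈)
  ⊆′ z∈ with ∈-resp-↭ (∈⇒↭ x∈) (⊆ (there z∈))
  ... | here refl = contradiction refl (All.lookup x∉ z∈)
  ... | there z∈′ = z∈′
  ⊇′ : ∀ {z} → z ∈ (ys ─ x∈) → z ∈ xs
  ⊇′ z∈ with ⊇ (∈-resp-↭ (↭-sym (∈⇒↭ x∈)) (there z∈))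
  ... | here refl = contradiction refl (All.lookup (AllPairs.head w) z∈)
  ... | there z∈′ = z∈′

filter-partition : ∀ {P : Pred A p} (P? : Decidable P) xs →
  xs ↭ filter P? xs ++ filter (¬? ∘ P?) xs
filter-partition P? [] = ↭-refl
filter-partition P? (x ∷ xs) with P? x
... | yes _ = prep x (filter-partition P? xs)
... | no  _ = ↭-trans (prep x (filter-partition P? xs)) (↭-sym (shift x _ _))

-- Multiplicities and the items of at least a given size

multiplicity-↭ : ∀ u {xs ys} → xs ↭ ys → multiplicity u xs ≡ multiplicity u ys
multiplicity-↭ u p = ↭-length (filter-↭ (u ≟_) p)

multiplicity-++ : ∀ u xs ys → multiplicity u (xs ++ ys) ≡ multiplicity u xs + multiplicity u ys
multiplicity-++ u xs ys = trans (cong length (filter-++ (u ≟_) xs ys)) (length-++ (filter (u ≟_) xs))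

multiplicity-∷ : ∀ u xs → multiplicity u (u ∷ xs) ≡ suc (multiplicity u xs)
multiplicity-∷ u xs = cong length (filter-accept (u ≟_) refl)

multiplicity>0⇒∈ : ∀ u xs → 0 < multiplicity u xs → u ∈ xs
multiplicity>0⇒∈ u xs 0< with filter (u ≟_) xs in eq
... | y ∷ _ with ∈-filter⁻ (u ≟_) {xs = xs} (subst (y ∈_) (sym eq) (here refl))
...   | y∈ , refl = y∈

atLeast-↭ : ∀ s {xs ys} → xs ↭ ys → atLeast s xs ↭ atLeast s ys
atLeast-↭ s = filter-↭ (s ≤?_)

atLeast-++ : ∀ s xs ys → atLeast s (xs ++ ys) ≡ atLeast s xs ++ atLeast s ys
atLeast-++ s = filter-++ (s ≤?_)

atLeast-none : ∀ {s xs} → All (_< s) xs → atLeast s xs ≡ []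
atLeast-none xs< = filter-none (_ ≤?_) (All.map <⇒≱ xs<)

atLeast-all : ∀ {s xs} → All (s ≤_) xs → atLeast s xs ≡ xs
atLeast-all = filter-all (_ ≤?_)

-- Separates the copies of `u`, which the stage for `u` redistributes, from the larger items, which
-- are already in place.
atLeast-split : ∀ u xs → atLeast u xs ↭ replicate (multiplicity u xs) u ++ atLeast (suc u) xs
atLeast-split u [] = ↭-refl
atLeast-split u (x ∷ xs) with <-cmp u x
... | tri< u<x u≢x _
  rewrite filter-accept (u ≤?_) {xs = xs} (<⇒≤ u<x) | filter-accept (suc u ≤?_) {xs = xs} u<x
        | filter-reject (u ≟_) {xs = xs} u≢x
  = ↭-trans (prep x (atLeast-split u xs)) (↭-sym (shift x _ _))
... | tri≈ u≮x refl _
  rewrite filter-accept (u ≤?_) {xs = xs} (≤-refl {u}) | filter-reject (suc u ≤?_) {xs = xs} u≮x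
        | filter-accept (u ≟_) {xs = xs} refl
  = prep u (atLeast-split u xs)
... | tri> u≮x u≢x x<u
  rewrite filter-reject (u ≤?_) {xs = xs} (<⇒≱ x<u) | filter-reject (suc u ≤?_) {xs = xs} u≮x
        | filter-reject (u ≟_) {xs = xs} u≢x
  = atLeast-split u xs

hasAtLeast? : ∀ s (B : Bunch) → Dec (HasAtLeast s B)
hasAtLeast? s = any? (s ≤?_)

¬hasAtLeast : ∀ {s B} → ¬ HasAtLeast s B → All (_< s) B
¬hasAtLeast {B = B} ¬h = All.map ≰⇒> (All.¬Any⇒All¬ B ¬h)

hasAtLeast⇒≢[] : ∀ {s B} → HasAtLeast s B → atLeast s B ≢ []
hasAtLeast⇒≢[] {s} {B} h eq = case filter-some (s ≤?_) h of λ l → contradiction (cong length eq) (>⇒≢ l)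

hasAtLeast-cong : ∀ {s X Y} → atLeast s X ↭ atLeast s Y → HasAtLeast s X → HasAtLeast s Y
hasAtLeast-cong {s} {X} {Y} p h with hasAtLeast? s Y
... | yes h′ = h′
... | no ¬h′ = contradiction (↭-empty-inv (subst (atLeast s X ↭_) (atLeast-none (¬hasAtLeast ¬h′)) p)) (hasAtLeast⇒≢[] h)

sum-filter≤ : ∀ {P : Pred ℕ p} (P? : Decidable P) xs → sum (filter P? xs) ≤ sum xs
sum-filter≤ P? xs = begin
  sum (filter P? xs)                                   ≤⟨ m≤m+n _ _ ⟩
  sum (filter P? xs) + sum (filter (¬? ∘ P?) xs)       ≡⟨ sum-++ (filter P? xs) _ ⟨
  sum (filter P? xs ++ filter (¬? ∘ P?) xs)            ≡⟨ sum-↭ (filter-partition P? xs) ⟨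
  sum xs                                               ∎
  where open ≤-Reasoning

∈⇒≤sum : ∀ {x xs} → x ∈ xs → x ≤ sum xs
∈⇒≤sum {x} x∈ = subst (x ≤_) (sym (sum-↭ (∈⇒↭ x∈))) (m≤m+n x _)

sum-replicate : ∀ n x → sum (replicate n x) ≡ n * x
sum-replicate zero    x = refl
sum-replicate (suc n) x = cong (x +_) (sum-replicate n x)

-- Binary expansions

2^-suc : ∀ k → 2 ^ suc k ≡ 2 ^ k + 2 ^ k
2^-suc k = cong (2 ^ k +_) (+-identityʳ (2 ^ k))

2^>0 : ∀ k → 0 < 2 ^ k
2^>0 k = m^n>0 2 k

2^-cancel-< : ∀ a b → 2 ^ a < 2 ^ b → a < b
2^-cancel-< a b lt with a <? b
... | yes a<b = a<b
... | no  a≮b = contradiction lt (≤⇒≯ (^-monoʳ-≤ 2 (≮⇒≥ a≮b)))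

2^-cancel-≤ : ∀ a b → 2 ^ a ≤ 2 ^ b → a ≤ b
2^-cancel-≤ a b le with a ≤? b
... | yes a≤b = a≤b
... | no  a≰b = contradiction le (<⇒≱ (^-monoʳ-< 2 (n<1+n 1) (≰⇒> a≰b)))

2^-∣ : ∀ a b → a ≤ b → 2 ^ a ∣ 2 ^ b
2^-∣ a b a≤b = subst (2 ^ a ∣_) (trans (sym (^-distribˡ-+-* 2 a (b ∸ a))) (cong (2 ^_) (m+[n∸m]≡n a≤b))) (m∣m*n (2 ^ (b ∸ a)))

powerOfTwo>0 : ∀ {n} → PowerOfTwo n → 0 < n
powerOfTwo>0 (k , refl) = 2^>0 k

powerOfTwo-∣ : ∀ k {n} → PowerOfTwo n → 2 ^ k ≤ n → 2 ^ k ∣ n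
powerOfTwo-∣ k (m , refl) le = 2^-∣ k m (2^-cancel-≤ k m le)

powerOfTwo-<⇒∣ : ∀ k {n} → PowerOfTwo n → 2 ^ k < n → 2 ^ suc k ∣ n
powerOfTwo-<⇒∣ k (m , refl) lt = 2^-∣ (suc k) m (2^-cancel-< k m lt)

∣-sum : ∀ {d xs} → All (d ∣_) xs → d ∣ sum xs
∣-sum []       = _ ∣0
∣-sum (x ∷ xs) = ∣m∣n⇒∣m+n x (∣-sum xs)

powerOfTwo-≢⇒< : ∀ k {n} → PowerOfTwo n → n < 2 ^ suc k → 2 ^ k ≢ n → n < 2 ^ k
powerOfTwo-≢⇒< k (m , refl) n< n≢ = ≤∧≢⇒< (^-monoʳ-≤ 2 (≤-pred (2^-cancel-< m (suc k) n<))) (n≢ ∘ sym)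

-- The value 2^k occurs at most once in a list bounded by 2^(k+1), and all other powers there are
-- below 2^k. It is used both for the slack items left by compression and for the small bundles left
-- by merging.
sum-distinct-powers : ∀ k {L} → All PowerOfTwo L → All (_< 2 ^ k) L → Unique L → sum L < 2 ^ k
sum-distinct-powers zero {[]} _ _ _ = s≤s z≤n
sum-distinct-powers zero {x ∷ L} (p ∷ _) (x<1 ∷ _) _ = contradiction (powerOfTwo>0 p) (<⇒≱ x<1)
sum-distinct-powers (suc k) {L} ps bs u with any? (2 ^ k ≟_) L
... | no 2^k∉ = begin-strict
  sum L          <⟨ sum-distinct-powers k ps bs′ u ⟩
  2 ^ k          ≤⟨ m≤m+n _ _ ⟩
  2 ^ suc k      ∎
  where
  open ≤-Reasoning
  bs′ = All.map
    (λ (p , b , ne) → powerOfTwo-≢⇒< k p b ne)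
    (All.zip (ps , All.zip (bs , All.¬Any⇒All¬ L 2^k∉)))
... | yes 2^k∈ = begin-strict
  sum L                        ≡⟨ sum-↭ (∈⇒↭ 2^k∈) ⟩
  2 ^ k + sum (L ─ 2^k∈)       <⟨ +-monoʳ-< (2 ^ k) (sum-distinct-powers k (All.tail ps′) bs′ (AllPairs.tail u′)) ⟩
  2 ^ k + 2 ^ k                ≡⟨ 2^-suc k ⟨
  2 ^ suc k                    ∎
  where
  open ≤-Reasoning
  ps′ = All-resp-↭ (∈⇒↭ 2^k∈) ps
  u′  = unique-resp-↭ (∈⇒↭ 2^k∈) u
  bs′ = All.map
    (λ (p , b , ne) → powerOfTwo-≢⇒< k p b ne)
    (All.zip (All.tail ps′ , All.zip (All.tail (All-resp-↭ (∈⇒↭ 2^k∈) bs) , AllPairs.head u′)))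

bit? : ∀ n q → Dec (bit q n ≡ 1)
bit? n q = bit q n ≟ 1

-- `binaryPowers n` is the case `N = n`. The number `N` of bits is kept apart from `n` to allow
-- induction: dropping bit 0 halves `n` but lowers `N` by one only.
powers : ℕ → ℕ → List ℕ
powers N n = map (2 ^_) (filter (bit? n) (upTo N))

bit-zero : ∀ n → bit 0 n ≡ n % 2
bit-zero n = cong (_% 2) (n/1≡n n)

bit-suc : ∀ q n → bit (suc q) n ≡ bit q (n / 2)
bit-suc q n = cong (_% 2) (sym (m/n/o≡m/[n*o] n 2 (2 ^ q) {{_}} {{m^n≢0 2 q}} {{m^n≢0 2 (suc q)}}))

powers-tail : ∀ n qs →
  map (2 ^_) (filter (bit? n) (map suc qs)) ≡
  map (2 *_) (map (2 ^_) (filter (bit? (n / 2)) qs))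
powers-tail n [] = refl
powers-tail n (q ∷ qs) with bit? (n / 2) q
... | yes e = trans
  (cong (map (2 ^_)) (filter-accept (bit? n) {x = suc q} {xs = map suc qs} (trans (bit-suc q n) e)))
  (trans (cong (2 ^ suc q ∷_) (powers-tail n qs))
    (cong (map (2 *_) ∘ map (2 ^_)) (sym (filter-accept (bit? (n / 2)) {x = q} {xs = qs} e))))
... | no ne = trans
  (cong (map (2 ^_)) (filter-reject (bit? n) {x = suc q} {xs = map suc qs} (ne ∘ trans (sym (bit-suc q n)))))
  (trans (powers-tail n qs)
    (cong (map (2 *_) ∘ map (2 ^_)) (sym (filter-reject (bit? (n / 2)) {x = q} {xs = qs} ne))))

powers-even : ∀ N n → n % 2 ≡ 0 → powers (suc N) n ≡ map (2 *_) (powers N (n / 2))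
powers-even N n e = begin
  powers (suc N) n
    ≡⟨ cong (map (2 ^_)) (filter-reject (bit? n) {x = 0} {xs = applyUpTo suc N} (λ b → 0≢1+n (trans (sym e) (trans (sym (bit-zero n)) b)))) ⟩
  map (2 ^_) (filter (bit? n) (applyUpTo suc N))
    ≡⟨ cong (λ qs → map (2 ^_) (filter (bit? n) qs)) (map-upTo suc N) ⟨
  map (2 ^_) (filter (bit? n) (map suc (upTo N)))
    ≡⟨ powers-tail n (upTo N) ⟩
  map (2 *_) (powers N (n / 2)) ∎
  where open ≡-Reasoning

powers-odd : ∀ N n → n % 2 ≡ 1 → powers (suc N) n ≡ 1 ∷ map (2 *_) (powers N (n / 2))
powers-odd N n e = begin
  powers (suc N) n
    ≡⟨ cong (map (2 ^_)) (filter-accept (bit? n) {x = 0} {xs = applyUpTo suc N} (trans (bit-zero n) e)) ⟩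
  1 ∷ map (2 ^_) (filter (bit? n) (applyUpTo suc N))
    ≡⟨ cong (λ qs → 1 ∷ map (2 ^_) (filter (bit? n) qs)) (map-upTo suc N) ⟨
  1 ∷ map (2 ^_) (filter (bit? n) (map suc (upTo N)))
    ≡⟨ cong (1 ∷_) (powers-tail n (upTo N)) ⟩
  1 ∷ map (2 *_) (powers N (n / 2)) ∎
  where open ≡-Reasoning

m*2≡m+m : ∀ m → m * 2 ≡ m + m
m*2≡m+m m = trans (*-comm m 2) (cong (m +_) (+-identityʳ m))

data Parity (n : ℕ) : Set where
  even : n % 2 ≡ 0 → n ≡ n / 2 + n / 2 → Parity n
  odd  : n % 2 ≡ 1 → n ≡ suc (n / 2 + n / 2) → Parity n

parity : ∀ n → Parity n
parity n with n % 2 in eq | m%n<n n 2 | m≡m%n+[m/n]*n n 2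
... | 0 | _ | e = even eq (trans e (m*2≡m+m (n / 2)))
... | 1 | _ | e = odd eq (trans e (cong suc (m*2≡m+m (n / 2))))
... | suc (suc _) | s≤s (s≤s ()) | _

sum-map-double : ∀ xs → sum (map (2 *_) xs) ≡ sum xs + sum xs
sum-map-double [] = refl
sum-map-double (x ∷ xs) = begin
  2 * x + sum (map (2 *_) xs)         ≡⟨ cong₂ _+_ (cong (x +_) (+-identityʳ x)) (sum-map-double xs) ⟩
  (x + x) + (sum xs + sum xs)         ≡⟨ interchange x x (sum xs) (sum xs) ⟩
  (x + sum xs) + (x + sum xs)         ∎
  where open ≡-Reasoning

halve-< : ∀ N n → n < 2 ^ suc N → n / 2 < 2 ^ N
halve-< N n n<2^ = m<n*o⇒m/o<n (subst (n <_) (*-comm 2 (2 ^ N)) n<2^)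

sum-powers : ∀ N n → n < 2 ^ N → sum (powers N n) ≡ n
sum-powers zero    zero    _ = refl
sum-powers zero    (suc n) (s≤s ())
sum-powers (suc N) n n<2^ with parity n
... | even e n≡ = begin
  sum (powers (suc N) n)                             ≡⟨ cong sum (powers-even N n e) ⟩
  sum (map (2 *_) (powers N (n / 2)))                ≡⟨ sum-map-double (powers N (n / 2)) ⟩
  sum (powers N (n / 2)) + sum (powers N (n / 2))    ≡⟨ cong (λ x → x + x) (sum-powers N (n / 2) (halve-< N n n<2^)) ⟩
  n / 2 + n / 2                                      ≡⟨ n≡ ⟨
  n                                                  ∎
  where
  open ≡-Reasoning
... | odd e n≡ = begin
  sum (powers (suc N) n)                                   ≡⟨ cong sum (powers-odd N n e) ⟩
  suc (sum (map (2 *_) (powers N (n / 2))))                ≡⟨ cong suc (sum-map-double (powers N (n / 2))) ⟩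
  suc (sum (powers N (n / 2)) + sum (powers N (n / 2)))    ≡⟨ cong (λ x → suc (x + x)) (sum-powers N (n / 2) (halve-< N n n<2^)) ⟩
  suc (n / 2 + n / 2)                                      ≡⟨ n≡ ⟨
  n                                                        ∎
  where
  open ≡-Reasoning

n<2^n : ∀ n → n < 2 ^ n
n<2^n zero    = s≤s z≤n
n<2^n (suc n) = begin-strict
  suc n          ≤⟨ n<2^n n ⟩
  2 ^ n          <⟨ m<m+n (2 ^ n) (2^>0 n) ⟩
  2 ^ n + 2 ^ n  ≡⟨ 2^-suc n ⟨
  2 ^ suc n      ∎
  where open ≤-Reasoning

sum-binaryPowers : ∀ n → sum (binaryPowers n) ≡ n
sum-binaryPowers n = sum-powers n n (n<2^n n)

binaryPowers-powers : ∀ n → All PowerOfTwo (binaryPowers n)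
binaryPowers-powers n = All.map⁺ (All.universal (λ q → q , refl) (filter (bit? n) (upTo n)))

binaryPowers-unique : ∀ n → Unique (binaryPowers n)
binaryPowers-unique n = Unique.map⁺ (λ {a} {b} e → ≤-antisym (2^-cancel-≤ a b (≤-reflexive e)) (2^-cancel-≤ b a (≤-reflexive (sym e))))
  (Unique.filter⁺ (bit? n) (Unique.upTo⁺ n))

halve-double : ∀ m → (m + m) / 2 ≡ m
halve-double m = trans (cong (_/ 2) (sym (m*2≡m+m m))) (m*n/n≡m m 2)

double-%2 : ∀ m → (m + m) % 2 ≡ 0
double-%2 m = trans (cong (_% 2) (sym (m*2≡m+m m))) (m*n%n≡0 m 2)

suc-double-%2 : ∀ m → suc (m + m) % 2 ≡ 1
suc-double-%2 m = trans (cong (λ x → suc x % 2) (sym (m*2≡m+m m))) ([m+kn]%n≡m%n 1 m 2)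

halve-suc-double : ∀ m → suc (m + m) / 2 ≡ m
halve-suc-double m with parity (suc (m + m))
... | even e _ = contradiction (trans (sym (suc-double-%2 m)) e) λ ()
... | odd  _ e = *-cancelˡ-≡ _ _ 2 (trans (cong (h +_) (+-identityʳ h)) (trans (sym (suc-injective e)) (cong (m +_) (sym (+-identityʳ m)))))
  where h = suc (m + m) / 2

length-powers-double : ∀ N m → length (powers (suc N) (m + m)) ≡ length (powers N m)
length-powers-double N m = begin
  length (powers (suc N) (m + m))                        ≡⟨ cong length (powers-even N (m + m) (double-%2 m)) ⟩
  length (map (2 *_) (powers N ((m + m) / 2)))           ≡⟨ length-map (2 *_) (powers N ((m + m) / 2)) ⟩
  length (powers N ((m + m) / 2))                        ≡⟨ cong (length ∘ powers N) (halve-double m) ⟩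
  length (powers N m)                                    ∎
  where open ≡-Reasoning

length-powers-suc-double : ∀ N m → length (powers (suc N) (suc (m + m))) ≡ suc (length (powers N m))
length-powers-suc-double N m = begin
  length (powers (suc N) (suc (m + m)))                       ≡⟨ cong length (powers-odd N (suc (m + m)) (suc-double-%2 m)) ⟩
  suc (length (map (2 *_) (powers N (suc (m + m) / 2))))      ≡⟨ cong suc (length-map (2 *_) (powers N (suc (m + m) / 2))) ⟩
  suc (length (powers N (suc (m + m) / 2)))                   ≡⟨ cong (suc ∘ length ∘ powers N) (halve-suc-double m) ⟩
  suc (length (powers N m))                                   ∎
  where open ≡-Reasoning

-- length (powers N n) counts the nonzero bits of n below N, and adding a power
-- of two creates at most one more.
length-powers-+ : ∀ N k n → length (powers N (2 ^ k + n)) ≤ suc (length (powers N n))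
length-powers-+ zero    k n = z≤n
length-powers-+ (suc N) k n with parity n
length-powers-+ (suc N) zero n | even _ n≡ = ≤-reflexive (begin
  length (powers (suc N) (suc n))           ≡⟨ cong (length ∘ powers (suc N) ∘ suc) n≡ ⟩
  length (powers (suc N) (suc (h + h)))     ≡⟨ length-powers-suc-double N h ⟩
  suc (length (powers N h))                 ≡⟨ cong suc (length-powers-double N h) ⟨
  suc (length (powers (suc N) (h + h)))     ≡⟨ cong (suc ∘ length ∘ powers (suc N)) n≡ ⟨
  suc (length (powers (suc N) n))           ∎)
  where
  open ≡-Reasoning
  h = n / 2
-- A carry: bit 0 disappears, which pays for the bit that adding 1 to `h` may create.
length-powers-+ (suc N) zero n | odd _ n≡ = begin
  length (powers (suc N) (suc n))              ≡⟨ cong (length ∘ powers (suc N) ∘ suc) (trans n≡ (sym (+-suc h h))) ⟩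
  length (powers (suc N) (suc h + suc h))      ≡⟨ length-powers-double N (suc h) ⟩
  length (powers N (suc h))                    ≤⟨ length-powers-+ N zero h ⟩
  suc (length (powers N h))                    ≡⟨ length-powers-suc-double N h ⟨
  length (powers (suc N) (suc (h + h)))        ≡⟨ cong (length ∘ powers (suc N)) n≡ ⟨
  length (powers (suc N) n)                    ≤⟨ n≤1+n _ ⟩
  suc (length (powers (suc N) n))              ∎
  where
  open ≤-Reasoning
  h = n / 2
length-powers-+ (suc N) (suc k) n | even _ n≡ = begin
  length (powers (suc N) (2 ^ suc k + n))                      ≡⟨ cong (length ∘ powers (suc N)) (trans (cong₂ _+_ (2^-suc k) n≡) (interchange (2 ^ k) (2 ^ k) h h)) ⟩
  length (powers (suc N) ((2 ^ k + h) + (2 ^ k + h)))          ≡⟨ length-powers-double N (2 ^ k + h) ⟩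
  length (powers N (2 ^ k + h))                                ≤⟨ length-powers-+ N k h ⟩
  suc (length (powers N h))                                    ≡⟨ cong suc (length-powers-double N h) ⟨
  suc (length (powers (suc N) (h + h)))                        ≡⟨ cong (suc ∘ length ∘ powers (suc N)) n≡ ⟨
  suc (length (powers (suc N) n))                              ∎
  where
  open ≤-Reasoning
  h = n / 2
length-powers-+ (suc N) (suc k) n | odd _ n≡ = begin
  length (powers (suc N) (2 ^ suc k + n))                      ≡⟨ cong (length ∘ powers (suc N)) (trans (cong₂ _+_ (2^-suc k) n≡) (trans (+-suc (2 ^ k + 2 ^ k) (h + h)) (cong suc (interchange (2 ^ k) (2 ^ k) h h)))) ⟩
  length (powers (suc N) (suc ((2 ^ k + h) + (2 ^ k + h))))    ≡⟨ length-powers-suc-double N (2 ^ k + h) ⟩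
  suc (length (powers N (2 ^ k + h)))                          ≤⟨ s≤s (length-powers-+ N k h) ⟩
  suc (suc (length (powers N h)))                              ≡⟨ cong suc (length-powers-suc-double N h) ⟨
  suc (length (powers (suc N) (suc (h + h))))                  ≡⟨ cong (suc ∘ length ∘ powers (suc N)) n≡ ⟨
  suc (length (powers (suc N) n))                              ∎
  where
  open ≤-Reasoning
  h = n / 2

powers-zero : ∀ N → powers N 0 ≡ []
powers-zero zero    = refl
powers-zero (suc N) = trans (powers-even N 0 refl) (cong (map (2 *_)) (powers-zero N))

-- The members of `L` are added one at a time to 0, which has no bits, and each creates at most one
-- bit. Repetitions in `L` are allowed; this makes the number of slack items a usable measure for
-- compression.
length-powers-min : ∀ N {L} → All PowerOfTwo L → length (powers N (sum L)) ≤ length L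
length-powers-min N [] = ≤-reflexive (cong length (powers-zero N))
length-powers-min N {_ ∷ L} ((k , refl) ∷ ps) = ≤-trans (length-powers-+ N k (sum L)) (s≤s (length-powers-min N ps))

binaryPowers-min : ∀ {L} → All PowerOfTwo L → length (binaryPowers (sum L)) ≤ length L
binaryPowers-min {L} = length-powers-min (sum L)

-- Bundles

concat-↭ : ∀ {xss yss : List (List A)} → xss ↭ yss → concat xss ↭ concat yss
concat-↭ _↭_.refl = ↭-refl
concat-↭ (prep xs p) = ++⁺ˡ xs (concat-↭ p)
concat-↭ (swap xs ys p) = ↭-trans (shifts xs ys) (++⁺ˡ ys (++⁺ˡ xs (concat-↭ p)))
concat-↭ (_↭_.trans p q) = ↭-trans (concat-↭ p) (concat-↭ q)

bsum-++ : ∀ b c → bsum (b ++ c) ≡ bsum b + bsum c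
bsum-++ b c = trans (cong sum (map-++ size b c)) (sum-++ (map size b) (map size c))

bsum-↭ : ∀ {b c} → b ↭ c → bsum b ≡ bsum c
bsum-↭ p = sum-↭ (map⁺ size p)

bsum-concat : ∀ bs → sum (map bsum bs) ≡ bsum (concat bs)
bsum-concat []       = refl
bsum-concat (b ∷ bs) = trans (cong (bsum b +_) (bsum-concat bs)) (sym (bsum-++ b (concat bs)))

module _ {P : Pred A p} (P? : Decidable P) where

  two-of-filter : ∀ xs → 2 ≤ length (filter P? xs) →
    ∃[ x ] ∃[ y ] ∃[ rest ] xs ↭ x ∷ y ∷ rest × P x × P y
  two-of-filter xs 2≤ with filter P? xs in eq
  ... | []        = contradiction 2≤ λ ()
  ... | _ ∷ []    = contradiction 2≤ λ { (s≤s ()) }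
  ... | x ∷ y ∷ r with subst (All P) eq (All.all-filter P? xs)
  ...   | px ∷ py ∷ _ =
    x , y , _ , subst (λ zs → xs ↭ zs ++ filter (¬? ∘ P?) xs) eq (filter-partition P? xs) , px , py

  length-filter-∷ : ∀ x xs → length (filter P? xs) ≤ length (filter P? (x ∷ xs))
  length-filter-∷ x xs with does (P? x)
  ... | true  = n≤1+n _
  ... | false = ≤-refl

∣⇒≡0 : ∀ {d n} → d ∣ n → n < d → n ≡ 0
∣⇒≡0 {n = zero}  _   _   = refl
∣⇒≡0 {n = suc n} d∣n n<d = contradiction (∣⇒≤ d∣n) (<⇒≱ n<d)

-- Values of at least 2^p may repeat: `distinct` excludes repetitions only below 2^p, which is
-- exactly what the end of the merging loop provides. The larger values, being powers of two, are
-- multiples of 2^p, so the divisibility of the whole sum passes to the small part.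
all-large : ∀ p {L} → All PowerOfTwo L → AllPairs (λ x y → x ≡ y → ¬ x < 2 ^ p) L →
  2 ^ p ∣ sum L → All (2 ^ p ≤_) L
all-large p {L} ps distinct d = All.map ≮⇒≥ (All.¬Any⇒All¬ L none)
  where
  small? = _<? 2 ^ p
  S = filter small? L
  M = filter (¬? ∘ small?) L
  unique : ∀ {xs} → All (_< 2 ^ p) xs → AllPairs (λ x y → x ≡ y → ¬ x < 2 ^ p) xs → Unique xs
  unique []       []       = []
  unique (b ∷ bs) (r ∷ rs) = All.map (λ f x≡y → f x≡y b) r ∷ unique bs rs
  sum-S< : sum S < 2 ^ p
  sum-S< = sum-distinct-powers p (All.filter⁺ small? ps) (All.all-filter small? L)
    (unique (All.all-filter small? L) (AllPairs.filter⁺ small? distinct))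
  ∣M : 2 ^ p ∣ sum M
  ∣M = ∣-sum (All.map (λ (q , x≮) → powerOfTwo-∣ p q (≮⇒≥ x≮))
    (All.zip (All.filter⁺ (¬? ∘ small?) ps , All.all-filter (¬? ∘ small?) L)))
  ∣S : 2 ^ p ∣ sum S
  ∣S = ∣m+n∣m⇒∣n (subst (2 ^ p ∣_)
    (trans (sum-↭ (filter-partition small? L)) (trans (sum-++ S M) (+-comm (sum S) (sum M)))) d) ∣M
  none : ¬ Any (_< 2 ^ p) L
  none small with find small
  ... | x , x∈ , x< = contradiction (∣⇒≡0 ∣S sum-S<)
    (>⇒≢ (<-≤-trans (powerOfTwo>0 (All.lookup ps x∈)) (∈⇒≤sum (∈-filter⁺ small? x∈ x<))))

Unmergeable : ℕ → Bundle → Bundle → Set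
Unmergeable p b c = bsum b ≡ bsum c → ¬ bsum b < 2 ^ p

mergeable? : ∀ p bs → All (PowerOfTwo ∘ bsum) bs → ∃ (MergeStep p bs) ⊎ AllPairs (Unmergeable p) bs
mergeable? p [] _ = inj₂ []
mergeable? p (b ∷ bs) ((i , b≡) ∷ ps) with bsum b <? 2 ^ p | any? (λ c → bsum b ≟ bsum c) bs | mergeable? p bs ps
... | yes b< | yes same | _ with find same
...   | c , c∈ , eq = inj₁ (_ , merge (2^-cancel-< i p (subst (_< 2 ^ p) b≡ b<)) (prep b (∈⇒↭ c∈)) b≡ (trans (sym eq) b≡))
mergeable? p (b ∷ bs) ((i , b≡) ∷ ps) | _ | _ | inj₁ (_ , merge {b₁ = b₁} {b₂} i< q e₁ e₂) =
  inj₁ (_ , merge i< (↭-trans (prep b q) (↭-trans (swap b b₁ ↭-refl) (prep b₁ (swap b b₂ ↭-refl)))) e₁ e₂)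
mergeable? p (b ∷ bs) ((i , b≡) ∷ ps) | no b≮ | _ | inj₂ un = inj₂ (All.universal (λ _ _ → b≮) bs ∷ un)
mergeable? p (b ∷ bs) ((i , b≡) ∷ ps) | _ | no ¬same | inj₂ un =
  inj₂ (All.map (λ ne eq _ → ne eq) (All.¬Any⇒All¬ bs ¬same) ∷ un)

MergeStep-length : ∀ {p bs bs′} → MergeStep p bs bs′ → length bs′ < length bs
MergeStep-length (merge _ q _ _) = ≤-reflexive (sym (↭-length q))

unmergeable-resp-↭ : ∀ {p bs cs} → bs ↭ cs → AllPairs (Unmergeable p) bs → AllPairs (Unmergeable p) cs
unmergeable-resp-↭ {p} q = AllPairs-resp-↭ (λ f e b< → f (sym e) (subst (_< 2 ^ p) e b<))
  ((λ { refl f → f }) , (λ { refl f → f })) (↭⇒↭ₛ q)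
  where open import Data.List.Relation.Binary.Permutation.Setoid.Properties (≡-setoid Bundle) using (AllPairs-resp-↭)

unmergeable⇒final : ∀ {p bs} → AllPairs (Unmergeable p) bs → ∀ bs′ → ¬ MergeStep p bs bs′
unmergeable⇒final {p} un _ (merge {i} i<p q e₁ e₂)
  with (f ∷ _) ∷ _ ← unmergeable-resp-↭ {p} q un
  = f (trans e₁ (sym e₂)) (subst (_< 2 ^ p) (sym e₁) (^-monoʳ-< 2 (n<1+n 1) i<p))

-- `shape` expresses that merging never goes beyond 2^p: a bundle exceeding 2^p is one of the
-- initial singletons, so it holds no small element.
record MergeInvariant (p : ℕ) (E : List Element) (bs : List Bundle) : Set where
  field
    content : concat bs ↭ E
    pows    : All (PowerOfTwo ∘ bsum) bs
    shape   : All (λ b → bsum b ≤ 2 ^ p ⊎ All (λ e → 2 ^ p < size e) b) bs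

concat-map-[] : ∀ (xs : List A) → concat (map [_] xs) ≡ xs
concat-map-[] []       = refl
concat-map-[] (x ∷ xs) = cong (x ∷_) (concat-map-[] xs)

mergeInvariant-start : ∀ p {E} → All (PowerOfTwo ∘ size) E → MergeInvariant p E (map [_] E)
mergeInvariant-start p {E} ps = record
  { content = ↭-reflexive (concat-map-[] E)
  ; pows    = All.map⁺ (All.map (λ {e} → subst PowerOfTwo (sym (+-identityʳ (size e)))) ps)
  ; shape   = All.map⁺ (All.universal shape E)
  }
  where
  shape : ∀ e → bsum [ e ] ≤ 2 ^ p ⊎ All (λ e → 2 ^ p < size e) [ e ]
  shape e with size e ≤? 2 ^ p
  ... | yes ≤p = inj₁ (subst (_≤ 2 ^ p) (sym (+-identityʳ (size e))) ≤p)
  ... | no ≰p  = inj₂ (≰⇒> ≰p ∷ [])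

mergeInvariant-step : ∀ {p E bs bs′} → MergeInvariant p E bs → MergeStep p bs bs′ → MergeInvariant p E bs′
mergeInvariant-step {p} inv (merge {i} {b₁} {b₂} {rest} i<p q e₁ e₂) = record
  { content = ↭-trans (↭-reflexive (++-assoc b₁ b₂ (concat rest))) (↭-trans (↭-sym (concat-↭ q)) content)
  ; pows    = (suc i , merged≡) ∷ All.tail (All.tail (All-resp-↭ q pows))
  ; shape   = inj₁ (≤-trans (≤-reflexive merged≡) (^-monoʳ-≤ 2 i<p)) ∷ All.tail (All.tail (All-resp-↭ q shape))
  }
  where
  open MergeInvariant inv
  merged≡ : bsum (b₁ ++ b₂) ≡ 2 ^ suc i
  merged≡ = trans (bsum-++ b₁ b₂) (trans (cong₂ _+_ e₁ e₂) (sym (2^-suc i)))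

smallSum : ℕ → List Element → ℕ
smallSum p E = bsum (filter (λ e → size e ≤? 2 ^ p) E)

smallSum-++ : ∀ p E F → smallSum p (E ++ F) ≡ smallSum p E + smallSum p F
smallSum-++ p E F = trans (cong bsum (filter-++ (λ e → size e ≤? 2 ^ p) E F)) (bsum-++ (filter _ E) (filter _ F))

bsum-partition : ∀ p E → bsum E ≡ smallSum p E + bsum (filter (λ e → ¬? (size e ≤? 2 ^ p)) E)
bsum-partition p E = trans (bsum-↭ (filter-partition (λ e → size e ≤? 2 ^ p) E)) (bsum-++ (filter (λ e → size e ≤? 2 ^ p) E) _)

-- When nothing can be merged, every bundle has `bsum` at least 2^p. By `shape` it is then exactly
-- 2^p, or the bundle contains no small element. So the small elements all lie in bundles of `bsum`
-- 2^p, and at least two of these are needed to hold them.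
final⇒two-bundles : ∀ {p E bs} → MergeInvariant p E bs → AllPairs (Unmergeable p) bs →
  2 ^ p ∣ bsum E → 2 ^ p + 2 ^ p ≤ smallSum p E →
  ∃[ b₁ ] ∃[ b₂ ] ∃[ rest ] bs ↭ b₁ ∷ b₂ ∷ rest × bsum b₁ ≡ 2 ^ p × bsum b₂ ≡ 2 ^ p
final⇒two-bundles {p} {E} {bs} inv un d enough = two-of-filter full? bs (*-cancelʳ-≤ 2 _ (2 ^ p) {{m^n≢0 2 p}} (begin
  2 * 2 ^ p                          ≡⟨ 2^-suc p ⟩
  2 ^ p + 2 ^ p                      ≤⟨ enough ⟩
  smallSum p E                       ≡⟨ bsum-↭ (filter-↭ small? content) ⟨
  smallSum p (concat bs)             ≤⟨ bound bs shape large ⟩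
  length (filter full? bs) * 2 ^ p   ∎))
  where
  open ≤-Reasoning
  open MergeInvariant inv
  small? : ∀ e → Dec (size e ≤ 2 ^ p)
  small? e = size e ≤? 2 ^ p
  full? : ∀ b → Dec (bsum b ≡ 2 ^ p)
  full? b = bsum b ≟ 2 ^ p
  large : All (λ b → 2 ^ p ≤ bsum b) bs
  large = All.map⁻ (all-large p (All.map⁺ pows) (AllPairs.map⁺ un)
    (subst (2 ^ p ∣_) (sym (trans (bsum-concat bs) (bsum-↭ content))) d))
  bound : ∀ bs → All (λ b → bsum b ≤ 2 ^ p ⊎ All (λ e → 2 ^ p < size e) b) bs →
    All (λ b → 2 ^ p ≤ bsum b) bs → smallSum p (concat bs) ≤ length (filter full? bs) * 2 ^ p
  bound [] _ _ = z≤n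
  bound (b ∷ bs) (inj₁ ≤p ∷ sh) (≥p ∷ la) = begin
    smallSum p (b ++ concat bs)                  ≡⟨ smallSum-++ p b (concat bs) ⟩
    smallSum p b + smallSum p (concat bs)        ≤⟨ +-mono-≤ (≤-trans (m≤m+n _ _) (≤-reflexive (sym (bsum-partition p b)))) (bound bs sh la) ⟩
    bsum b + length (filter full? bs) * 2 ^ p    ≤⟨ +-monoˡ-≤ _ ≤p ⟩
    2 ^ p + length (filter full? bs) * 2 ^ p     ≡⟨ cong (λ l → length l * 2 ^ p) (filter-accept full? {x = b} {xs = bs} (≤-antisym ≤p ≥p)) ⟨
    length (filter full? (b ∷ bs)) * 2 ^ p       ∎
  bound (b ∷ bs) (inj₂ >p ∷ sh) (_ ∷ la) = begin
    smallSum p (b ++ concat bs)                  ≡⟨ smallSum-++ p b (concat bs) ⟩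
    smallSum p b + smallSum p (concat bs)        ≡⟨ cong (λ l → bsum l + smallSum p (concat bs)) (filter-none small? (All.map <⇒≱ >p)) ⟩
    smallSum p (concat bs)                       ≤⟨ bound bs sh la ⟩
    length (filter full? bs) * 2 ^ p             ≤⟨ *-monoˡ-≤ (2 ^ p) (length-filter-∷ full? b bs) ⟩
    length (filter full? (b ∷ bs)) * 2 ^ p       ∎

-- Moves of items

split₁ : ∀ {n} (X Y : Vector A n) i → (∀ k → k ≢ i → X k ≡ Y k) →
  ∃[ common ] toList X ↭ X i ∷ common × toList Y ↭ Y i ∷ common
split₁ {n = suc n} X Y zero same =
  toList (X ∘ suc) , ↭-refl ,
  prep (Y zero) (↭-reflexive (sym (tabulate-cong λ k → same (suc k) λ ())))
split₁ {n = suc n} X Y (suc i) same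
  with common , p , q ← split₁ (X ∘ suc) (Y ∘ suc) i (λ k k≢ → same (suc k) (k≢ ∘ Fin.suc-injective))
  with X zero | Y zero | same zero (λ ())
... | x | _ | refl =
  x ∷ common , ↭-trans (prep x p) (swap x (X (suc i)) ↭-refl) , ↭-trans (prep x q) (swap x (Y (suc i)) ↭-refl)

-- Passes from vectors that agree outside two positions to lists with a common remainder, the form
-- in which `Adjacent` is stated.
split₂ : ∀ {n} (X Y : Vector A n) {i j} → i ≢ j → (∀ k → k ≢ i → k ≢ j → X k ≡ Y k) →
  ∃[ common ] toList X ↭ X i ∷ X j ∷ common × toList Y ↭ Y i ∷ Y j ∷ common
split₂ {n = suc n} X Y {zero} {zero} i≢j same = contradiction refl i≢j
split₂ {n = suc n} X Y {zero} {suc j} i≢j same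
  with common , p , q ← split₁ (X ∘ suc) (Y ∘ suc) j (λ k k≢ → same (suc k) (λ ()) (k≢ ∘ Fin.suc-injective))
  = common , prep (X zero) p , prep (Y zero) q
split₂ {n = suc n} X Y {suc i} {zero} i≢j same
  with common , p , q ← split₁ (X ∘ suc) (Y ∘ suc) i (λ k k≢ → same (suc k) (k≢ ∘ Fin.suc-injective) (λ ()))
  = common , ↭-trans (prep (X zero) p) (swap _ _ ↭-refl) , ↭-trans (prep (Y zero) q) (swap _ _ ↭-refl)
split₂ {n = suc n} X Y {suc i} {suc j} i≢j same
  with common , p , q ← split₂ (X ∘ suc) (Y ∘ suc) (i≢j ∘ cong suc)
                          (λ k k≢i k≢j → same (suc k) (k≢i ∘ Fin.suc-injective) (k≢j ∘ Fin.suc-injective))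
  with X zero | Y zero | same zero (λ ()) (λ ())
... | x | _ | refl = x ∷ common , ↭-trans (prep x p) (rotate x _ _) , ↭-trans (prep x q) (rotate x _ _)
  where
  rotate : ∀ x y z {xs} → x ∷ y ∷ z ∷ xs ↭ y ∷ z ∷ x ∷ xs
  rotate x y z = ↭-trans (swap x y ↭-refl) (prep y (swap x z ↭-refl))

module ≋ where
  open import Data.List.Relation.Binary.Permutation.Setoid (↭-setoid {A = ℕ}) public
    using (refl; prep; swap; trans; ↭-refl; ↭-sym; onIndices)
  open import Data.List.Relation.Binary.Permutation.Setoid.Properties (↭-setoid {A = ℕ}) public
    using (xs↭ys⇒|xs|≡|ys|; ++⁺; onIndices-lookup; All-resp-↭; map⁺)

↭⇒≋ : ∀ {C D : Configuration} → C ↭ D → C ≋ D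
↭⇒≋ = ↭⇒↭ₛ′ (Setoid.isEquivalence ↭-setoid)

concat-≋ : ∀ {C D} → C ≋ D → concat C ↭ concat D
concat-≋ (≋.refl ps) = pointwise ps
  where
  open import Data.List.Relation.Binary.Pointwise using (Pointwise; []; _∷_)
  pointwise : ∀ {C D : Configuration} → Pointwise _↭_ C D → concat C ↭ concat D
  pointwise []       = ↭-refl
  pointwise (p ∷ ps) = ++⁺ p (pointwise ps)
concat-≋ (≋.prep p q)    = ++⁺ p (concat-≋ q)
concat-≋ (≋.swap {x = x} {y} p q r) = ↭-trans (shifts x y) (++⁺ q (++⁺ p (concat-≋ r)))
concat-≋ (≋.trans p q)   = ↭-trans (concat-≋ p) (concat-≋ q)

-- A relation rather than the function `moveTo`, so that it also describes the net effect of
-- `moveAll`, whatever the order in which the items are taken.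
record Moved (us : List ℕ) {n} (i j : Fin n) (C C′ : Vector Bunch n) : Set where
  field
    source : C i ↭ us ++ C′ i
    target : C′ j ↭ us ++ C j
    others : ∀ k → k ≢ i → k ≢ j → C′ k ≡ C k

moved-refl : ∀ {n} {i j : Fin n} {C} → Moved [] i j C C
moved-refl = record { source = ↭-refl ; target = ↭-refl ; others = λ _ _ _ → refl }

moved-cons : ∀ {us u vs n} {i j : Fin n} {C C′ C″} → us ↭ u ∷ vs →
  Moved [ u ] i j C C′ → Moved vs i j C′ C″ → Moved us i j C C″
moved-cons {us} {u} {vs} {i = i} {j} {C} {C′} {C″} p m n = record
  { source = ↭-trans (Moved.source m) (↭-trans (prep u (Moved.source n)) (++⁺ʳ (C″ i) (↭-sym p)))
  ; target = ↭-trans (Moved.target n) (↭-trans (++⁺ˡ vs (Moved.target m)) (↭-trans (shift u vs (C j)) (++⁺ʳ (C j) (↭-sym p))))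
  ; others = λ k k≢i k≢j → trans (Moved.others n k k≢i k≢j) (Moved.others m k k≢i k≢j)
  }

moveTo-moved : ∀ {n u} (C : Vector Bunch n) {i j} → i ≢ j → (u∈ : u ∈ C i) → Moved [ u ] i j C (moveTo C i j u∈)
moveTo-moved {u = u} C {i} {j} i≢j u∈ = record
  { source = ↭-trans (∈⇒↭ u∈) (prep u (↭-reflexive (sym (trans
      (updateAt-minimal i j {u ∷_} (updateAt C i (const (C i ─ u∈))) i≢j)
      (updateAt-updates i C)))))
  ; target = ↭-reflexive (trans
      (updateAt-updates j (updateAt C i (const (C i ─ u∈))))
      (cong (u ∷_) (updateAt-minimal j i C (i≢j ∘ sym))))
  ; others = λ k k≢i k≢j → trans
      (updateAt-minimal k j (updateAt C i (const (C i ─ u∈))) k≢j)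
      (updateAt-minimal k i C k≢i)
  }

module _ {us : List ℕ} {n : ℕ} {i j : Fin n} {C C′ : Vector Bunch n} (i≢j : i ≢ j) (m : Moved us i j C C′) where
  open Moved m

  moved-split : ∃[ common ] toList C ↭ C i ∷ C j ∷ common × toList C′ ↭ C′ i ∷ C′ j ∷ common
  moved-split = split₂ C C′ i≢j (λ k k≢i k≢j → sym (others k k≢i k≢j))

  moved-underlying : underlying (toList C′) ↭ underlying (toList C)
  moved-underlying with common , p , q ← moved-split =
    ↭-trans (concat-↭ q) (↭-trans exchange (↭-sym (concat-↭ p)))
    where
    exchange : ∀ {xs} → C′ i ++ C′ j ++ xs ↭ C i ++ C j ++ xs
    exchange {xs} = begin
      C′ i ++ C′ j ++ xs            ↭⟨ ++⁺ˡ (C′ i) (++⁺ʳ xs target) ⟩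
      C′ i ++ (us ++ C j) ++ xs     ≡⟨ cong (C′ i ++_) (++-assoc us (C j) xs) ⟩
      C′ i ++ us ++ C j ++ xs       ↭⟨ shifts (C′ i) us ⟩
      us ++ C′ i ++ C j ++ xs       ≡⟨ ++-assoc us (C′ i) (C j ++ xs) ⟨
      (us ++ C′ i) ++ C j ++ xs     ↭⟨ ++⁺ʳ (C j ++ xs) (↭-sym source) ⟩
      C i ++ C j ++ xs              ∎
      where open PermutationReasoning

  moved-legal : ∀ {κ} → (∀ k → vol (C k) ≤ κ) → sum us + vol (C j) ≤ κ → ∀ k → vol (C′ k) ≤ κ
  moved-legal {κ} legal fits k with k Fin.≟ i | k Fin.≟ j
  ... | yes refl | _ = ≤-trans (m≤n+m (vol (C′ k)) (sum us))
    (subst (_≤ κ) (trans (sum-↭ source) (sum-++ us (C′ k))) (legal k))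
  ... | no k≢i | yes refl = subst (_≤ κ) (sym (trans (sum-↭ target) (sum-++ us (C k)))) fits
  ... | no k≢i | no k≢j   = subst (λ B → vol B ≤ κ) (sym (others k k≢i k≢j)) (legal k)

  moved-atLeast : ∀ {s} → All (_< s) us → ∀ k → atLeast s (C′ k) ↭ atLeast s (C k)
  moved-atLeast {s} us< k with k Fin.≟ i | k Fin.≟ j
  ... | yes refl | _      = ↭-sym (↭-trans (atLeast-↭ s source) (unaffected (C′ k)))
    where
    unaffected : ∀ X → atLeast s (us ++ X) ↭ atLeast s X
    unaffected X = ↭-reflexive (trans (atLeast-++ s us X) (cong (_++ atLeast s X) (atLeast-none us<)))
  ... | no k≢i | yes refl = ↭-trans (atLeast-↭ s target)
    (↭-reflexive (trans (atLeast-++ s us (C k)) (cong (_++ atLeast s (C k)) (atLeast-none us<))))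
  ... | no k≢i | no k≢j   = ↭-reflexive (cong (atLeast s) (others k k≢i k≢j))

length-↭∷ : ∀ {u : A} {xs ys} → xs ↭ u ∷ ys → ¬ (xs ↭ ys)
length-↭∷ p q = 1+n≢n (trans (sym (↭-length p)) (↭-length q))

-- `Adjacent` demands disjoint differences. These fail to be disjoint only when the two bunches
-- exchange their contents, and then the configuration is the same multiset as before.
moved⇒adjacent : ∀ {u n} {i j : Fin n} {C C′} → i ≢ j → Moved [ u ] i j C C′ →
  toList C ≋ toList C′ ⊎ Adjacent (toList C) (toList C′)
moved⇒adjacent {u} {i = i} {j} {C} {C′} i≢j m
  with common , p , q ← moved-split i≢j m
  with C i ↭? C′ j
... | yes same = inj₁ (≋.trans (↭⇒≋ p) (≋.trans
  (≋.swap same (drop-∷ (↭-trans (↭-sym (Moved.target m)) (↭-trans (↭-sym same) (Moved.source m)))) ≋.↭-refl)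
  (↭⇒≋ (↭-sym q))))
... | no different = inj₂ (record
  { differences = common , ↭⇒≋ p , ↭⇒≋ q , disjoint
  ; removed     = Moved.source m
  ; added       = Moved.target m
  })
  where
  disjoint : Disjoint (C i ∷ C j ∷ []) (C′ i ∷ C′ j ∷ [])
  disjoint (here a         , here b)         = length-↭∷ (Moved.source m) (↭-trans (↭-sym a) b)
  disjoint (here a         , there (here b)) = different (↭-trans (↭-sym a) b)
  -- If the old receiver equals the new donor, adding `u` to both makes the old donor equal to the
  -- new receiver, which is the excluded case.
  disjoint (there (here a) , here b)         = different (↭-trans (Moved.source m)
    (↭-trans (prep u (↭-trans (↭-sym b) a)) (↭-sym (Moved.target m))))
  disjoint (there (here a) , there (here b)) = length-↭∷ (Moved.target m) (↭-trans (↭-sym b) a)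

-- Total slack, slack items and the elements of a bunch

totalSlack-vol : ∀ {κ C} → Legal κ C → totalSlack κ C + vol (underlying C) ≡ length C * κ
totalSlack-vol [] = refl
totalSlack-vol {κ} {B ∷ C} (l ∷ ls) = begin
  (slack κ B + totalSlack κ C) + vol (B ++ underlying C)          ≡⟨ cong (slack κ B + totalSlack κ C +_) (sum-++ B (underlying C)) ⟩
  (slack κ B + totalSlack κ C) + (vol B + vol (underlying C))     ≡⟨ interchange (slack κ B) (totalSlack κ C) (vol B) (vol (underlying C)) ⟩
  (slack κ B + vol B) + (totalSlack κ C + vol (underlying C))     ≡⟨ cong₂ _+_ (m∸n+n≡m l) (totalSlack-vol ls) ⟩
  κ + length C * κ                                                ∎
  where open ≡-Reasoning

-- Total slack and total volume add up to κ times the number of bunches, so the slack is the same in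
-- all configurations that moves can reach. Hence a single comparison with ℓ at the start suffices
-- in both directions of the theorem.
totalSlack-cong : ∀ {κ C D} → Legal κ C → Legal κ D → length C ≡ length D →
  underlying C ↭ underlying D → totalSlack κ C ≡ totalSlack κ D
totalSlack-cong {κ} {C} {D} lC lD len p = +-cancelʳ-≡ (vol (underlying C)) _ _ (begin
  totalSlack κ C + vol (underlying C)   ≡⟨ totalSlack-vol lC ⟩
  length C * κ                          ≡⟨ cong (_* κ) len ⟩
  length D * κ                          ≡⟨ totalSlack-vol lD ⟨
  totalSlack κ D + vol (underlying D)   ≡⟨ cong (totalSlack κ D +_) (sum-↭ p) ⟨
  totalSlack κ D + vol (underlying C)   ∎)
  where open ≡-Reasoning

slackSize : Element → Maybe ℕ
slackSize (actual _)    = nothing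
slackSize (slackItem s) = just s

slackSizes : Bundle → List ℕ
slackSizes = mapMaybe slackSize

actualItems-elements : ∀ B S → actualItems (map actual B ++ map slackItem S) ≡ B
actualItems-elements (u ∷ B) S       = cong (u ∷_) (actualItems-elements B S)
actualItems-elements []      []      = refl
actualItems-elements []      (s ∷ S) = actualItems-elements [] S

slackSizes-elements : ∀ B S → slackSizes (map actual B ++ map slackItem S) ≡ S
slackSizes-elements (u ∷ B) S       = slackSizes-elements B S
slackSizes-elements []      []      = refl
slackSizes-elements []      (s ∷ S) = cong (s ∷_) (slackSizes-elements [] S)

bsum-split : ∀ b → bsum b ≡ sum (actualItems b) + sum (slackSizes b)
bsum-split [] = refl
bsum-split (actual u ∷ b) = trans (cong (u +_) (bsum-split b)) (sym (+-assoc u _ _))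
bsum-split (slackItem s ∷ b) = trans (cong (s +_) (bsum-split b)) (x∙yz≈y∙xz s (sum (actualItems b)) (sum (slackSizes b)))

sum-slackItems : ∀ κ B → sum (slackItems κ B) ≡ slack κ B
sum-slackItems κ B = sum-binaryPowers (slack κ B)

bsum-allElements : ∀ {κ} B → vol B ≤ κ → bsum (allElements κ B) ≡ κ
bsum-allElements {κ} B legal = begin
  bsum (allElements κ B)
    ≡⟨ bsum-split (allElements κ B) ⟩
  sum (actualItems (allElements κ B)) + sum (slackSizes (allElements κ B))
    ≡⟨ cong₂ (λ xs ys → sum xs + sum ys) (actualItems-elements B (slackItems κ B)) (slackSizes-elements B (slackItems κ B)) ⟩
  vol B + sum (slackItems κ B)
    ≡⟨ cong (vol B +_) (sum-slackItems κ B) ⟩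
  vol B + slack κ B
    ≡⟨ m+[n∸m]≡n legal ⟩
  κ ∎
  where open ≡-Reasoning

allElements-powers : ∀ κ {B} → All PowerOfTwo B → All (PowerOfTwo ∘ size) (allElements κ B)
allElements-powers κ {B} ps = All.++⁺ (All.map⁺ ps) (All.map⁺ (binaryPowers-powers (slack κ B)))

actual-∈ : ∀ {b u} → u ∈ actualItems b → actual u ∈ b
actual-∈ {actual u ∷ b}    (here refl) = here refl
actual-∈ {actual u ∷ b}    (there u∈)  = there (actual-∈ u∈)
actual-∈ {slackItem s ∷ b} u∈          = there (actual-∈ u∈)

actualItems-≤ : ∀ b → All (_≤ bsum b) (actualItems b)
actualItems-≤ b = All.tabulate λ u∈ → ∈⇒≤sum (∈-map⁺ size (actual-∈ {b} u∈))

slackItem-≤ : ∀ {κ B s} → s ∈ slackItems κ B → s ≤ slack κ B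
slackItem-≤ {κ} {B} {s} s∈ = subst (s ≤_) (sum-slackItems κ B) (∈⇒≤sum s∈)

module _ {κ : ℕ} {B : Bunch} {b rest : Bundle} (p : b ++ rest ↭ allElements κ B) where

  items-split : B ↭ actualItems b ++ actualItems rest
  items-split = begin
    B                                        ≡⟨ actualItems-elements B (slackItems κ B) ⟨
    actualItems (allElements κ B)            ↭⟨ mapMaybe-↭ actualItem p ⟨
    actualItems (b ++ rest)                  ≡⟨ mapMaybe-++ actualItem b rest ⟩
    actualItems b ++ actualItems rest        ∎
    where open PermutationReasoning

  slackItems-split : slackItems κ B ↭ slackSizes b ++ slackSizes rest
  slackItems-split = begin
    slackItems κ B                           ≡⟨ slackSizes-elements B (slackItems κ B) ⟨
    slackSizes (allElements κ B)             ↭⟨ mapMaybe-↭ slackSize p ⟨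
    slackSizes (b ++ rest)                   ≡⟨ mapMaybe-++ slackSize b rest ⟩
    slackSizes b ++ slackSizes rest          ∎
    where open PermutationReasoning

sum>0⇒length>0 : ∀ xs → 0 < sum xs → 0 < length xs
sum>0⇒length>0 (_ ∷ _) _ = s≤s z≤n

sum-positive : ∀ {xs} → xs ≢ [] → All PowerOfTwo xs → 0 < sum xs
sum-positive {[]}     ne _       = contradiction refl ne
sum-positive {x ∷ xs} _  (p ∷ _) = <-≤-trans (powerOfTwo>0 p) (m≤m+n x (sum xs))

-- Two bundles of slack items with equal sums would let the slack be written
-- with fewer powers of two than its binary expansion has.
some-actual : ∀ {κ B q b₁ b₂ rest} → b₁ ++ b₂ ++ rest ↭ allElements κ B →
  bsum b₁ ≡ 2 ^ q → bsum b₂ ≡ 2 ^ q → actualItems b₁ ≡ [] → actualItems b₂ ≢ []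
some-actual {κ} {B} {q} {b₁} {b₂} {rest} p e₁ e₂ n₁ n₂ = <⇒≱ shorter minimal
  where
  S  = slackItems κ B
  s₁ = slackSizes b₁
  s₂ = slackSizes b₂
  r  = slackSizes rest
  S↭ : S ↭ s₁ ++ s₂ ++ r
  S↭ = subst (λ xs → S ↭ s₁ ++ xs) (mapMaybe-++ slackSize b₂ rest) (slackItems-split {κ} {B} {b₁} {b₂ ++ rest} p)
  slack-sum : ∀ b → actualItems b ≡ [] → bsum b ≡ 2 ^ q → sum (slackSizes b) ≡ 2 ^ q
  slack-sum b none e = trans (sym (trans (bsum-split b) (cong (λ xs → sum xs + sum (slackSizes b)) none))) e
  sum₁ = slack-sum b₁ n₁ e₁
  sum₂ = slack-sum b₂ n₂ e₂
  L = 2 ^ suc q ∷ r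
  sum-L : sum L ≡ slack κ B
  sum-L = begin
    2 ^ suc q + sum r           ≡⟨ cong (_+ sum r) (2^-suc q) ⟩
    2 ^ q + 2 ^ q + sum r       ≡⟨ cong₂ (λ x y → x + y + sum r) sum₁ sum₂ ⟨
    sum s₁ + sum s₂ + sum r     ≡⟨ +-assoc (sum s₁) (sum s₂) (sum r) ⟩
    sum s₁ + (sum s₂ + sum r)   ≡⟨ cong (sum s₁ +_) (sum-++ s₂ r) ⟨
    sum s₁ + sum (s₂ ++ r)      ≡⟨ sum-++ s₁ (s₂ ++ r) ⟨
    sum (s₁ ++ s₂ ++ r)         ≡⟨ sum-↭ S↭ ⟨
    sum S                       ≡⟨ sum-slackItems κ B ⟩
    slack κ B                   ∎
    where open ≡-Reasoning
  powers-L : All PowerOfTwo L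
  powers-L = (suc q , refl) ∷ All.++⁻ʳ s₂ (All.++⁻ʳ s₁ (All-resp-↭ S↭ (binaryPowers-powers (slack κ B))))
  minimal : length S ≤ length L
  minimal = subst (λ x → length (binaryPowers x) ≤ length L) sum-L (binaryPowers-min powers-L)
  nonempty : ∀ xs → sum xs ≡ 2 ^ q → 0 < length xs
  nonempty xs e = sum>0⇒length>0 xs (subst (0 <_) (sym e) (2^>0 q))
  shorter : length L < length S
  shorter = begin-strict
    1 + length r                             <⟨ +-mono-≤ (nonempty s₁ sum₁) (+-monoˡ-≤ (length r) (nonempty s₂ sum₂)) ⟩
    length s₁ + (length s₂ + length r)       ≡⟨ cong (length s₁ +_) (length-++ s₂) ⟨
    length s₁ + length (s₂ ++ r)             ≡⟨ length-++ s₁ ⟨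
    length (s₁ ++ s₂ ++ r)                   ≡⟨ ↭-length S↭ ⟨
    length S                                 ∎
    where open ≤-Reasoning

-- Serves the receiving bunch too, with the bunch after the move in the role of `X`.
slack-source : ∀ {κ} us {X X′} → X ↭ us ++ X′ → vol X ≤ κ → slack κ X′ ≡ slack κ X + sum us
slack-source {κ} us {X} {X′} p legal = begin
  κ ∸ vol X′                                ≡⟨ cong (_∸ vol X′) (m∸n+n≡m legal) ⟨
  (κ ∸ vol X) + vol X ∸ vol X′              ≡⟨ cong (λ v → (κ ∸ vol X) + v ∸ vol X′) vol-X ⟩
  (κ ∸ vol X) + (sum us + vol X′) ∸ vol X′  ≡⟨ cong (_∸ vol X′) (+-assoc (κ ∸ vol X) (sum us) (vol X′)) ⟨
  (κ ∸ vol X) + sum us + vol X′ ∸ vol X′    ≡⟨ m+n∸n≡m _ (vol X′) ⟩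
  κ ∸ vol X + sum us                        ∎
  where
  open ≡-Reasoning
  vol-X : vol X ≡ sum us + vol X′
  vol-X = trans (sum-↭ p) (sum-++ us X′)

-- The slack of the first bunch becomes rest − 2^q + 2^(q+1), where rest is
-- what its slack has outside the bundle b; in the second bunch, the slack items
-- of b replace 2^q.
mergeSlack-fewer : ∀ {κ q b rest X X′ Y Y′} →
  All PowerOfTwo X → vol X ≤ κ → vol Y′ ≤ κ →
  2 ^ q ∈ slackItems κ X → 2 ^ q ∈ slackItems κ Y →
  b ++ rest ↭ allElements κ X → bsum b ≡ 2 ^ q → actualItems b ≢ [] →
  X ↭ actualItems b ++ X′ → Y′ ↭ actualItems b ++ Y →
  length (slackItems κ X′) + length (slackItems κ Y′) < length (slackItems κ X) + length (slackItems κ Y)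
mergeSlack-fewer {κ} {q} {b} {rest} {X} {X′} {Y} {Y′} powers-X legal-X legal-Y′ q∈X q∈Y p bsum≡ some X↭ Y′↭ =
  ≤-trans (s≤s (+-mono-≤ min-X min-Y)) (≤-reflexive lengths)
  where
  us = actualItems b
  SX = slackItems κ X
  SY = slackItems κ Y
  s  = slackSizes b
  r  = slackSizes rest
  SX↭ : SX ↭ s ++ r
  SX↭ = slackItems-split {κ} {X} {b} {rest} p
  powers-SX = All-resp-↭ SX↭ (binaryPowers-powers (slack κ X))
  items+slack : sum us + sum s ≡ 2 ^ q
  items+slack = trans (sym (bsum-split b)) bsum≡
  us-positive : 0 < sum us
  us-positive = sum-positive some (All.++⁻ˡ us (All-resp-↭ X↭ powers-X))
  -- The bundle has `bsum` 2^q and contains an actual item, so it has no room for the slack item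
  -- 2^q, which must therefore lie in the rest.
  q∈r : 2 ^ q ∈ r
  q∈r with ∈-++⁻ s (∈-resp-↭ SX↭ q∈X)
  ... | inj₂ q∈r = q∈r
  ... | inj₁ q∈s = contradiction items+slack
    (>⇒≢ (<-≤-trans (m<n+m (2 ^ q) us-positive) (+-monoʳ-≤ (sum us) (∈⇒≤sum q∈s))))
  r′ = r ─ q∈r
  y′ = SY ─ q∈Y
  L = 2 ^ suc q ∷ r′
  M = s ++ y′
  sum-L : sum L ≡ slack κ X′
  sum-L = +-cancelʳ-≡ (sum s) _ _ (begin
    2 ^ suc q + sum r′ + sum s                ≡⟨ cong (λ x → x + sum r′ + sum s) (2^-suc q) ⟩
    2 ^ q + 2 ^ q + sum r′ + sum s            ≡⟨ cong (_+ sum s) (+-assoc (2 ^ q) (2 ^ q) (sum r′)) ⟩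
    2 ^ q + (2 ^ q + sum r′) + sum s          ≡⟨ cong (λ x → 2 ^ q + x + sum s) (sum-↭ (∈⇒↭ q∈r)) ⟨
    2 ^ q + sum r + sum s                     ≡⟨ +-assoc (2 ^ q) (sum r) (sum s) ⟩
    2 ^ q + (sum r + sum s)                   ≡⟨ cong₂ _+_ items+slack (+-comm (sum s) (sum r)) ⟨
    sum us + sum s + (sum s + sum r)          ≡⟨ cong (sum us + sum s +_) (trans (sym (sum-++ s r)) (trans (sym (sum-↭ SX↭)) (sum-slackItems κ X))) ⟩
    sum us + sum s + slack κ X                ≡⟨ +-comm (sum us + sum s) (slack κ X) ⟩
    slack κ X + (sum us + sum s)              ≡⟨ +-assoc (slack κ X) (sum us) (sum s) ⟨
    slack κ X + sum us + sum s                ≡⟨ cong (_+ sum s) (slack-source us X↭ legal-X) ⟨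
    slack κ X′ + sum s                        ∎)
    where open ≡-Reasoning
  sum-M : sum M ≡ slack κ Y′
  sum-M = +-cancelʳ-≡ (sum us) _ _ (begin
    sum (s ++ y′) + sum us                    ≡⟨ +-comm _ (sum us) ⟩
    sum us + sum (s ++ y′)                    ≡⟨ cong (sum us +_) (sum-++ s y′) ⟩
    sum us + (sum s + sum y′)                 ≡⟨ +-assoc (sum us) (sum s) (sum y′) ⟨
    sum us + sum s + sum y′                   ≡⟨ cong (_+ sum y′) items+slack ⟩
    2 ^ q + sum y′                            ≡⟨ sum-↭ (∈⇒↭ q∈Y) ⟨
    sum SY                                    ≡⟨ sum-slackItems κ Y ⟩
    slack κ Y                                 ≡⟨ slack-source us Y′↭ legal-Y′ ⟩
    slack κ Y′ + sum us                       ∎)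
    where open ≡-Reasoning
  min-X : length (slackItems κ X′) ≤ length L
  min-X = subst (λ x → length (binaryPowers x) ≤ length L) sum-L
    (binaryPowers-min ((suc q , refl) ∷ All.tail (All-resp-↭ (∈⇒↭ q∈r) (All.++⁻ʳ s powers-SX))))
  min-Y : length (slackItems κ Y′) ≤ length M
  min-Y = subst (λ x → length (binaryPowers x) ≤ length M) sum-M
    (binaryPowers-min (All.++⁺ (All.++⁻ˡ s powers-SX) (All.tail (All-resp-↭ (∈⇒↭ q∈Y) (binaryPowers-powers (slack κ Y))))))
  -- `L` is as long as `r`, having 2^(q+1) in place of 2^q, while `M` is one shorter than `s` and
  -- `SY` together. That missing element is the strict decrease.
  lengths : suc (length L + length M) ≡ length SX + length SY
  lengths = begin
    suc (length L + length M)                               ≡⟨ cong₂ (λ x y → suc (x + y)) (↭-length (∈⇒↭ q∈r)) (sym (length-++ s)) ⟨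
    suc (length r + (length s + length y′))                 ≡⟨ +-suc (length r) _ ⟨
    length r + suc (length s + length y′)                   ≡⟨ cong (length r +_) (+-suc (length s) (length y′)) ⟨
    length r + (length s + suc (length y′))                 ≡⟨ +-assoc (length r) (length s) _ ⟨
    length r + length s + suc (length y′)                   ≡⟨ cong₂ _+_ (trans (+-comm (length s) (length r)) refl) (↭-length (∈⇒↭ q∈Y)) ⟨
    length s + length r + length SY                         ≡⟨ cong (_+ length SY) (trans (↭-length SX↭) (length-++ s)) ⟨
    length SX + length SY                                   ∎
    where open ≡-Reasoning

-- Runs of SettleItems

sum-concat : ∀ xss → sum (concat xss) ≡ sum (map sum xss)
sum-concat []         = refl
sum-concat (xs ∷ xss) = trans (sum-++ xs (concat xss)) (cong (sum xs +_) (sum-concat xss))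

room : ∀ {κ B u} → vol B ≤ κ → u ≤ slack κ B → sum [ u ] + vol B ≤ κ
room {κ} {B} {u} legal fits = begin
  u + 0 + vol B          ≡⟨ cong (_+ vol B) (+-identityʳ u) ⟩
  u + vol B              ≤⟨ +-monoˡ-≤ (vol B) fits ⟩
  slack κ B + vol B      ≡⟨ m∸n+n≡m legal ⟩
  κ                      ∎
  where open ≤-Reasoning

potential : ℕ → Configuration → ℕ
potential κ C = sum (map (length ∘ slackItems κ) C)

moved-∈ : ∀ {us u n} {i j t : Fin n} {C C′} → Moved us i j C C′ → t ≢ i → u ∈ C t → u ∈ C′ t
moved-∈ {us} {j = j} {t} {C} m t≢i u∈ with t Fin.≟ j
... | yes refl = ∈-resp-↭ (↭-sym (Moved.target m)) (∈-++⁺ʳ us u∈)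
... | no t≢j   = subst (_ ∈_) (sym (Moved.others m t t≢i t≢j)) u∈

-- As the slack is below u = 2^(p+1), the elements exceeding 2^p are just the actual items of size
-- at least u. The hypothesis says that these leave at least u of the total κ, which the small
-- elements must fill.
atLeast⇒smallSum : ∀ {κ p B} → All PowerOfTwo B → vol B ≤ κ → slack κ B < 2 ^ suc p →
  sum (atLeast (2 ^ suc p) B) + 2 ^ suc p ≤ κ → 2 ^ p + 2 ^ p ≤ smallSum p (allElements κ B)
atLeast⇒smallSum {κ} {p} {B} powers legal slack< fits = +-cancelˡ-≤ (sum (atLeast u B)) _ _ (begin
  sum (atLeast u B) + (2 ^ p + 2 ^ p)          ≡⟨ cong (sum (atLeast u B) +_) (2^-suc p) ⟨
  sum (atLeast u B) + u                        ≤⟨ fits ⟩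
  κ                                            ≡⟨ bsum-allElements B legal ⟨
  bsum E                                       ≡⟨ bsum-partition p E ⟩
  smallSum p E + bsum (filter large? E)        ≤⟨ +-monoʳ-≤ (smallSum p E) large-sum ⟩
  smallSum p E + sum (atLeast u B)             ≡⟨ +-comm (smallSum p E) _ ⟩
  sum (atLeast u B) + smallSum p E             ∎)
  where
  open ≤-Reasoning
  u = 2 ^ suc p
  E = allElements κ B
  large? : ∀ e → Dec (¬ size e ≤ 2 ^ p)
  large? e = ¬? (size e ≤? 2 ^ p)
  no-large-slack : filter large? (map slackItem (slackItems κ B)) ≡ []
  no-large-slack = filter-none large? (All.map⁺ (All.tabulate small))
    where
    small : ∀ {s} → s ∈ slackItems κ B → ¬ ¬ s ≤ 2 ^ p
    small s∈ s≰ with All.lookup (binaryPowers-powers (slack κ B)) s∈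
    ... | k , refl = s≰ (^-monoʳ-≤ 2 (≤-pred (2^-cancel-< k (suc p) (≤-<-trans (slackItem-≤ {κ} {B} s∈) slack<))))
  large-actual : ∀ {X} → All PowerOfTwo X → bsum (filter large? (map actual X)) ≤ sum (atLeast u X)
  large-actual [] = z≤n
  large-actual {x ∷ X} (px ∷ pX) = case x ≤? 2 ^ p of λ where
    (yes small) → begin
      bsum (filter large? (map actual (x ∷ X)))   ≡⟨ cong bsum (filter-reject large? {x = actual x} {xs = map actual X} (λ f → f small)) ⟩
      bsum (filter large? (map actual X))         ≤⟨ large-actual pX ⟩
      sum (atLeast u X)                           ≡⟨ cong sum (filter-reject (u ≤?_) {xs = X} (<⇒≱ (≤-<-trans small (^-monoʳ-< 2 (n<1+n 1) (n<1+n p))))) ⟨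
      sum (atLeast u (x ∷ X))                     ∎
    (no large) → begin
      bsum (filter large? (map actual (x ∷ X)))   ≡⟨ cong bsum (filter-accept large? {x = actual x} {xs = map actual X} large) ⟩
      x + bsum (filter large? (map actual X))     ≤⟨ +-monoʳ-≤ x (large-actual pX) ⟩
      x + sum (atLeast u X)                       ≡⟨ cong sum (filter-accept (u ≤?_) {xs = X} (∣⇒≤ {{>-nonZero (powerOfTwo>0 px)}} (powerOfTwo-<⇒∣ p px (≰⇒> large)))) ⟨
      sum (atLeast u (x ∷ X))                     ∎
  large-sum : bsum (filter large? E) ≤ sum (atLeast u B)
  large-sum = begin
    bsum (filter large? E)
      ≡⟨ cong bsum (trans (filter-++ large? (map actual B) _) (trans (cong (filter large? (map actual B) ++_) no-large-slack) (++-identityʳ _))) ⟩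
    bsum (filter large? (map actual B))
      ≤⟨ large-actual powers ⟩
    sum (atLeast u B) ∎

-- Modulo 2^(q+1): κ is a power of two above 2^q, and so is every element exceeding 2^q. Hence the
-- small elements sum to a multiple of 2^(q+1), and this multiple is positive because the slack item
-- 2^q is one of them.
slackItem⇒smallSum : ∀ {κ q B} → PowerOfTwo κ → All PowerOfTwo B → vol B ≤ κ →
  2 ^ q < κ → 2 ^ q ∈ slackItems κ B → 2 ^ q + 2 ^ q ≤ smallSum q (allElements κ B)
slackItem⇒smallSum {κ} {q} {B} κ-power powers legal q<κ q∈ = begin
  2 ^ q + 2 ^ q     ≡⟨ 2^-suc q ⟨
  2 ^ suc q         ≤⟨ ∣⇒≤ {{>-nonZero positive}} divides-small ⟩
  smallSum q E      ∎
  where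
  open ≤-Reasoning
  E = allElements κ B
  small? : ∀ e → Dec (size e ≤ 2 ^ q)
  small? e = size e ≤? 2 ^ q
  large? : ∀ e → Dec (¬ size e ≤ 2 ^ q)
  large? e = ¬? (size e ≤? 2 ^ q)
  divides-large : 2 ^ suc q ∣ bsum (filter large? E)
  divides-large = ∣-sum (All.map⁺ (All.map (λ (p , l) → powerOfTwo-<⇒∣ q p (≰⇒> l))
    (All.zip (All.filter⁺ large? (allElements-powers κ powers) , All.all-filter large? E))))
  divides-small : 2 ^ suc q ∣ smallSum q E
  divides-small = ∣m+n∣m⇒∣n
    (subst (2 ^ suc q ∣_)
      (trans (sym (bsum-allElements B legal)) (trans (bsum-partition q E) (+-comm (smallSum q E) _)))
      (powerOfTwo-<⇒∣ q κ-power q<κ))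
    divides-large
  positive : 0 < smallSum q E
  positive = <-≤-trans (2^>0 q) (∈⇒≤sum (∈-map⁺ size
    (∈-filter⁺ small? {x = slackItem (2 ^ q)} (∈-++⁺ʳ (map actual B) (∈-map⁺ slackItem q∈)) ≤-refl)))

-- Each run lemma is a Hoare triple in continuation-passing style: every run
-- from a command succeeds provided that every run from the commands after it
-- does, whatever configuration the command leads to.
module Run {κ n m : ℕ} (T : Vector Bunch m) {U : List ℕ} (U-powers : All PowerOfTwo U) where
  open SettleItems κ {n} T public

  record Sound (C : Vector Bunch n) : Set where
    field
      legal : ∀ k → vol (C k) ≤ κ
      items : underlying (toList C) ↭ U

    isLegal : Legal κ (toList C)
    isLegal = All.tabulate⁺ legal

    ∈-U : ∀ {k u} → u ∈ C k → u ∈ U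
    ∈-U {k} u∈ = ∈-resp-↭ items (∈-concat⁺′ u∈ (∈-tabulate⁺ k))

    bunchPowers : ∀ k → All PowerOfTwo (C k)
    bunchPowers k = All.tabulate λ u∈ → All.lookup U-powers (∈-U u∈)

  open Sound

  moved-sound : ∀ {us i j C C′} → i ≢ j → Moved us i j C C′ → Sound C → sum us + vol (C j) ≤ κ → Sound C′
  moved-sound i≢j m sd fits = record
    { legal = moved-legal i≢j m (legal sd) fits
    ; items = ↭-trans (moved-underlying i≢j m) (items sd)
    }

  run-move : ∀ {u i j ks C} → i ≢ j → Sound C → u ∈ C i → sum [ u ] + vol (C j) ≤ κ →
    (∀ {C′} → Moved [ u ] i j C C′ → Sound C′ → AlwaysReconfigures (ks , C′)) →
    AlwaysReconfigures (moveItem u i j ∷ ks , C)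
  run-move {C = C} i≢j sd u∈ fits k = continue (isLegal sd) (_ , move-item i≢j u∈) λ where
    (move-item _ u∈′) → let m = moveTo-moved C i≢j u∈′ in
      moved⇒adjacent i≢j m , k m (moved-sound i≢j m sd fits)
    (move-none _) → contradiction refl i≢j

  run-moveAll : ∀ {us rest i j ks C} → i ≢ j → Sound C → C i ↭ us ++ rest → sum us + vol (C j) ≤ κ →
    (∀ {C′} → Moved us i j C C′ → Sound C′ → AlwaysReconfigures (ks , C′)) →
    AlwaysReconfigures (moveAll us i j ∷ ks , C)
  run-moveAll {us} {i = i} {j} i≢j = go (length us) refl
    where
    -- Recursion on the length, since a run may take any item of `us` next. The bound on the room is
    -- preserved because an item leaving `us` enters bunch `j`.
    go : ∀ l {us rest ks C} → length us ≡ l → Sound C → C i ↭ us ++ rest → sum us + vol (C j) ≤ κ →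
      (∀ {C′} → Moved us i j C C′ → Sound C′ → AlwaysReconfigures (ks , C′)) →
      AlwaysReconfigures (moveAll us i j ∷ ks , C)
    go zero {[]} _ sd _ _ k = continue (isLegal sd) (_ , moveAll-end) λ where
      moveAll-end       → inj₁ ≋.↭-refl , k moved-refl sd
      (moveAll-next ())
    go (suc l) {us@(x ∷ xs)} {rest} {C = C} len sd C↭ fits k =
      continue (isLegal sd) (_ , moveAll-next (here refl)) λ where
        (moveAll-next {u = u} u∈) →
          let us↭ = ∈⇒↭ u∈
              vs  = us ─ u∈
              sum-us : sum us ≡ u + sum vs
              sum-us = sum-↭ us↭
              C↭′ = ↭-trans C↭ (++⁺ʳ rest us↭)
          in inj₁ ≋.↭-refl ,
             run-move i≢j sd (∈-resp-↭ (↭-sym C↭′) (here refl))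
               (≤-trans (+-monoˡ-≤ _ (subst (u + 0 ≤_) (sym sum-us) (+-monoʳ-≤ u z≤n))) fits)
               λ m sd′ → go l (suc-injective (trans (sym (↭-length us↭)) len)) sd′
                 (drop-∷ (↭-trans (↭-sym (Moved.source m)) C↭′))
                 (subst (_≤ κ)
                   (trans (cong (_+ vol (C j)) (trans sum-us (+-comm u (sum vs))))
                     (trans (+-assoc (sum vs) u _) (cong (sum vs +_) (sym (sum-↭ (Moved.target m))))))
                   fits)
                 λ m′ → k (moved-cons us↭ m m′)

  run-bundles : ∀ {i p return ks C} → Sound C → 2 ^ p ∣ κ →
    2 ^ p + 2 ^ p ≤ smallSum p (allElements κ (C i)) →
    (∀ {b₁ b₂ rest} → b₁ ++ b₂ ++ rest ↭ allElements κ (C i) → bsum b₁ ≡ 2 ^ p → bsum b₂ ≡ 2 ^ p →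
      AlwaysReconfigures (return b₁ b₂ ∷ ks , C)) →
    AlwaysReconfigures (bundles i p return ∷ ks , C)
  run-bundles {i} {p} {return} {ks} {C} sd p∣κ enough k = continue (isLegal sd) (_ , bundles-start) λ where
      bundles-start → inj₁ ≋.↭-refl ,
        go (<-wellFounded _) (mergeInvariant-start p (allElements-powers κ (bunchPowers sd i)))
    where
    E = allElements κ (C i)
    go : ∀ {bs} → Acc _<_ (length bs) → MergeInvariant p E bs → AlwaysReconfigures (merging p bs return ∷ ks , C)
    go {bs} (acc rec) inv = continue (isLegal sd) progress λ where
        (bundles-merge st) → inj₁ ≋.↭-refl , go (rec (MergeStep-length st)) (mergeInvariant-step inv st)
        (bundles-return _ p e₁ e₂) → inj₁ ≋.↭-refl ,
          k (↭-trans (↭-sym (concat-↭ p)) (MergeInvariant.content inv)) e₁ e₂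
      where
      progress : ∃[ σ ] (merging p bs return ∷ ks , C) ⟶ σ
      progress with mergeable? p bs (MergeInvariant.pows inv)
      ... | inj₁ (_ , st) = _ , bundles-merge st
      ... | inj₂ un with final⇒two-bundles inv un (subst (2 ^ p ∣_) (sym (bsum-allElements (C i) (legal sd i))) p∣κ) enough
      ...   | _ , _ , _ , bs↭ , e₁ , e₂ = _ , bundles-return (unmergeable⇒final un) bs↭ e₁ e₂

empty? : (xs : List A) → Dec (xs ≡ [])
empty? []      = yes refl
empty? (_ ∷ _) = no λ ()

sum-actualItems-≤ : ∀ b → sum (actualItems b) ≤ bsum b
sum-actualItems-≤ b = ≤-trans (m≤m+n _ (sum (slackSizes b))) (≤-reflexive (sym (bsum-split b)))

potential-moved : ∀ {κ us n} {i j : Fin n} {C C′} → i ≢ j → Moved us i j C C′ →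
  length (slackItems κ (C′ i)) + length (slackItems κ (C′ j)) < length (slackItems κ (C i)) + length (slackItems κ (C j)) →
  potential κ (toList C′) < potential κ (toList C)
potential-moved {κ} {i = i} {j} {C} {C′} i≢j m less with common , p , q ← moved-split i≢j m = begin-strict
  sum (map f (toList C′))                       ≡⟨ sum-↭ (map⁺ f q) ⟩
  f (C′ i) + (f (C′ j) + sum (map f common))    ≡⟨ +-assoc (f (C′ i)) _ _ ⟨
  f (C′ i) + f (C′ j) + sum (map f common)      <⟨ +-monoˡ-< _ less ⟩
  f (C i) + f (C j) + sum (map f common)        ≡⟨ +-assoc (f (C i)) _ _ ⟩
  f (C i) + (f (C j) + sum (map f common))      ≡⟨ sum-↭ (map⁺ f p) ⟨
  sum (map f (toList C))                        ∎
  where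
  open ≤-Reasoning
  f = length ∘ slackItems κ

-- Compression phase

module Compression {κ n m : ℕ} (T : Vector Bunch m) {U : List ℕ}
                   (κ-power : PowerOfTwo κ) (U-powers : All PowerOfTwo U) where
  open Run {κ} {n} T U-powers public
  open Sound

  -- All that a stage remembers about compression and about the exchange of bundles, both of which
  -- move only items smaller than `u`.
  SameAtLeast : ℕ → Vector Bunch n → Vector Bunch n → Set
  SameAtLeast u C C′ = ∀ k → atLeast u (C′ k) ↭ atLeast u (C k)

  -- Bunch `j` can receive either bundle: its slack contains 2^q, and the actual items of a bundle
  -- amount to at most 2^q. For the same reason each of them is smaller than `u`.
  run-mergeSlack : ∀ {u i j q ks C} → u ≤ κ → Mergeable u C i j q → Sound C →
    (∀ {C′} → potential κ (toList C′) < potential κ (toList C) → SameAtLeast u C C′ → Sound C′ →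
      AlwaysReconfigures (ks , C′)) →
    AlwaysReconfigures (mergeSlack i j q ∷ ks , C)
  run-mergeSlack {u} {i} {j} {q} {ks} {C} u≤κ (i≢j , q<u , q∈i , q∈j) sd k =
    run-bundles sd 2^q∣κ enough choose
    where
    q<κ : 2 ^ q < κ
    q<κ = <-≤-trans q<u u≤κ
    2^q∣κ : 2 ^ q ∣ κ
    2^q∣κ = powerOfTwo-∣ q κ-power (<⇒≤ q<κ)
    enough = slackItem⇒smallSum {κ} {q} {C i} κ-power (bunchPowers sd i) (legal sd i) q<κ q∈i
    finish : ∀ b rest → b ++ rest ↭ allElements κ (C i) → bsum b ≡ 2 ^ q → actualItems b ≢ [] →
      AlwaysReconfigures (moveAll (actualItems b) i j ∷ ks , C)
    finish b rest p e some = run-moveAll i≢j sd (items-split {κ} {C i} {b} {rest} p) fits λ mv sd′ →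
      k (potential-moved i≢j mv (mergeSlack-fewer {κ} {q} {b} {rest} (bunchPowers sd i) (legal sd i) (legal sd′ j)
           q∈i q∈j p e some (Moved.source mv) (Moved.target mv)))
        (moved-atLeast i≢j mv (All.map (λ ≤b → ≤-<-trans ≤b (subst (_< u) (sym e) q<u)) (actualItems-≤ b)))
        sd′
      where
      open ≤-Reasoning
      fits : sum (actualItems b) + vol (C j) ≤ κ
      fits = begin
        sum (actualItems b) + vol (C j)   ≤⟨ +-monoˡ-≤ _ (≤-trans (sum-actualItems-≤ b) (≤-trans (≤-reflexive e) (slackItem-≤ {κ} {C j} q∈j))) ⟩
        slack κ (C j) + vol (C j)         ≡⟨ m∸n+n≡m (legal sd j) ⟩
        κ                                 ∎
    choose : ∀ {b₁ b₂ rest} → b₁ ++ b₂ ++ rest ↭ allElements κ (C i) → bsum b₁ ≡ 2 ^ q → bsum b₂ ≡ 2 ^ q →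
      AlwaysReconfigures (chooseOne i j b₁ b₂ ∷ ks , C)
    choose {b₁} {b₂} {rest} p e₁ e₂ = continue (isLegal sd) progress λ where
        (choose-first some)  → inj₁ ≋.↭-refl , finish b₁ (b₂ ++ rest) p e₁ some
        (choose-second some) → inj₁ ≋.↭-refl , finish b₂ (b₁ ++ rest) (↭-trans (shifts b₂ b₁) p) e₂ some
      where
      progress : ∃[ σ ] (chooseOne i j b₁ b₂ ∷ ks , C) ⟶ σ
      progress with empty? (actualItems b₁)
      ... | no some  = _ , choose-first some
      ... | yes none = _ , choose-second (some-actual {κ} {C i} {q} {b₁} {b₂} {rest} p e₁ e₂ none)

  mergeable-bunches? : ∀ u C → Dec (∃[ i ] ∃[ j ] ∃[ q ] Mergeable u C i j q)
  -- The exponent ranges over all of ℕ, so the search runs through the slack items common to two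
  -- bunches; the exponent is recovered from such an item being a power of two.
  mergeable-bunches? u C = map′ to from (Fin.any? λ i → Fin.any? λ j →
    ¬? (i Fin.≟ j) ×-dec any? (λ x → x <? u ×-dec any? (x ≟_) (slackItems κ (C j))) (slackItems κ (C i)))
    where
    to : (∃[ i ] ∃[ j ] i ≢ j × Any (λ x → x < u × x ∈ slackItems κ (C j)) (slackItems κ (C i))) →
      ∃[ i ] ∃[ j ] ∃[ q ] Mergeable u C i j q
    to (i , j , i≢j , common) with find common
    ... | x , x∈ , x<u , x∈′ with All.lookup (binaryPowers-powers (slack κ (C i))) x∈
    ...   | q , refl = i , j , q , i≢j , x<u , x∈ , x∈′
    from : (∃[ i ] ∃[ j ] ∃[ q ] Mergeable u C i j q) →
      ∃[ i ] ∃[ j ] i ≢ j × Any (λ x → x < u × x ∈ slackItems κ (C j)) (slackItems κ (C i))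
    from (i , j , q , i≢j , q<u , q∈i , q∈j) = i , j , i≢j , lose q∈i (q<u , q∈j)

  Compressed : ℕ → Vector Bunch n → Set
  Compressed u C = ∀ i j q → ¬ Mergeable u C i j q

  run-compress : ∀ {u ks C} → u ≤ κ → Sound C →
    (∀ {C′} → Compressed u C′ → SameAtLeast u C C′ → Sound C′ → AlwaysReconfigures (ks , C′)) →
    AlwaysReconfigures (compress u ∷ ks , C)
  run-compress {u} {ks} {C₀} u≤κ sd₀ k = go (<-wellFounded _) sd₀ (λ _ → ↭-refl)
    where
    go : ∀ {C} → Acc _<_ (potential κ (toList C)) → Sound C → SameAtLeast u C₀ C →
      AlwaysReconfigures (compress u ∷ ks , C)
    go {C} (acc rec) sd same = continue (isLegal sd) progress λ where
        (compress-end done)       → inj₁ ≋.↭-refl , k done same sd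
        (compress-loop mergeable) → inj₁ ≋.↭-refl , run-mergeSlack u≤κ mergeable sd λ less same′ sd′ →
          go (rec less) sd′ (λ l → ↭-trans (same′ l) (same l))
      where
      progress : ∃[ σ ] (compress u ∷ ks , C) ⟶ σ
      progress with mergeable-bunches? u C
      ... | yes (_ , _ , q , mergeable) = _ , compress-loop {q = q} mergeable
      ... | no none = _ , compress-end (λ i j q mergeable → none (i , j , q , mergeable))

  -- After compression all slack items smaller than u are distinct powers of
  -- two, so together they are less than u.
  compressed⇒large-slack : ∀ {u C} → PowerOfTwo u → Compressed u C → u ≤ totalSlack κ (toList C) →
    ∃[ t ] Any (u ≤_) (slackItems κ (C t))
  compressed⇒large-slack {u} {C} (k , refl) compressed enough
    with Fin.any? (λ t → any? (u ≤?_) (slackItems κ (C t)))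
  ... | yes found = found
  ... | no none = contradiction enough (<⇒≱ (begin-strict
    totalSlack κ (toList C)            ≡⟨ cong sum (map-tabulate C (slack κ)) ⟩
    sum (tabulate (slack κ ∘ C))       ≡⟨ cong sum (tabulate-cong (λ t → sym (sum-slackItems κ (C t)))) ⟩
    sum (tabulate (sum ∘ S))           ≡⟨ cong sum (map-tabulate S sum) ⟨
    sum (map sum (tabulate S))         ≡⟨ sum-concat (tabulate S) ⟨
    sum (concat (tabulate S))          <⟨ sum-distinct-powers k
                                            (All.concat⁺ (All.tabulate⁺ powers-S))
                                            (All.concat⁺ (All.tabulate⁺ small))
                                            (Unique.concat⁺ (All.tabulate⁺ (λ t → binaryPowers-unique (slack κ (C t))))
                                                            (AllPairs.tabulate⁺ disjoint)) ⟩
    2 ^ k                              ∎))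
    where
    open ≤-Reasoning
    S : Fin n → List ℕ
    S t = slackItems κ (C t)
    powers-S : ∀ t → All PowerOfTwo (S t)
    powers-S t = binaryPowers-powers (slack κ (C t))
    small : ∀ t → All (_< 2 ^ k) (S t)
    small t = All.map ≰⇒> (All.¬Any⇒All¬ (S t) (λ large → none (t , large)))
    disjoint : ∀ {i j} → i ≢ j → ∀ {x} → ¬ (x ∈ S i × x ∈ S j)
    disjoint {i} {j} i≢j (x∈i , x∈j) with All.lookup (powers-S i) x∈i
    ... | q , refl = compressed i j q (i≢j , All.lookup (small i) x∈i , x∈i , x∈j)

-- Transfer phase

record Transferred (u : ℕ) {n} (s d : Fin n) (C C′ : Vector Bunch n) : Set where
  field
    loses : atLeast u (C s) ↭ u ∷ atLeast u (C′ s)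
    gains : atLeast u (C′ d) ↭ u ∷ atLeast u (C d)
    keeps : ∀ k → k ≢ s → k ≢ d → atLeast u (C′ k) ↭ atLeast u (C k)

atLeast-∷ : ∀ u xs → atLeast u (u ∷ xs) ≡ u ∷ atLeast u xs
atLeast-∷ u xs = filter-accept (u ≤?_) ≤-refl

moved⇒transferred : ∀ {u n} {s d : Fin n} {C C′} → Moved [ u ] s d C C′ → Transferred u s d C C′
moved⇒transferred {u} {d = d} {C} {C′} m = record
  { loses = ↭-trans (atLeast-↭ u source) (↭-reflexive (atLeast-∷ u (C′ _)))
  ; gains = ↭-trans (atLeast-↭ u target) (↭-reflexive (atLeast-∷ u (C d)))
  ; keeps = λ k k≢s k≢d → ↭-reflexive (cong (atLeast u) (others k k≢s k≢d))
  }
  where open Moved m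

transferred-resp : ∀ {u n} {s d : Fin n} {C D C′} → (∀ k → atLeast u (D k) ↭ atLeast u (C k)) →
  Transferred u s d D C′ → Transferred u s d C C′
transferred-resp {s = s} {d} same t = record
  { loses = ↭-trans (↭-sym (same s)) loses
  ; gains = ↭-trans gains (prep _ (same d))
  ; keeps = λ k k≢s k≢d → ↭-trans (keeps k k≢s k≢d) (same k)
  }
  where open Transferred t

-- The temporary bunch gains a copy of `u` and loses one again, so the detour is invisible among the
-- items of size at least `u`. `Transferred` looks at no other items, which gives both kinds of
-- transfer the same description.
transferred-via : ∀ {u n} {s d t : Fin n} {C C₁ C₂ C₃} → s ≢ t → s ≢ d → t ≢ d →
  Transferred u s t C C₁ → (∀ k → atLeast u (C₂ k) ↭ atLeast u (C₁ k)) → Transferred u t d C₂ C₃ →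
  Transferred u s d C C₃
transferred-via {u} {s = s} {d} {t} {C} {C₁} {C₂} {C₃} s≢t s≢d t≢d p same q = record
  { loses = ↭-trans p.loses (prep u (↭-trans (↭-sym (same s)) (↭-sym (q.keeps s s≢t s≢d))))
  ; gains = ↭-trans q.gains (prep u (↭-trans (same d) (p.keeps d (s≢d ∘ sym) (t≢d ∘ sym))))
  ; keeps = keeps
  }
  where
  module p = Transferred p
  module q = Transferred q
  keeps : ∀ k → k ≢ s → k ≢ d → atLeast u (C₃ k) ↭ atLeast u (C k)
  keeps k k≢s k≢d with k Fin.≟ t
  ... | yes refl = drop-∷ (↭-trans (↭-sym q.loses) (↭-trans (same k) p.gains))
  ... | no k≢t   = ↭-trans (q.keeps k k≢t k≢d) (↭-trans (same k) (p.keeps k k≢s k≢t))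

module Transfer {κ n m : ℕ} (T : Vector Bunch m) {U : List ℕ}
                (κ-power : PowerOfTwo κ) (U-powers : All PowerOfTwo U) where
  open Compression {κ} {n} T κ-power U-powers public
  open Sound

  -- The two bundles together have `bsum` u. Their slack elements were slack of bunch `d` already,
  -- so once their actual items have left, the slack of `d` is at least u. As `t` may be the bunch
  -- `s`, the room in `s` is the separate hypothesis `space`, which has a different origin in each
  -- case.
  run-exchange : ∀ {p s d t ks C} → t ≢ d → s ≢ d → 2 ^ suc p ≤ κ → Sound C → 2 ^ suc p ∈ C t →
    slack κ (C d) < 2 ^ suc p → sum (atLeast (2 ^ suc p) (C d)) + 2 ^ suc p ≤ κ →
    2 ^ suc p + vol (C s) ≤ κ →
    (∀ {C₂ C₃} → SameAtLeast (2 ^ suc p) C C₂ → Moved [ 2 ^ suc p ] t d C₂ C₃ → Sound C₃ →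
      AlwaysReconfigures (ks , C₃)) →
    AlwaysReconfigures
      (bundles d p (λ b₁ b₂ → moveAll (actualItems b₁ ++ actualItems b₂) d s) ∷ moveItem (2 ^ suc p) t d ∷ ks , C)
  run-exchange {p} {s} {d} {t} {ks} {C} t≢d s≢d u≤κ sd u∈t slack< fits space k =
    run-bundles sd (powerOfTwo-∣ p κ-power (≤-trans (<⇒≤ 2^p<u) u≤κ))
      (atLeast⇒smallSum {κ} {p} {C d} (bunchPowers sd d) (legal sd d) slack< fits)
      (λ {b₁} {b₂} {rest} → exchange {b₁} {b₂} {rest})
    where
    u = 2 ^ suc p
    2^p<u : 2 ^ p < u
    2^p<u = ^-monoʳ-< 2 (n<1+n 1) (n<1+n p)
    exchange : ∀ {b₁ b₂ rest} → b₁ ++ b₂ ++ rest ↭ allElements κ (C d) → bsum b₁ ≡ 2 ^ p → bsum b₂ ≡ 2 ^ p →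
      AlwaysReconfigures (moveAll (actualItems b₁ ++ actualItems b₂) d s ∷ moveItem u t d ∷ ks , C)
    exchange {b₁} {b₂} {rest} b↭ e₁ e₂ =
      run-moveAll (s≢d ∘ sym) sd
        (subst (λ us → C d ↭ us ++ actualItems rest) us≡ (items-split {κ} {C d} {b} {rest} b↭′))
        (≤-trans (+-monoˡ-≤ (vol (C s)) us≤u) space)
        λ {C₂} mv sd₂ →
          run-move t≢d sd₂ (moved-∈ mv t≢d u∈t)
            (room {κ} {C₂ d} (legal sd₂ d) (subst (u ≤_) (sym (slack-source us (Moved.source mv) (legal sd d))) u≤slack))
            λ mv′ sd₃ → k (moved-atLeast (s≢d ∘ sym) mv us<u) mv′ sd₃
      where
      b = b₁ ++ b₂
      us = actualItems b₁ ++ actualItems b₂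
      us≡ : actualItems b ≡ us
      us≡ = mapMaybe-++ actualItem b₁ b₂
      b↭′ : b ++ rest ↭ allElements κ (C d)
      b↭′ = ↭-trans (↭-reflexive (++-assoc b₁ b₂ rest)) b↭
      bsum-b : bsum b ≡ u
      bsum-b = trans (bsum-++ b₁ b₂) (trans (cong₂ _+_ e₁ e₂) (sym (2^-suc p)))
      us≤u : sum us ≤ u
      us≤u = subst₂ _≤_ (cong sum us≡) bsum-b (sum-actualItems-≤ b)
      small : ∀ c → bsum c ≡ 2 ^ p → All (_< u) (actualItems c)
      small c e = All.map (λ x≤ → ≤-<-trans x≤ (subst (_< u) (sym e) 2^p<u)) (actualItems-≤ c)
      us<u : All (_< u) us
      us<u = All.++⁺ (small b₁ e₁) (small b₂ e₂)
      open ≤-Reasoning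
      slack-part : sum (slackSizes b) ≤ slack κ (C d)
      slack-part = begin
        sum (slackSizes b)                            ≤⟨ m≤m+n _ _ ⟩
        sum (slackSizes b) + sum (slackSizes rest)    ≡⟨ sum-++ (slackSizes b) _ ⟨
        sum (slackSizes b ++ slackSizes rest)         ≡⟨ sum-↭ (slackItems-split {κ} {C d} {b} {rest} b↭′) ⟨
        sum (slackItems κ (C d))                      ≡⟨ sum-slackItems κ (C d) ⟩
        slack κ (C d)                                 ∎
      u≤slack : u ≤ slack κ (C d) + sum us
      u≤slack = begin
        u                                       ≡⟨ bsum-b ⟨
        bsum b                                  ≡⟨ bsum-split b ⟩
        sum (actualItems b) + sum (slackSizes b) ≡⟨ cong (λ xs → sum xs + sum (slackSizes b)) us≡ ⟩
        sum us + sum (slackSizes b)             ≤⟨ +-monoʳ-≤ (sum us) slack-part ⟩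
        sum us + slack κ (C d)                  ≡⟨ +-comm (sum us) _ ⟩
        slack κ (C d) + sum us                  ∎

  large-slack : ∀ {B u} → Any (u ≤_) (slackItems κ B) → u ≤ slack κ B
  large-slack {B} large with find large
  ... | x , x∈ , u≤x = ≤-trans u≤x (slackItem-≤ {κ} {B} x∈)

  transfer-progress : ∀ {u s d ks C t} → PowerOfTwo u → Sound C → sum (atLeast u (C d)) + u ≤ κ →
    Any (u ≤_) (slackItems κ (C t)) → ∃[ σ ] (transfer u s d ∷ ks , C) ⟶ σ
  transfer-progress {u} {d = d} {C = C} u-power sd fits large with u ≤? slack κ (C d) | u-power
  ... | yes u≤slack | _            = _ , transfer-direct large u≤slack
  ... | no  u≰slack | suc p , refl = _ , transfer-via {p = p} large (≰⇒> u≰slack) refl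
  -- For u = 1 there is no half to make bundles of. But every item has size at least 1, so `fits`
  -- already grants slack 1 and the transfer is direct.
  ... | no  u≰slack | zero  , refl = contradiction (m+n≤o⇒m≤o∸n 1 (begin
    1 + vol (C d)                 ≡⟨ +-comm 1 (vol (C d)) ⟩
    vol (C d) + 1                 ≡⟨ cong (λ B → sum B + 1) (atLeast-all (All.map powerOfTwo>0 (bunchPowers sd d))) ⟨
    sum (atLeast 1 (C d)) + 1     ≤⟨ fits ⟩
    κ                             ∎)) u≰slack
    where open ≤-Reasoning

  run-via : ∀ {u s d t p ks C} → u ≤ κ → s ≢ d → Sound C → u ∈ C s → sum (atLeast u (C d)) + u ≤ κ →
    u ≤ slack κ (C t) → slack κ (C d) < u → u ≡ 2 ^ suc p →
    (∀ {C′} → Transferred u s d C C′ → Sound C′ → AlwaysReconfigures (ks , C′)) →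
    AlwaysReconfigures (moveItem u s t
      ∷ bundles d p (λ b₁ b₂ → moveAll (actualItems b₁ ++ actualItems b₂) d s) ∷ moveItem u t d ∷ ks , C)
  run-via {u} {s} {d} {t} {p} {C = C} u≤κ s≢d sd u∈s fits u≤slack slack< refl k with s Fin.≟ t
  -- The temporary bunch is `s`: the first move does nothing, and the exchanged items fit into the
  -- slack of `s`.
  ... | yes refl = continue (isLegal sd) (_ , move-none u∈s) λ where
    (move-item s≢s _) → contradiction refl s≢s
    (move-none _) → inj₁ ≋.↭-refl ,
      run-exchange s≢d s≢d u≤κ sd u∈s slack< fits
        (subst (λ x → x + vol (C s) ≤ κ) (+-identityʳ u) (room {κ} {C s} (legal sd s) u≤slack))
        λ same mv → k (transferred-resp same (moved⇒transferred mv))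
  ... | no s≢t = run-move s≢t sd u∈s (room {κ} {C t} (legal sd t) u≤slack) λ {C₁} mv sd₁ →
    let C₁d≡Cd = Moved.others mv d (s≢d ∘ sym) (t≢d ∘ sym) in
    run-exchange t≢d s≢d u≤κ sd₁ (∈-resp-↭ (↭-sym (Moved.target mv)) (here refl))
      (subst (λ B → slack κ B < u) (sym C₁d≡Cd) slack<)
      (subst (λ B → sum (atLeast u B) + u ≤ κ) (sym C₁d≡Cd) fits)
      -- Here the departure of `u` from `s` has just made the room for the exchanged items.
      (subst (_≤ κ) (sum-↭ (Moved.source mv)) (legal sd s))
      λ same mv′ → k (transferred-via s≢t s≢d t≢d (moved⇒transferred mv) same (moved⇒transferred mv′))
    where
    t≢d : t ≢ d
    t≢d refl = contradiction u≤slack (<⇒≱ slack<)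

  run-transfer : ∀ {u s d ks C} → PowerOfTwo u → u ≤ κ → s ≢ d → Sound C → u ∈ C s →
    sum (atLeast u (C d)) + u ≤ κ → ∃[ t ] Any (u ≤_) (slackItems κ (C t)) →
    (∀ {C′} → Transferred u s d C C′ → Sound C′ → AlwaysReconfigures (ks , C′)) →
    AlwaysReconfigures (transfer u s d ∷ ks , C)
  run-transfer {C = C} u-power u≤κ s≢d sd u∈s fits (_ , large₀) k =
    -- `large₀` only shows that a step exists; the run may use another temporary bunch.
    continue (isLegal sd) (transfer-progress u-power sd fits large₀) λ where
      (transfer-direct _ u≤slack) → inj₁ ≋.↭-refl ,
        run-move s≢d sd u∈s (room {κ} {C _} (legal sd _) u≤slack) (λ mv → k (moved⇒transferred mv))
      (transfer-via {t = t} large slack< u≡) → inj₁ ≋.↭-refl ,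
        run-via u≤κ s≢d sd u∈s fits (large-slack {C t} large) slack< u≡ k

-- Sums along partial maps, and counting the items of one size

Σ-mono-≤ : ∀ {n} {f g : Fin n → ℕ} → (∀ i → f i ≤ g i) → sum (tabulate f) ≤ sum (tabulate g)
Σ-mono-≤ {zero}  f≤g = z≤n
Σ-mono-≤ {suc n} f≤g = +-mono-≤ (f≤g zero) (Σ-mono-≤ (f≤g ∘ suc))

Σ-mono-< : ∀ {n} {f g : Fin n → ℕ} → (∀ i → f i ≤ g i) → ∀ i → f i < g i → sum (tabulate f) < sum (tabulate g)
Σ-mono-< f≤g zero    f<g = +-mono-<-≤ f<g (Σ-mono-≤ (f≤g ∘ suc))
Σ-mono-< f≤g (suc i) f<g = +-mono-≤-< (f≤g zero) (Σ-mono-< (f≤g ∘ suc) i f<g)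

InjectivePartial : ∀ {n m} → PartialMap n m → Set
InjectivePartial φ = ∀ {i i′ j} → φ i ≡ just j → φ i′ ≡ just j → i ≡ i′

module _ (f : A → Maybe B) where

  ∈-mapMaybe⁺ : ∀ {x y xs} → x ∈ xs → f x ≡ just y → y ∈ mapMaybe f xs
  ∈-mapMaybe⁺ {xs = x ∷ xs} (here refl) eq with f x
  ∈-mapMaybe⁺ {xs = x ∷ xs} (here refl) refl | just y = here refl
  ∈-mapMaybe⁺ {xs = x ∷ xs} (there x∈)  eq with f x
  ... | just _  = there (∈-mapMaybe⁺ x∈ eq)
  ... | nothing = ∈-mapMaybe⁺ x∈ eq

  ∈-mapMaybe⁻ : ∀ {y} xs → y ∈ mapMaybe f xs → ∃[ x ] x ∈ xs × f x ≡ just y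
  ∈-mapMaybe⁻ (x ∷ xs) y∈ with f x in eq
  ∈-mapMaybe⁻ (x ∷ xs) (here refl) | just y  = x , here refl , eq
  ∈-mapMaybe⁻ (x ∷ xs) (there y∈)  | just _  with ∈-mapMaybe⁻ xs y∈
  ... | x′ , x∈ , e = x′ , there x∈ , e
  ∈-mapMaybe⁻ (x ∷ xs) y∈          | nothing with ∈-mapMaybe⁻ xs y∈
  ... | x′ , x∈ , e = x′ , there x∈ , e

  unique-mapMaybe : (∀ {x x′ y} → f x ≡ just y → f x′ ≡ just y → x ≡ x′) →
    ∀ {xs} → Unique xs → Unique (mapMaybe f xs)
  unique-mapMaybe inj []                   = []
  unique-mapMaybe inj {x ∷ xs} (x∉ ∷ uniq) with f x in eq
  ... | nothing = unique-mapMaybe inj uniq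
  ... | just y  = All.tabulate (λ y′∈ y≡y′ → case ∈-mapMaybe⁻ xs y′∈ of λ where
    (x′ , x′∈ , e) → All.lookup x∉ x′∈ (inj eq (trans e (cong just (sym y≡y′))))) ∷ unique-mapMaybe inj uniq

sum-filter-positive : ∀ (g : A → ℕ) xs → sum (map g (filter (λ x → 0 <? g x) xs)) ≡ sum (map g xs)
sum-filter-positive g [] = refl
sum-filter-positive g (x ∷ xs) with 0 <? g x
... | yes 0<g = trans (cong (sum ∘ map g) (filter-accept (λ x → 0 <? g x) 0<g)) (cong (g x +_) (sum-filter-positive g xs))
... | no ¬0<g = trans (cong (sum ∘ map g) (filter-reject (λ x → 0 <? g x) ¬0<g))
  (trans (sum-filter-positive g xs) (cong (_+ sum (map g xs)) (sym (n≤0⇒n≡0 (≮⇒≥ ¬0<g)))))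

sum-mapMaybe : ∀ {X Y : Set} (f : X → Maybe Y) (g : Y → ℕ) xs → sum (map (maybe g 0 ∘ f) xs) ≡ sum (map g (mapMaybe f xs))
sum-mapMaybe f g [] = refl
sum-mapMaybe f g (x ∷ xs) with f x
... | just y  = cong (g y +_) (sum-mapMaybe f g xs)
... | nothing = sum-mapMaybe f g xs

-- Indices where `g` vanishes change neither sum. On the remaining ones `φ` is a bijection onto its
-- targets, so both sums run over the same set of indices.
Σ-partial : ∀ {n m} {φ : PartialMap n m} (g : Fin m → ℕ) → InjectivePartial φ →
  (∀ j → 0 < g j → ∃[ i ] φ i ≡ just j) → sum (tabulate (maybe g 0 ∘ φ)) ≡ sum (tabulate g)
Σ-partial {n} {m} {φ} g inj covers = begin
  sum (tabulate (maybe g 0 ∘ φ))                ≡⟨ cong sum (map-tabulate id (maybe g 0 ∘ φ)) ⟨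
  sum (map (maybe g 0 ∘ φ) (allFin n))          ≡⟨ sum-mapMaybe φ g (allFin n) ⟩
  sum (map g targets)                           ≡⟨ sum-filter-positive g targets ⟨
  sum (map g (filter pos? targets))             ≡⟨ sum-↭ (map⁺ g (unique-set⇒↭
                                                     (Unique.filter⁺ pos? (unique-mapMaybe φ inj (Unique.allFin⁺ n)))
                                                     (Unique.filter⁺ pos? (Unique.allFin⁺ m)) ⊆ ⊇)) ⟩
  sum (map g (filter pos? (allFin m)))          ≡⟨ sum-filter-positive g (allFin m) ⟩
  sum (map g (allFin m))                        ≡⟨ cong sum (map-tabulate id g) ⟩
  sum (tabulate g)                              ∎
  where
  open ≡-Reasoning
  targets = mapMaybe φ (allFin n)
  pos? : ∀ j → Dec (0 < g j)
  pos? j = 0 <? g j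
  ⊆ : ∀ {j} → j ∈ filter pos? targets → j ∈ filter pos? (allFin m)
  ⊆ {j} j∈ = ∈-filter⁺ pos? (∈-allFin j) (proj₂ (∈-filter⁻ pos? {xs = targets} j∈))
  ⊇ : ∀ {j} → j ∈ filter pos? (allFin m) → j ∈ filter pos? targets
  ⊇ {j} j∈ with ∈-filter⁻ pos? {xs = allFin m} j∈
  ... | _ , 0<g with covers j 0<g
  ...   | i , eq = ∈-filter⁺ pos? (∈-mapMaybe⁺ φ (∈-allFin i) eq) 0<g

multiplicity-concat : ∀ u xss → multiplicity u (concat xss) ≡ sum (map (multiplicity u) xss)
multiplicity-concat u []         = refl
multiplicity-concat u (xs ∷ xss) = trans (multiplicity-++ u xs (concat xss)) (cong (multiplicity u xs +_) (multiplicity-concat u xss))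

atLeast-atLeast : ∀ {s t} → s ≤ t → ∀ xs → atLeast t (atLeast s xs) ≡ atLeast t xs
atLeast-atLeast {s} {t} s≤t [] = refl
atLeast-atLeast {s} {t} s≤t (x ∷ xs) with s ≤? x
... | no s≰x = trans (cong (atLeast t) (filter-reject (s ≤?_) s≰x))
  (trans (atLeast-atLeast s≤t xs) (sym (filter-reject (t ≤?_) {xs = xs} (s≰x ∘ ≤-trans s≤t))))
... | yes s≤x with t ≤? x
...   | yes t≤x = trans (cong (atLeast t) (filter-accept (s ≤?_) {xs = xs} s≤x))
  (trans (filter-accept (t ≤?_) {xs = atLeast s xs} t≤x)
    (trans (cong (x ∷_) (atLeast-atLeast s≤t xs)) (sym (filter-accept (t ≤?_) {xs = xs} t≤x))))
...   | no t≰x = trans (cong (atLeast t) (filter-accept (s ≤?_) {xs = xs} s≤x))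
  (trans (filter-reject (t ≤?_) {xs = atLeast s xs} t≰x)
    (trans (atLeast-atLeast s≤t xs) (sym (filter-reject (t ≤?_) {xs = xs} t≰x))))

multiplicity-atLeast : ∀ {s u} → s ≤ u → ∀ xs → multiplicity u (atLeast s xs) ≡ multiplicity u xs
multiplicity-atLeast {s} {u} s≤u [] = refl
multiplicity-atLeast {s} {u} s≤u (x ∷ xs) with u ≟ x
... | yes refl = begin
  multiplicity u (atLeast s (u ∷ xs))     ≡⟨ cong (multiplicity u) (filter-accept (s ≤?_) {xs = xs} s≤u) ⟩
  multiplicity u (u ∷ atLeast s xs)       ≡⟨ multiplicity-∷ u (atLeast s xs) ⟩
  suc (multiplicity u (atLeast s xs))     ≡⟨ cong suc (multiplicity-atLeast s≤u xs) ⟩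
  suc (multiplicity u xs)                 ≡⟨ multiplicity-∷ u xs ⟨
  multiplicity u (u ∷ xs)                 ∎
  where open ≡-Reasoning
... | no u≢x = trans drop (trans (multiplicity-atLeast s≤u xs) (cong length (sym (filter-reject (u ≟_) {xs = xs} u≢x))))
  where
  drop : multiplicity u (atLeast s (x ∷ xs)) ≡ multiplicity u (atLeast s xs)
  drop with s ≤? x
  ... | yes s≤x = trans (cong (multiplicity u) (filter-accept (s ≤?_) {xs = xs} s≤x)) (cong length (filter-reject (u ≟_) u≢x))
  ... | no s≰x  = cong (multiplicity u) (filter-reject (s ≤?_) {xs = xs} s≰x)

multiplicity-resp : ∀ {u} X Y → atLeast u X ↭ atLeast u Y → multiplicity u X ≡ multiplicity u Y
multiplicity-resp {u} X Y p =
  trans (sym (multiplicity-atLeast ≤-refl X)) (trans (multiplicity-↭ u p) (multiplicity-atLeast ≤-refl Y))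

atLeast-resp : ∀ {s t} X Y → s ≤ t → atLeast s X ↭ atLeast s Y → atLeast t X ↭ atLeast t Y
atLeast-resp {s} {t} X Y s≤t p =
  subst₂ _↭_ (atLeast-atLeast s≤t X) (atLeast-atLeast s≤t Y) (atLeast-↭ t p)

module _ {u : ℕ} {X Y : Bunch} (p : atLeast u X ↭ u ∷ atLeast u Y) where

  multiplicity-suc : multiplicity u X ≡ suc (multiplicity u Y)
  multiplicity-suc = begin
    multiplicity u X                        ≡⟨ multiplicity-atLeast ≤-refl X ⟨
    multiplicity u (atLeast u X)            ≡⟨ multiplicity-↭ u p ⟩
    multiplicity u (u ∷ atLeast u Y)        ≡⟨ multiplicity-∷ u (atLeast u Y) ⟩
    suc (multiplicity u (atLeast u Y))      ≡⟨ cong suc (multiplicity-atLeast ≤-refl Y) ⟩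
    suc (multiplicity u Y)                  ∎
    where open ≡-Reasoning

  atLeast-above : atLeast (suc u) X ↭ atLeast (suc u) Y
  atLeast-above = begin
    atLeast (suc u) X                       ≡⟨ atLeast-atLeast (n≤1+n u) X ⟨
    atLeast (suc u) (atLeast u X)           ↭⟨ atLeast-↭ (suc u) p ⟩
    atLeast (suc u) (u ∷ atLeast u Y)       ≡⟨ filter-reject (suc u ≤?_) {xs = atLeast u Y} (n≮n u) ⟩
    atLeast (suc u) (atLeast u Y)           ≡⟨ atLeast-atLeast (n≤1+n u) Y ⟩
    atLeast (suc u) Y                       ∎
    where open PermutationReasoning

sum-atLeast : ∀ u xs → sum (atLeast u xs) ≡ multiplicity u xs * u + sum (atLeast (suc u) xs)
sum-atLeast u xs = trans (sum-↭ (atLeast-split u xs))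
  (trans (sum-++ (replicate (multiplicity u xs) u) _) (cong (_+ sum (atLeast (suc u) xs)) (sum-replicate (multiplicity u xs) u)))

-- Action Step

module Action {κ n m : ℕ} (T : Vector Bunch m) {U : List ℕ}
              (κ-power : PowerOfTwo κ) (U-powers : All PowerOfTwo U)
              (T-legal : ∀ j → vol (T j) ≤ κ) (T-items : underlying (toList T) ↭ U) where
  open Transfer {κ} {n} T κ-power U-powers public
  open Sound

  -- Paired bunches already agree above `u`, and bunches outside `φ` hold nothing of size at least
  -- `u`. So every copy of `u`, here and in the target, lies in a paired bunch. The map stays fixed
  -- while `C` changes.
  record ActionInvariant (u : ℕ) (φ : PartialMap n m) (C : Vector Bunch n) : Set where
    field
      injective : InjectivePartial φ
      above     : ∀ {i j} → φ i ≡ just j → atLeast (suc u) (C i) ↭ atLeast (suc u) (T j)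
      covers    : ∀ {i} → HasAtLeast u (C i) → ∃[ j ] φ i ≡ just j
      coversT   : ∀ {j} → HasAtLeast u (T j) → ∃[ i ] φ i ≡ just j

  invariant-resp : ∀ {u φ C C′} → SameAtLeast u C C′ → ActionInvariant u φ C → ActionInvariant u φ C′
  invariant-resp {u} {C = C} {C′} same inv = record
    { injective = injective
    ; above     = λ {i} e → ↭-trans (atLeast-resp (C′ i) (C i) (n≤1+n u) (same i)) (above e)
    ; covers    = λ {i} h → covers (hasAtLeast-cong (same i) h)
    ; coversT   = coversT
    }
    where open ActionInvariant inv

  invariant-transferred : ∀ {u φ s d C C′} → Transferred u s d C C′ →
    (∃[ j ] φ s ≡ just j) → (∃[ j ] φ d ≡ just j) → ActionInvariant u φ C → ActionInvariant u φ C′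
  invariant-transferred {u} {φ} {s} {d} {C} {C′} tr s∈ d∈ inv = record
    { injective = injective
    ; above     = λ {i} e → ↭-trans (same-above i) (above e)
    ; covers    = covers′
    ; coversT   = coversT
    }
    where
    open ActionInvariant inv
    open Transferred tr
    same-above : ∀ i → atLeast (suc u) (C′ i) ↭ atLeast (suc u) (C i)
    same-above i with i Fin.≟ s | i Fin.≟ d
    ... | yes refl | _        = ↭-sym (atLeast-above {u} {C i} {C′ i} loses)
    ... | no _     | yes refl = atLeast-above {u} {C′ i} {C i} gains
    ... | no i≢s   | no i≢d   = atLeast-resp (C′ i) (C i) (n≤1+n u) (keeps i i≢s i≢d)
    covers′ : ∀ {i} → HasAtLeast u (C′ i) → ∃[ j ] φ i ≡ just j
    covers′ {i} h with i Fin.≟ s | i Fin.≟ d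
    ... | yes refl | _        = s∈
    ... | no _     | yes refl = d∈
    ... | no i≢s   | no i≢d   = covers (hasAtLeast-cong (keeps i i≢s i≢d) h)

  -- Truncated subtraction makes this count only surplus copies: a receiving bunch contributes
  -- nothing before or after a transfer, so the total strictly decreases.
  excess : ℕ → PartialMap n m → Vector Bunch n → Fin n → ℕ
  excess u φ C i = maybe (λ j → multiplicity u (C i) ∸ multiplicity u (T j)) 0 (φ i)

  totalExcess : ℕ → PartialMap n m → Vector Bunch n → ℕ
  totalExcess u φ C = sum (tabulate (excess u φ C))

  excess-just : ∀ {u φ C i j} → φ i ≡ just j → excess u φ C i ≡ multiplicity u (C i) ∸ multiplicity u (T j)
  excess-just {u} {C = C} {i} eq = cong (maybe (λ j → multiplicity u (C i) ∸ multiplicity u (T j)) 0) eq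

  excess-resp : ∀ {u φ C C′} i → multiplicity u (C i) ≡ multiplicity u (C′ i) → excess u φ C i ≡ excess u φ C′ i
  excess-resp {u} {φ} i eq = cong (λ x → maybe (λ j → x ∸ multiplicity u (T j)) 0 (φ i)) eq

  excess-transferred : ∀ {u φ s d C C′} → Transferred u s d C C′ → Surplus u φ C s → Deficit u φ C d →
    totalExcess u φ C′ < totalExcess u φ C
  excess-transferred {u} {φ} {s} {d} {C} {C′} tr (js , es , more) (jd , ed , fewer) = Σ-mono-< bound s decreases
    where
    open Transferred tr
    open ≤-Reasoning
    decreases : excess u φ C′ s < excess u φ C s
    decreases = begin-strict
      excess u φ C′ s                                        ≡⟨ excess-just {u} {φ} {C′} es ⟩
      multiplicity u (C′ s) ∸ multiplicity u (T js)          <⟨ ∸-monoˡ-< (≤-reflexive (sym (multiplicity-suc {u} {C s} {C′ s} loses))) (≤-pred (subst (multiplicity u (T js) <_) (multiplicity-suc {u} {C s} {C′ s} loses) more)) ⟩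
      multiplicity u (C s) ∸ multiplicity u (T js)           ≡⟨ excess-just {u} {φ} {C} es ⟨
      excess u φ C s                                         ∎
    bound : ∀ i → excess u φ C′ i ≤ excess u φ C i
    bound i with i Fin.≟ s | i Fin.≟ d
    ... | yes refl | _        = <⇒≤ decreases
    ... | no i≢s   | no i≢d   = ≤-reflexive (excess-resp {u} {φ} {C′} {C} i (multiplicity-resp (C′ i) (C i) (keeps i i≢s i≢d)))
    -- The receiver was short of at least one copy, so after gaining one it still does not exceed
    -- its target.
    ... | no _     | yes refl = begin
      excess u φ C′ i                                        ≡⟨ excess-just {u} {φ} {C′} ed ⟩
      multiplicity u (C′ i) ∸ multiplicity u (T jd)          ≡⟨ m≤n⇒m∸n≡0 (subst (_≤ multiplicity u (T jd)) (sym (multiplicity-suc {u} {C′ i} {C i} gains)) fewer) ⟩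
      0                                                      ≤⟨ z≤n ⟩
      excess u φ C i                                         ∎

  module _ {u : ℕ} {φ : PartialMap n m} {C : Vector Bunch n} (sd : Sound C) (inv : ActionInvariant u φ C) where
    open ActionInvariant inv

    private
      have want : Fin n → ℕ
      have i = multiplicity u (C i)
      want i = maybe (multiplicity u ∘ T) 0 (φ i)

    -- The target holds as many copies of `u` as the current configuration, and each lies in a bunch
    -- that `φ` reaches, so reindexing along `φ` loses none.
    Σ-have≡Σ-want : sum (tabulate have) ≡ sum (tabulate want)
    Σ-have≡Σ-want = begin
      sum (tabulate have)                         ≡⟨ count C ⟨
      multiplicity u (underlying (toList C))      ≡⟨ multiplicity-↭ u (↭-trans (items sd) (↭-sym T-items)) ⟩
      multiplicity u (underlying (toList T))      ≡⟨ count T ⟩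
      sum (tabulate (multiplicity u ∘ T))         ≡⟨ Σ-partial {φ = φ} (multiplicity u ∘ T) injective
                                                       (λ j 0< → coversT (lose (multiplicity>0⇒∈ u (T j) 0<) ≤-refl)) ⟨
      sum (tabulate want)                         ∎
      where
      open ≡-Reasoning
      count : ∀ {l} (D : Vector Bunch l) → multiplicity u (underlying (toList D)) ≡ sum (tabulate (multiplicity u ∘ D))
      count D = trans (multiplicity-concat u (toList D)) (cong sum (map-tabulate D (multiplicity u)))

    less⇒deficit : ∀ i → have i < want i → Deficit u φ C i
    less⇒deficit i lt with φ i in eq
    ... | just j = j , refl , lt

    more⇒surplus : ∀ i → want i < have i → Surplus u φ C i
    more⇒surplus i gt with covers (lose (multiplicity>0⇒∈ u (C i) (≤-<-trans z≤n gt)) ≤-refl)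
    ... | j , eq = j , eq , subst (_< have i) (cong (maybe (multiplicity u ∘ T) 0) eq) gt

    -- With equal totals, a surplus somewhere forces a deficit elsewhere and conversely; the action
    -- loop is never left with only one of them.
    balanced-or-unbalanced : Balanced u φ C ⊎ ∃[ s ] ∃[ d ] Surplus u φ C s × Deficit u φ C d
    balanced-or-unbalanced with Fin.any? (λ i → want i <? have i) | Fin.any? (λ i → have i <? want i)
    ... | yes (s , gt) | yes (d , lt) = inj₂ (s , d , more⇒surplus s gt , less⇒deficit d lt)
    ... | yes (s , gt) | no none      = contradiction (sym Σ-have≡Σ-want) (<⇒≢ (Σ-mono-< (λ i → ≮⇒≥ (λ lt → none (i , lt))) s gt))
    ... | no none      | yes (d , lt) = contradiction Σ-have≡Σ-want (<⇒≢ (Σ-mono-< (λ i → ≮⇒≥ (λ gt → none (i , gt))) d lt))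
    ... | no none      | no none′     = inj₁ λ i j eq →
      trans (≤-antisym (≮⇒≥ (λ gt → none (i , gt))) (≮⇒≥ (λ lt → none′ (i , lt)))) (cong (maybe (multiplicity u ∘ T) 0) eq)

    -- The target bunch holds the same larger items and at least one more copy of `u`, yet it is
    -- legal. This is where the bundles of the transfer get their room from.
    deficit-fits : ∀ {d} → Deficit u φ C d → sum (atLeast u (C d)) + u ≤ κ
    deficit-fits {d} (j , eq , fewer) = begin
      sum (atLeast u (C d)) + u                            ≡⟨ cong (_+ u) (sum-atLeast u (C d)) ⟩
      have d * u + sum (atLeast (suc u) (C d)) + u         ≡⟨ +-comm _ u ⟩
      u + (have d * u + sum (atLeast (suc u) (C d)))       ≡⟨ +-assoc u (have d * u) _ ⟨
      suc (have d) * u + sum (atLeast (suc u) (C d))       ≤⟨ +-mono-≤ (*-monoˡ-≤ u fewer) (≤-reflexive (sum-↭ (above eq))) ⟩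
      multiplicity u (T j) * u + sum (atLeast (suc u) (T j)) ≡⟨ sum-atLeast u (T j) ⟨
      sum (atLeast u (T j))                                ≤⟨ sum-filter≤ (u ≤?_) (T j) ⟩
      vol (T j)                                            ≤⟨ T-legal j ⟩
      κ                                                    ∎
      where open ≤-Reasoning

  run-action : ∀ {u φ ks C} → PowerOfTwo u → u ≤ κ → (∀ {C} → Sound C → u ≤ totalSlack κ (toList C)) →
    Sound C → ActionInvariant u φ C →
    (∀ {C′} → Sound C′ → ActionInvariant u φ C′ → Balanced u φ C′ → AlwaysReconfigures (ks , C′)) →
    AlwaysReconfigures (actionLoop u φ ∷ ks , C)
  run-action {u} {φ} {ks} u-power u≤κ enough sd₀ inv₀ k = go (<-wellFounded _) sd₀ inv₀
    where
    go : ∀ {C} → Acc _<_ (totalExcess u φ C) → Sound C → ActionInvariant u φ C → AlwaysReconfigures (actionLoop u φ ∷ ks , C)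
    go {C} (acc rec) sd inv = continue (isLegal sd) progress λ where
        (action-end balanced) → inj₁ ≋.↭-refl , k sd inv balanced
        (action-loop {s = s} {d} surplus deficit) → inj₁ ≋.↭-refl , iterate surplus deficit
      where
      progress : ∃[ σ ] (actionLoop u φ ∷ ks , C) ⟶ σ
      progress with balanced-or-unbalanced sd inv
      ... | inj₁ balanced = _ , action-end balanced
      ... | inj₂ (_ , _ , surplus , deficit) = _ , action-loop surplus deficit
      iterate : ∀ {s d} → Surplus u φ C s → Deficit u φ C d →
        AlwaysReconfigures (compress u ∷ transfer u s d ∷ actionLoop u φ ∷ ks , C)
      iterate {s} {d} (js , es , more) (jd , ed , fewer) = run-compress u≤κ sd λ {C₁} compressed same sd₁ →
        let same-count : ∀ k → multiplicity u (C₁ k) ≡ multiplicity u (C k)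
            same-count k = multiplicity-resp (C₁ k) (C k) (same k)
            inv₁     = invariant-resp same inv
            surplus₁ = js , es , subst (multiplicity u (T js) <_) (sym (same-count s)) more
            deficit₁ = jd , ed , subst (_< multiplicity u (T jd)) (sym (same-count d)) fewer
        in run-transfer u-power u≤κ s≢d sd₁
             (multiplicity>0⇒∈ u (C₁ s) (≤-<-trans z≤n (proj₂ (proj₂ surplus₁))))
             (deficit-fits sd₁ inv₁ deficit₁)
             (compressed⇒large-slack u-power compressed (enough sd₁))
             λ tr sd₂ → go
               (rec (<-≤-trans (excess-transferred tr surplus₁ deficit₁)
                 (Σ-mono-≤ (λ i → ≤-reflexive (excess-resp {u} {φ} {C₁} {C} i (same-count i))))))
               sd₂ (invariant-transferred tr (js , es) (jd , ed) inv₁)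
        where
        s≢d : s ≢ d
        s≢d refl with refl ← just-injective (trans (sym es) ed) = <-asym more fewer

-- Settling bijections and stage maps

module _ {n m : ℕ} {P : Fin n → Set} {Q : Fin m → Set} (P? : Decidable P) (Q? : Decidable Q)
         {φ : PartialMap n m} (bij : IsBijection P Q φ) where
  open IsBijection bij

  image-↭ : mapMaybe φ (allFin n) ↭ filter Q? (allFin m)
  image-↭ = unique-set⇒↭ (unique-mapMaybe φ injective (Unique.allFin⁺ n)) (Unique.filter⁺ Q? (Unique.allFin⁺ m))
    (λ {j} j∈ → case ∈-mapMaybe⁻ φ (allFin n) j∈ of λ where
      (i , _ , eq) → ∈-filter⁺ Q? (∈-allFin j) (Equivalence.from (image j) (i , eq)))
    (λ {j} j∈ → case Equivalence.to (image j) (proj₂ (∈-filter⁻ Q? {xs = allFin m} j∈)) of λ where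
      (i , eq) → ∈-mapMaybe⁺ φ (∈-allFin i) eq)

  length-mapMaybe-filter : ∀ xs → length (mapMaybe φ xs) ≡ length (filter P? xs)
  length-mapMaybe-filter [] = refl
  length-mapMaybe-filter (i ∷ xs) with φ i in eq
  ... | just j  = trans (cong suc (length-mapMaybe-filter xs))
    (cong length (sym (filter-accept P? {xs = xs} (Equivalence.from (domain i) (j , eq)))))
  ... | nothing = trans (length-mapMaybe-filter xs)
    (cong length (sym (filter-reject P? {xs = xs} (λ Pi → case trans (sym eq) (proj₂ (Equivalence.to (domain i) Pi)) of λ ()))))

  length-domain : length (filter P? (allFin n)) ≡ length (filter Q? (allFin m))
  length-domain = trans (sym (length-mapMaybe-filter (allFin n))) (↭-length image-↭)

-- A settling bijection must be undefined on bunches without an item of size at least s. Matchings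
-- and stage maps may be defined on more bunches and are cut down with this.
guard : ∀ {P : Set} → Dec P → Maybe A → Maybe A
guard (yes _) x = x
guard (no _)  _ = nothing

guard-just : ∀ {P : Set} (P? : Dec P) {x : Maybe A} {y} → guard P? x ≡ just y → P × x ≡ just y
guard-just (yes p) eq = p , eq

guard-accept : ∀ {P : Set} (P? : Dec P) {x : Maybe A} → P → guard P? x ≡ x
guard-accept (yes _) _ = refl
guard-accept (no ¬p) p = contradiction p ¬p

module _ {n m : ℕ} {X : Vector Bunch n} {Y : Vector Bunch m} (p : toList X ≋ toList Y) where

  private
    module π = Inverse (≋.onIndices p)
    castX : Fin n → Fin (length (toList X))
    castX = cast (sym (length-tabulate X))
    castY : Fin (length (toList Y)) → Fin m
    castY = cast (length-tabulate Y)
    castX⁻ : Fin (length (toList X)) → Fin n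
    castX⁻ = cast (length-tabulate X)
    castY⁻ : Fin m → Fin (length (toList Y))
    castY⁻ = cast (sym (length-tabulate Y))
    X-cycle : ∀ k → castX (castX⁻ k) ≡ k
    X-cycle = Fin.cast-involutive (sym (length-tabulate X)) (length-tabulate X)
    X-cycle⁻ : ∀ i → castX⁻ (castX i) ≡ i
    X-cycle⁻ = Fin.cast-involutive (length-tabulate X) (sym (length-tabulate X))
    Y-cycle : ∀ j → castY (castY⁻ j) ≡ j
    Y-cycle = Fin.cast-involutive (length-tabulate Y) (sym (length-tabulate Y))
    Y-cycle⁻ : ∀ k → castY⁻ (castY k) ≡ k
    Y-cycle⁻ = Fin.cast-involutive (sym (length-tabulate Y)) (length-tabulate Y)

  -- `≋.onIndices` relates positions in lists. The casts are needed because the length of `toList X`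
  -- equals `n` only propositionally.
  matching : Fin n → Fin m
  matching i = castY (π.to (castX i))

  matching⁻¹ : Fin m → Fin n
  matching⁻¹ j = castX⁻ (π.from (castY⁻ j))

  matching-agrees : ∀ i → X i ↭ Y (matching i)
  matching-agrees i = begin
    X i                                              ≡⟨ lookup-tabulate X i ⟨
    fromList (toList X) (castX i)                    ↭⟨ ≋.onIndices-lookup p (castX i) ⟩
    fromList (toList Y) (π.to (castX i))             ≡⟨ cong (fromList (toList Y)) (Y-cycle⁻ (π.to (castX i))) ⟨
    fromList (toList Y) (castY⁻ (matching i))        ≡⟨ lookup-tabulate Y (matching i) ⟩
    Y (matching i)                                   ∎
    where open PermutationReasoning

  matching-inverseˡ : ∀ i → matching⁻¹ (matching i) ≡ i
  matching-inverseˡ i = begin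
    castX⁻ (π.from (castY⁻ (castY (π.to (castX i)))))   ≡⟨ cong (castX⁻ ∘ π.from) (Y-cycle⁻ (π.to (castX i))) ⟩
    castX⁻ (π.from (π.to (castX i)))                    ≡⟨ cong castX⁻ (π.strictlyInverseʳ (castX i)) ⟩
    castX⁻ (castX i)                                    ≡⟨ X-cycle⁻ i ⟩
    i                                                   ∎
    where open ≡-Reasoning

  matching-inverseʳ : ∀ j → matching (matching⁻¹ j) ≡ j
  matching-inverseʳ j = begin
    castY (π.to (castX (castX⁻ (π.from (castY⁻ j)))))   ≡⟨ cong (castY ∘ π.to) (X-cycle (π.from (castY⁻ j))) ⟩
    castY (π.to (π.from (castY⁻ j)))                    ≡⟨ cong castY (π.strictlyInverseˡ (castY⁻ j)) ⟩
    castY (castY⁻ j)                                    ≡⟨ Y-cycle j ⟩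
    j                                                   ∎
    where open ≡-Reasoning

module _ {s n m : ℕ} {D : Vector Bunch n} {T : Vector Bunch m} where

  -- A matching of all bunches pairs nonempty filtered bunches with nonempty ones, so its
  -- restriction to these is a settling bijection.
  ≋⇒settled : toList (atLeast s ∘ D) ≋ toList (atLeast s ∘ T) → Settled s D T
  ≋⇒settled p = φ , record
    { isBijection = record
      { domain    = λ i → mk⇔ (λ h → π i , guard-accept (has? i) h) (λ (j , eq) → proj₁ (guard-just (has? i) eq))
      ; image     = λ j → mk⇔
          (λ h → π⁻¹ j , trans
            (guard-accept (has? (π⁻¹ j)) (hasAtLeast-cong {s} {T j} {D (π⁻¹ j)} (↭-sym (subst (λ k → atLeast s (D (π⁻¹ j)) ↭ atLeast s (T k)) (matching-inverseʳ p j) (matching-agrees p (π⁻¹ j)))) h))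
            (cong just (matching-inverseʳ p j)))
          (λ (i , eq) → hasAtLeast-cong {s} {D i} {T j} (agrees eq) (proj₁ (guard-just (has? i) eq)))
      ; injective = λ {i} {i′} eq eq′ → trans (sym (matching-inverseˡ p i)) (trans
          (cong π⁻¹ (just-injective (trans (proj₂ (guard-just (has? i) eq)) (sym (proj₂ (guard-just (has? i′) eq′))))))
          (matching-inverseˡ p i′))
      }
    ; agrees = agrees
    }
    where
    π   = matching p
    π⁻¹ = matching⁻¹ p
    has? : ∀ i → Dec (HasAtLeast s (D i))
    has? i = hasAtLeast? s (D i)
    φ : PartialMap n m
    φ i = guard (has? i) (just (π i))
    agrees : ∀ {i j} → φ i ≡ just j → atLeast s (D i) ↭ atLeast s (T j)
    agrees {i} eq with refl ← just-injective (proj₂ (guard-just (has? i) eq)) = matching-agrees p i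

  -- The bijection matches the bunches that keep an item. All others become empty under the filter,
  -- and by `n ≡ m` there are equally many of them on both sides.
  settled⇒≋ : n ≡ m → Settled s D T → toList (atLeast s ∘ D) ≋ toList (atLeast s ∘ T)
  settled⇒≋ n≡m (φ , settling) =
    ≋.trans (split D) (≋.trans (≋.++⁺ matched unmatched) (≋.↭-sym (split T)))
    where
    open IsSettlingBijection settling
    open IsBijection isBijection
    has? : ∀ {l} (E : Vector Bunch l) i → Dec (HasAtLeast s (E i))
    has? E i = hasAtLeast? s (E i)
    with≥ without≥ : ∀ {l} (E : Vector Bunch l) → List (Fin l)
    with≥    E = filter (has? E) (allFin _)
    without≥ E = filter (¬? ∘ has? E) (allFin _)
    split : ∀ {l} (E : Vector Bunch l) →
      toList (atLeast s ∘ E) ≋ map (atLeast s ∘ E) (with≥ E) ++ map (atLeast s ∘ E) (without≥ E)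
    split {l} E = ↭⇒≋ (↭-trans (↭-reflexive (sym (map-tabulate id (atLeast s ∘ E))))
      (↭-trans (map⁺ (atLeast s ∘ E) (filter-partition (has? E) (allFin l)))
        (↭-reflexive (map-++ (atLeast s ∘ E) (with≥ E) (without≥ E)))))
    pairwise : ∀ xs → map (atLeast s ∘ D) (filter (has? D) xs) ≋ map (atLeast s ∘ T) (mapMaybe φ xs)
    pairwise [] = ≋.↭-refl
    pairwise (i ∷ xs) with φ i in eq
    ... | just j  = ≋.trans
      (↭⇒≋ (↭-reflexive (cong (map (atLeast s ∘ D)) (filter-accept (has? D) {xs = xs} (Equivalence.from (domain i) (j , eq))))))
      (≋.prep (agrees eq) (pairwise xs))
    ... | nothing = ≋.trans
      (↭⇒≋ (↭-reflexive (cong (map (atLeast s ∘ D)) (filter-reject (has? D) {xs = xs} (λ h → case trans (sym eq) (proj₂ (Equivalence.to (domain i) h)) of λ ())))))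
      (pairwise xs)
    matched : map (atLeast s ∘ D) (with≥ D) ≋ map (atLeast s ∘ T) (with≥ T)
    matched = ≋.trans (pairwise (allFin n)) (↭⇒≋ (map⁺ (atLeast s ∘ T) (image-↭ (has? D) (has? T) isBijection)))
    blank : ∀ {l} (E : Vector Bunch l) {xs} → All (¬_ ∘ HasAtLeast s ∘ E) xs → map (atLeast s ∘ E) xs ≡ replicate (length xs) []
    blank E []       = refl
    blank E (¬h ∷ hs) = cong₂ _∷_ (atLeast-none (¬hasAtLeast ¬h)) (blank E hs)
    total : ∀ {l} (E : Vector Bunch l) → length (with≥ E) + length (without≥ E) ≡ l
    total {l} E = trans (sym (length-++ (with≥ E)))
      (trans (sym (↭-length (filter-partition (has? E) (allFin l)))) (length-tabulate {n = l} id))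
    length-without : length (without≥ D) ≡ length (without≥ T)
    length-without = +-cancelˡ-≡ (length (with≥ D)) _ _ (trans (total D) (trans n≡m (trans (sym (total T))
      (cong (_+ length (without≥ T)) (sym (length-domain (has? D) (has? T) isBijection))))))
    unmatched : map (atLeast s ∘ D) (without≥ D) ≋ map (atLeast s ∘ T) (without≥ T)
    unmatched = ↭⇒≋ (↭-reflexive (trans (blank D (All.all-filter (¬? ∘ has? D) (allFin n)))
      (trans (cong (λ l → replicate l []) length-without) (sym (blank T (All.all-filter (¬? ∘ has? T) (allFin m)))))))

settled? : ∀ {n m} → n ≡ m → ∀ s (D : Vector Bunch n) (T : Vector Bunch m) → Dec (Settled s D T)
settled? n≡m s D T = map′ ≋⇒settled (settled⇒≋ n≡m) (toList (atLeast s ∘ D) ≋? toList (atLeast s ∘ T))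

-- Existence of stage maps

assoc : ∀ {n m} → List (Fin n) → List (Fin m) → PartialMap n m
assoc (x ∷ xs) (y ∷ ys) i with i Fin.≟ x
... | yes _ = just y
... | no  _ = assoc xs ys i
assoc _ _ i = nothing

assoc-∈ : ∀ {n m} (xs : List (Fin n)) (ys : List (Fin m)) {i j} → assoc xs ys i ≡ just j → i ∈ xs × j ∈ ys
assoc-∈ (x ∷ xs) (y ∷ ys) {i} eq with i Fin.≟ x
assoc-∈ (x ∷ xs) (y ∷ ys) refl | yes i≡x = here i≡x , here refl
... | no _ with assoc-∈ xs ys eq
...   | i∈ , j∈ = there i∈ , there j∈

assoc-domain : ∀ {n m} (xs : List (Fin n)) (ys : List (Fin m)) → length xs ≡ length ys →
  ∀ {i} → i ∈ xs → ∃[ j ] assoc xs ys i ≡ just j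
assoc-domain (x ∷ xs) (y ∷ ys) len {i} i∈ with i Fin.≟ x | i∈
... | yes _  | _         = y , refl
... | no i≢x | here i≡x  = contradiction i≡x i≢x
... | no _   | there i∈′ = assoc-domain xs ys (suc-injective len) i∈′

assoc-image : ∀ {n m} {xs : List (Fin n)} (ys : List (Fin m)) → Unique xs → length xs ≡ length ys →
  ∀ {j} → j ∈ ys → ∃[ i ] assoc xs ys i ≡ just j
assoc-image {xs = x ∷ xs} (y ∷ ys) _ len (here refl) = x , first
  where
  first : assoc (x ∷ xs) (y ∷ ys) x ≡ just y
  first with x Fin.≟ x
  ... | yes _   = refl
  ... | no  x≢x = contradiction refl x≢x
assoc-image {xs = x ∷ xs} (y ∷ ys) (x∉ ∷ uniq) len {j} (there j∈)
  with assoc-image ys uniq (suc-injective len) j∈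
... | i , eq = i , later
  where
  later : assoc (x ∷ xs) (y ∷ ys) i ≡ just j
  later with i Fin.≟ x
  ... | yes refl = contradiction refl (All.lookup x∉ (proj₁ (assoc-∈ xs ys eq)))
  ... | no _     = eq

assoc-injective : ∀ {n m} (xs : List (Fin n)) {ys : List (Fin m)} → Unique ys → InjectivePartial (assoc xs ys)
assoc-injective (x ∷ xs) {y ∷ ys} (y∉ ∷ uniq) {i} {i′} eq eq′ with i Fin.≟ x | i′ Fin.≟ x
... | yes i≡x | yes i′≡x = trans i≡x (sym i′≡x)
... | yes _   | no _     with refl ← just-injective eq  = contradiction refl (All.lookup y∉ (proj₂ (assoc-∈ xs ys eq′)))
... | no _    | yes _    with refl ← just-injective eq′ = contradiction refl (All.lookup y∉ (proj₂ (assoc-∈ xs ys eq)))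
... | no _    | no _     = assoc-injective xs uniq eq eq′

toSubset : ∀ {n} → List (Fin n) → Subset.Subset n
toSubset []       = Subset.⊥
toSubset (x ∷ xs) = Subset.⁅ x ⁆ Subset.∪ toSubset xs

∈-toSubset⁺ : ∀ {n} {xs : List (Fin n)} {i} → i ∈ xs → i Subset.∈ toSubset xs
∈-toSubset⁺ {i = i} (here refl) = Subset.x∈p∪q⁺ (inj₁ (Subset.x∈⁅x⁆ i))
∈-toSubset⁺ (there i∈) = Subset.x∈p∪q⁺ (inj₂ (∈-toSubset⁺ i∈))

∈-toSubset⁻ : ∀ {n} (xs : List (Fin n)) {i} → i Subset.∈ toSubset xs → i ∈ xs
∈-toSubset⁻ []       i∈ = contradiction i∈ Subset.∉⊥
∈-toSubset⁻ (x ∷ xs) i∈ with Subset.x∈p∪q⁻ Subset.⁅ x ⁆ (toSubset xs) i∈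
... | inj₁ i∈x  = here (Subset.x∈⁅y⁆⇒x≡y x i∈x)
... | inj₂ i∈xs = there (∈-toSubset⁻ xs i∈xs)

-- Provides the arbitrary bijection by which the Mapping Step extends the starting map; the two
-- lists are the padded collections of bunches.
assoc-bijection : ∀ {n m} {xs : List (Fin n)} {ys : List (Fin m)} → Unique xs → Unique ys → length xs ≡ length ys →
  IsBijection (Subset._∈ toSubset xs) (Subset._∈ toSubset ys) (assoc xs ys)
assoc-bijection {xs = xs} {ys} uxs uys len = record
  { domain    = λ i → mk⇔ (assoc-domain xs ys len ∘ ∈-toSubset⁻ xs) (λ (j , eq) → ∈-toSubset⁺ (proj₁ (assoc-∈ xs ys eq)))
  ; image     = λ j → mk⇔ (assoc-image ys uxs len ∘ ∈-toSubset⁻ ys) (λ (i , eq) → ∈-toSubset⁺ (proj₂ (assoc-∈ xs ys eq)))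
  ; injective = assoc-injective xs uys
  }

-- Lets the first stage be treated like the others: without a previous size nothing counts as above,
-- in accordance with the empty starting map.
Above : Maybe ℕ → ℕ → Set
Above nothing  v = ⊥
Above (just s) v = s ≤ v

hasAbove? : ∀ prev B → Dec (Any (Above prev) B)
hasAbove? nothing  = any? (λ _ → no id)
hasAbove? (just s) = any? (s ≤?_)

starting-bijection : ∀ prev {n m} {C : Vector Bunch n} {T : Vector Bunch m} {ψ} → IsStartingMap prev C T ψ →
  IsBijection (Any (Above prev) ∘ C) (Any (Above prev) ∘ T) ψ
starting-bijection (just s) settling = IsSettlingBijection.isBijection settling
starting-bijection nothing {ψ = ψ} empty = record
  { domain    = λ i → mk⇔ (λ h → contradiction h none) (λ (j , eq) → contradiction eq (undefined i))
  ; image     = λ j → mk⇔ (λ h → contradiction h none) (λ (i , eq) → contradiction eq (undefined i))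
  ; injective = λ {i} eq → contradiction eq (undefined i)
  }
  where
  none : ∀ {B : Bunch} → ¬ Any (Above nothing) B
  none (there h) = none h
  undefined : ∀ i {j} → ψ i ≢ just j
  undefined i eq with () ← trans (sym (empty i)) eq

isLargestItem? : ∀ u B → Dec (IsLargestItem u B)
isLargestItem? u B = any? (u ≟_) B ×-dec All.all? (_≤? u) B

-- No size lies strictly between u and those already treated.
Gap : Maybe ℕ → ℕ → Bunch → Set
Gap prev u = All (λ v → u < v → Above prev v)

module _ {prev : Maybe ℕ} {u : ℕ} (sep : ∀ {v} → Above prev v → u < v) where

  ¬above⇒≤ : ∀ {B} → Gap prev u B → ¬ Any (Above prev) B → All (_≤ u) B
  ¬above⇒≤ {B} gap ¬above = All.map (λ (f , ¬a) → ≮⇒≥ (¬a ∘ f)) (All.zip (gap , All.¬Any⇒All¬ B ¬above))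

  ≤⇒¬above : ∀ {B} → All (_≤ u) B → ¬ Any (Above prev) B
  ≤⇒¬above (v≤u ∷ _)  (here a)  = contradiction v≤u (<⇒≱ (sep a))
  ≤⇒¬above (_ ∷ vs≤u) (there h) = ≤⇒¬above vs≤u h

  ¬largest⇒< : ∀ {B} → Gap prev u B → ¬ Any (Above prev) B → ¬ IsLargestItem u B → All (_< u) B
  ¬largest⇒< {B} gap ¬above ¬largest = All.map (λ (v≤u , u≢v) → ≤∧≢⇒< v≤u (u≢v ∘ sym))
    (All.zip (≤u , All.¬Any⇒All¬ B (λ u∈ → ¬largest (u∈ , ≤u))))
    where ≤u = ¬above⇒≤ gap ¬above

  -- By `gap`, a bunch without items above consists of items of size at most `u`. So either its
  -- largest item is `u`, or all its items are smaller than `u` and it is available for padding.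
  module Split {l : ℕ} (E : Vector Bunch l) (gap : ∀ k → Gap prev u (E k)) where

    has? : ∀ i → Dec (Any (Above prev) (E i))
    has? i = hasAbove? prev (E i)
    largest? : ∀ i → Dec (IsLargestItem u (E i))
    largest? i = isLargestItem? u (E i)
    previous remaining largest smaller : List (Fin l)
    previous  = filter has? (allFin l)
    remaining = filter (¬? ∘ has?) (allFin l)
    largest   = filter largest? remaining
    smaller   = filter (¬? ∘ largest?) remaining

    padded : ℕ → List (Fin l)
    padded k = largest ++ take k smaller

    length-split : length previous + (length largest + length smaller) ≡ l
    length-split = begin
      length previous + (length largest + length smaller)   ≡⟨ cong (length previous +_) (trans (sym (length-++ largest)) (sym (↭-length (filter-partition largest? remaining)))) ⟩
      length previous + length remaining                    ≡⟨ trans (sym (length-++ previous)) (sym (↭-length (filter-partition has? (allFin l)))) ⟩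
      length (allFin l)                                     ≡⟨ length-tabulate {n = l} id ⟩
      l                                                     ∎
      where open ≡-Reasoning

    remaining-unique : Unique remaining
    remaining-unique = Unique.filter⁺ (¬? ∘ has?) (Unique.allFin⁺ l)

    largest-unique : Unique largest
    largest-unique = Unique.filter⁺ largest? remaining-unique

    ∈-take : ∀ k {i} (xs : List (Fin l)) → i ∈ take k xs → i ∈ xs
    ∈-take (suc k) (_ ∷ xs) (here eq)  = here eq
    ∈-take (suc k) (_ ∷ xs) (there i∈) = there (∈-take k xs i∈)

    padded-unique : ∀ k → Unique (padded k)
    padded-unique k = Unique.++⁺ largest-unique (Unique.take⁺ k (Unique.filter⁺ (¬? ∘ largest?) remaining-unique))
      λ (i∈ , i∈′) → proj₂ (∈-filter⁻ (¬? ∘ largest?) {xs = remaining} (∈-take k smaller i∈′))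
                       (proj₂ (∈-filter⁻ largest? {xs = remaining} i∈))

    ∈-largest⁺ : ∀ i → IsLargestItem u (E i) → i ∈ largest
    ∈-largest⁺ i is = ∈-filter⁺ largest? (∈-filter⁺ (¬? ∘ has?) (∈-allFin i) (≤⇒¬above (proj₂ is))) is

    ∈-largest⁻ : ∀ i → i ∈ largest → IsLargestItem u (E i)
    ∈-largest⁻ i i∈ = proj₂ (∈-filter⁻ largest? {xs = remaining} i∈)

    exactly : ExactlyLargest u E (toSubset largest)
    exactly i = mk⇔ (∈-largest⁻ i ∘ ∈-toSubset⁻ largest) (∈-toSubset⁺ ∘ ∈-largest⁺ i)

    padding : ∀ k → PaddedLargest u E (toSubset (padded k))
    padding k = (λ i is → ∈-toSubset⁺ (∈-++⁺ˡ (∈-largest⁺ i is))) , λ i i∈ → classify i (∈-++⁻ largest (∈-toSubset⁻ (padded k) i∈))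
      where
      classify : ∀ i → i ∈ largest ⊎ i ∈ take k smaller → IsLargestItem u (E i) ⊎ All (_< u) (E i)
      classify i (inj₁ i∈) = inj₁ (∈-largest⁻ i i∈)
      classify i (inj₂ i∈) with ∈-filter⁻ (¬? ∘ largest?) {xs = remaining} (∈-take k smaller i∈)
      ... | i∈r , ¬is = inj₂ (¬largest⇒< (gap i) (proj₂ (∈-filter⁻ (¬? ∘ has?) {xs = allFin l} i∈r)) ¬is)

    length-padded : ∀ {k} → k ≤ length smaller → length (padded k) ≡ length largest + k
    length-padded {k} k≤ = trans (length-++ largest)
      (cong (length largest +_) (trans (length-take k smaller) (m≤n⇒m⊓n≡m k≤)))

  -- The starting map pairs the bunches it involves, so equally many are left on both sides. Hence
  -- the side with fewer bunches of largest item `u` has enough bunches of smaller items for its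
  -- padding.
  length-unmapped : ∀ {n m} {C : Vector Bunch n} {T : Vector Bunch m} {ψ} → n ≡ m →
    (gapC : ∀ k → Gap prev u (C k)) (gapT : ∀ k → Gap prev u (T k)) → IsStartingMap prev C T ψ →
    length (Split.largest C gapC) + length (Split.smaller C gapC) ≡
    length (Split.largest T gapT) + length (Split.smaller T gapT)
  length-unmapped {C = C} {T} n≡m gapC gapT starting =
    +-cancelˡ-≡ (length SC.previous) _ _ (trans SC.length-split (trans n≡m (trans (sym ST.length-split)
      (cong (_+ (length ST.largest + length ST.smaller)) (sym (length-domain SC.has? ST.has? (starting-bijection prev starting)))))))
    where
    module SC = Split C gapC
    module ST = Split T gapT

  stageMap-exists : ∀ {n m} {C : Vector Bunch n} {T : Vector Bunch m} {ψ} → n ≡ m →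
    (∀ k → Gap prev u (C k)) → (∀ k → Gap prev u (T k)) → IsStartingMap prev C T ψ →
    ∃[ φ ] IsStageMap prev u C T φ
  stageMap-exists {C = C} {T} {ψ} n≡m gapC gapT starting with ≤-total (length (Split.largest C gapC)) (length (Split.largest T gapT))
  ... | inj₁ fewer = _ , record
    { starting  = starting
    ; padding   = inj₂ (SC.padding k , ST.exactly)
    ; extension = assoc-bijection (SC.padded-unique k) ST.largest-unique
        (trans (SC.length-padded k≤) (m+[n∸m]≡n fewer))
    ; combined  = λ _ → refl
    }
    where
    module SC = Split C gapC
    module ST = Split T gapT
    k = length ST.largest ∸ length SC.largest
    same = length-unmapped n≡m gapC gapT starting
    k≤ : k ≤ length SC.smaller
    k≤ = m≤n+o⇒m∸n≤o (length ST.largest) (length SC.largest) (≤-trans (m≤m+n (length ST.largest) (length ST.smaller)) (≤-reflexive (sym same)))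
  ... | inj₂ fewer = _ , record
    { starting  = starting
    ; padding   = inj₁ (SC.exactly , ST.padding k)
    ; extension = assoc-bijection SC.largest-unique (ST.padded-unique k)
        (sym (trans (ST.length-padded k≤) (m+[n∸m]≡n fewer)))
    ; combined  = λ _ → refl
    }
    where
    module SC = Split C gapC
    module ST = Split T gapT
    k = length SC.largest ∸ length ST.largest
    same = length-unmapped n≡m gapC gapT starting
    k≤ : k ≤ length ST.smaller
    k≤ = m≤n+o⇒m∸n≤o (length SC.largest) (length ST.largest) (≤-trans (m≤m+n (length SC.largest) (length SC.smaller)) (≤-reflexive same))

atLeast-gap : ∀ {s t B} → All (λ v → (s ≤ v → t ≤ v) × (t ≤ v → s ≤ v)) B → atLeast s B ≡ atLeast t B
atLeast-gap [] = refl
atLeast-gap {s} {t} {v ∷ B} ((f , g) ∷ vs) with s ≤? v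
... | yes s≤v = trans (filter-accept (s ≤?_) {xs = B} s≤v) (trans (cong (v ∷_) (atLeast-gap vs)) (sym (filter-accept (t ≤?_) {xs = B} (f s≤v))))
... | no s≰v  = trans (filter-reject (s ≤?_) {xs = B} s≰v) (trans (atLeast-gap vs) (sym (filter-reject (t ≤?_) {xs = B} (s≰v ∘ g))))

padded-≤ : ∀ {u n} {C : Vector Bunch n} {P} → PaddedLargest u C P → ∀ {i} → i Subset.∈ P → All (_≤ u) (C i)
padded-≤ (_ , classify) {i} i∈ with classify i i∈
... | inj₁ (_ , ≤u) = ≤u
... | inj₂ <u       = All.map <⇒≤ <u

exactly⇒padded : ∀ {u n} {C : Vector Bunch n} {P} → ExactlyLargest u C P → PaddedLargest u C P
exactly⇒padded exact = (λ i → Equivalence.from (exact i)) , λ i i∈ → inj₁ (Equivalence.to (exact i) i∈)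

-- Stages

module Stages {κ n m : ℕ} (n≡m : n ≡ m) (T : Vector Bunch m) {U : List ℕ}
              (κ-power : PowerOfTwo κ) (U-powers : All PowerOfTwo U)
              (T-legal : ∀ j → vol (T j) ≤ κ) (T-items : underlying (toList T) ↭ U) where
  open Action {κ} {n} T κ-power U-powers T-legal T-items public
  open Sound

  -- Concerns every outcome of the Mapping Step, as the run chooses it; the map constructed before
  -- only shows that there is one.
  stageMap-invariant : ∀ prev {u C φ} → (∀ {v} → Above prev v → u < v) →
    (∀ k → Gap prev u (C k)) → (∀ k → Gap prev u (T k)) →
    IsStageMap prev u C T φ → ActionInvariant u φ C
  stageMap-invariant prev {u} {C} {φ} sep gapC gapT stageMap = record
    { injective = injective′
    ; above     = above′
    ; covers    = covers′
    ; coversT   = coversT′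
    }
    where
    open IsStageMap stageMap
    module ψ = IsBijection (starting-bijection prev starting)
    module χ = IsBijection extension
    paddedP : PaddedLargest u C P
    paddedP with padding
    ... | inj₁ (exact , _) = exactly⇒padded exact
    ... | inj₂ (pad , _)   = pad
    paddedQ : PaddedLargest u T Q
    paddedQ with padding
    ... | inj₁ (_ , pad)   = pad
    ... | inj₂ (_ , exact) = exactly⇒padded exact
    φ-split : ∀ {i j} → φ i ≡ just j → ψ i ≡ just j ⊎ χ i ≡ just j
    φ-split {i} eq with ψ i | trans (sym (combined i)) eq
    ... | just _  | e = inj₁ e
    ... | nothing | e = inj₂ e
    C≤ : ∀ {i j} → χ i ≡ just j → All (_≤ u) (C i)
    C≤ eq = padded-≤ {C = C} paddedP (Equivalence.from (χ.domain _) (_ , eq))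
    T≤ : ∀ {i j} → χ i ≡ just j → All (_≤ u) (T j)
    T≤ eq = padded-≤ {C = T} paddedQ (Equivalence.from (χ.image _) (_ , eq))
    -- `ψ` reaches only target bunches with an item larger than `u`, and `χ` only those without, so
    -- the combined map stays injective.
    disjoint : ∀ {i i′ j} → ψ i ≡ just j → ¬ χ i′ ≡ just j
    disjoint e e′ = ≤⇒¬above {prev} sep (T≤ e′) (Equivalence.from (ψ.image _) (_ , e))
    injective′ : InjectivePartial φ
    injective′ eq eq′ with φ-split eq | φ-split eq′
    ... | inj₁ e | inj₁ e′ = ψ.injective e e′
    ... | inj₂ e | inj₂ e′ = χ.injective e e′
    ... | inj₁ e | inj₂ e′ = contradiction e′ (disjoint e)
    ... | inj₂ e | inj₁ e′ = contradiction e (disjoint e′)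
    -- `ψ` gives agreement from the previous size on, but agreement from u + 1 on is needed. By
    -- `Gap` no item lies in between, so both filters keep the same items.
    ψ-above : ∀ {i j} prev → (∀ {v} → Above prev v → u < v) → (∀ k → Gap prev u (C k)) → (∀ k → Gap prev u (T k)) →
      IsStartingMap prev C T ψ → ψ i ≡ just j → atLeast (suc u) (C i) ↭ atLeast (suc u) (T j)
    ψ-above {i} nothing _ _ _ empty e with () ← trans (sym (empty i)) e
    ψ-above {i} {j} (just s) sep gapC gapT settling e =
      subst₂ _↭_ (atLeast-gap (All.map (λ f → sep , f) (gapC i))) (atLeast-gap (All.map (λ f → sep , f) (gapT j)))
        (IsSettlingBijection.agrees settling e)
    above′ : ∀ {i j} → φ i ≡ just j → atLeast (suc u) (C i) ↭ atLeast (suc u) (T j)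
    above′ eq with φ-split eq
    ... | inj₁ e = ψ-above prev sep gapC gapT starting e
    ... | inj₂ e = ↭-reflexive (trans (atLeast-none (All.map s≤s (C≤ e))) (sym (atLeast-none (All.map s≤s (T≤ e)))))
    largest : ∀ {B} → Gap prev u B → ¬ Any (Above prev) B → HasAtLeast u B → IsLargestItem u B
    largest gap ¬above h with find h | ¬above⇒≤ {prev} sep gap ¬above
    ... | x , x∈ , u≤x | ≤u with refl ← ≤-antisym u≤x (All.lookup ≤u x∈) = x∈ , ≤u
    covers′ : ∀ {i} → HasAtLeast u (C i) → ∃[ j ] φ i ≡ just j
    covers′ {i} h with ψ i in e | hasAbove? prev (C i)
    ... | just j  | _ = j , trans (combined i) (cong (_<∣> χ i) e)
    ... | nothing | yes a = case trans (sym e) (proj₂ (Equivalence.to (ψ.domain i) a)) of λ ()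
    ... | nothing | no ¬a with Equivalence.to (χ.domain i) (proj₁ paddedP i (largest (gapC i) ¬a h))
    ...   | j , e′ = j , trans (combined i) (trans (cong (_<∣> χ i) e) e′)
    coversT′ : ∀ {j} → HasAtLeast u (T j) → ∃[ i ] φ i ≡ just j
    coversT′ {j} h with hasAbove? prev (T j)
    ... | yes a with Equivalence.to (ψ.image j) a
    ...   | i , e = i , trans (combined i) (cong (_<∣> χ i) e)
    coversT′ {j} h | no ¬a with Equivalence.to (χ.image j) (proj₁ paddedQ j (largest (gapT j) ¬a h))
    -- The combined map prefers `ψ`, so `ψ` has to be undefined at `i`. It is, since bunches in the
    -- domain of `χ` have no item larger than `u`.
    ...   | i , e = i , trans (combined i) (undefined (ψ i) λ e′ → ≤⇒¬above {prev} sep (C≤ e) (Equivalence.from (ψ.domain i) (_ , e′)))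
      where
      undefined : ∀ x → (∀ {j′} → ¬ x ≡ just j′) → (x <∣> χ i) ≡ just j
      undefined (just _) f = contradiction refl f
      undefined nothing  f = e

  -- Paired bunches agree above `u` by the invariant and in their copies of `u` by balance. Padding
  -- may leave bunches without items of size at least `u` in `φ`, hence the restriction `φ′`.
  balanced⇒settled : ∀ {u φ C} → ActionInvariant u φ C → Balanced u φ C → Settled u C T
  balanced⇒settled {u} {φ} {C} inv balanced = φ′ , record
    { isBijection = record
      { domain    = λ i → mk⇔
          (λ h → let j , eq = covers h in j , trans (guard-accept (has? i) h) eq)
          (λ (j , eq) → proj₁ (guard-just (has? i) eq))
      ; image     = λ j → mk⇔
          (λ h → let i , eq = coversT h in
            i , trans (guard-accept (has? i) (hasAtLeast-cong {u} {T j} {C i} (↭-sym (agree eq)) h)) eq)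
          (λ (i , eq) → let h , eq′ = guard-just (has? i) eq in hasAtLeast-cong {u} {C i} {T j} (agree eq′) h)
      ; injective = λ {i} {i′} eq eq′ → injective (proj₂ (guard-just (has? i) eq)) (proj₂ (guard-just (has? i′) eq′))
      }
    ; agrees = λ {i} eq → agree (proj₂ (guard-just (has? i) eq))
    }
    where
    open ActionInvariant inv
    has? : ∀ i → Dec (HasAtLeast u (C i))
    has? i = hasAtLeast? u (C i)
    φ′ : PartialMap n m
    φ′ i = guard (has? i) (φ i)
    agree : ∀ {i j} → φ i ≡ just j → atLeast u (C i) ↭ atLeast u (T j)
    agree {i} {j} eq = begin
      atLeast u (C i)                                                       ↭⟨ atLeast-split u (C i) ⟩
      replicate (multiplicity u (C i)) u ++ atLeast (suc u) (C i)           ≡⟨ cong (λ l → replicate l u ++ atLeast (suc u) (C i)) (balanced i j eq) ⟩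
      replicate (multiplicity u (T j)) u ++ atLeast (suc u) (C i)           ↭⟨ ++⁺ˡ (replicate (multiplicity u (T j)) u) (above eq) ⟩
      replicate (multiplicity u (T j)) u ++ atLeast (suc u) (T j)           ↭⟨ atLeast-split u (T j) ⟨
      atLeast u (T j)                                                       ∎
      where open PermutationReasoning

  allSettledFrom? : ∀ u C → Dec (AllSettledFrom u C)
  allSettledFrom? u C = map′
    (λ settled s s∈ → All.lookup settled s∈)
    (λ settled → All.tabulate λ {s} → settled s)
    (All.all? (λ s → (u ≤? s) →-dec settled? n≡m s C T) (underlying (toList C)))

  module _ {ℓ : ℕ} (ℓ∈U : ℓ ∈ U) (enough : ∀ {C} → Sound C → ℓ ≤ totalSlack κ (toList C)) where

    -- `covered` and `separate` divide the sizes into treated and pending ones, from which `Gap`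
    -- follows. `settled` survives because stages above ℓ are skipped and change nothing; once a
    -- stage acts, its size is at most ℓ and the field is vacuous for the sizes left.
    record StageInvariant (prev : Maybe ℕ) (us : List ℕ) (C : Vector Bunch n) : Set where
      field
        sound    : Sound C
        covered  : ∀ {v} → v ∈ U → Above prev v ⊎ v ∈ us
        separate : All (λ u → ∀ v → Above prev v → u < v) us
        sorted   : AllPairs (λ u v → v < u) us
        ⊆U       : All (_∈ U) us
        starting : ∃[ ψ ] IsStartingMap prev C T ψ
        settled  : All (λ u → ℓ < u → AllSettledFrom u C) us

    -- As ℓ is an item size, some stage has been performed. The last size treated is then a lower
    -- bound for all items, its filter deletes nothing, and settledness amounts to equality with the
    -- target.
    finish : ∀ prev {C} → StageInvariant prev [] C → toList C ≋ toList T
    finish nothing inv with StageInvariant.covered inv ℓ∈U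
    ... | inj₁ ()
    ... | inj₂ ()
    finish (just s) {C} inv = ≋.trans (↭⇒≋ (↭-reflexive (unfiltered C λ v∈ → ∈-U sound v∈)))
      (≋.trans (settled⇒≋ n≡m starting)
        (↭⇒≋ (↭-reflexive (sym (unfiltered T λ {k} v∈ → ∈-resp-↭ T-items (∈-concat⁺′ v∈ (∈-tabulate⁺ k)))))))
      where
      open StageInvariant inv
      s≤ : ∀ {v} → v ∈ U → s ≤ v
      s≤ v∈ with covered v∈
      ... | inj₁ s≤v = s≤v
      unfiltered : ∀ {l} (E : Vector Bunch l) → (∀ {k v} → v ∈ E k → v ∈ U) → toList E ≡ toList (atLeast s ∘ E)
      unfiltered E ⊆U = tabulate-cong λ k → sym (atLeast-all (All.tabulate λ v∈ → s≤ (⊆U v∈)))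

    next : ∀ {prev u us C C′} → StageInvariant prev (u ∷ us) C → Sound C′ → Settled u C′ T →
      All (λ v → ℓ < v → AllSettledFrom v C′) us → StageInvariant (just u) us C′
    next {prev} {u} {us} inv sd settled-u settled-us = record
      { sound    = sd
      ; covered  = covered′
      ; separate = All.map (λ v<u _ u≤w → <-≤-trans v<u u≤w) (AllPairs.head sorted)
      ; sorted   = AllPairs.tail sorted
      ; ⊆U       = All.tail ⊆U
      ; starting = settled-u
      ; settled  = settled-us
      }
      where
      open StageInvariant inv
      covered′ : ∀ {v} → v ∈ U → u ≤ v ⊎ v ∈ us
      covered′ v∈ with covered v∈
      ... | inj₁ above        = inj₁ (<⇒≤ (All.head separate _ above))
      ... | inj₂ (here refl)  = inj₁ ≤-refl
      ... | inj₂ (there v∈us) = inj₂ v∈us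

    run-stages : ∀ prev us {C} → StageInvariant prev us C → AlwaysReconfigures (stages prev us ∷ [] , C)
    run-stages prev [] inv = continue (isLegal sound) (_ , stages-end) λ where
        stages-end → inj₁ ≋.↭-refl , finished (isLegal sound) (finish prev inv)
      where open StageInvariant inv
    run-stages prev (u ∷ us) {C} inv = continue (isLegal sound) progress λ where
        (stage-skip all-settled) → inj₁ ≋.↭-refl ,
          run-stages (just u) us (next inv sound (all-settled u u∈C ≤-refl) (All.tail settled))
        (stage-act {φ = φ} ¬all stageMap) → inj₁ ≋.↭-refl ,
          run-action (All.lookup U-powers u∈U) u≤κ (λ sd → ≤-trans (u≤ℓ ¬all) (enough sd)) sound
            (stageMap-invariant prev separate-u gapC gapT stageMap)
            λ sd inv′ balanced → run-stages (just u) us (next inv sd (balanced⇒settled inv′ balanced)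
              -- The pending sizes are smaller than `u`, hence than ℓ, so nothing has to be
              -- preserved for them.
              (All.map (λ v<u ℓ<v → contradiction (≤-trans (<⇒≤ v<u) (u≤ℓ ¬all)) (<⇒≱ ℓ<v)) (AllPairs.head sorted)))
      where
      open StageInvariant inv
      u∈U : u ∈ U
      u∈U = All.head ⊆U
      u∈C : u ∈ underlying (toList C)
      u∈C = ∈-resp-↭ (↭-sym (items sound)) u∈U
      separate-u : ∀ {v} → Above prev v → u < v
      separate-u = All.head separate _
      u≤κ : u ≤ κ
      u≤κ with Any.tabulate⁻ (∈-concat⁻ (toList C) u∈C)
      ... | k , u∈k = ≤-trans (∈⇒≤sum u∈k) (legal sound k)
      u≤ℓ : ¬ AllSettledFrom u C → u ≤ ℓ
      u≤ℓ ¬all = ≮⇒≥ (¬all ∘ All.head settled)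
      gap : ∀ {v} → v ∈ U → u < v → Above prev v
      gap v∈ u<v with covered v∈
      ... | inj₁ above        = above
      ... | inj₂ (here refl)  = contradiction u<v (n≮n u)
      ... | inj₂ (there v∈us) = contradiction u<v (<-asym (All.lookup (AllPairs.head sorted) v∈us))
      gapC : ∀ k → Gap prev u (C k)
      gapC k = All.tabulate λ v∈ → gap (∈-U sound v∈)
      gapT : ∀ k → Gap prev u (T k)
      gapT k = All.tabulate λ v∈ → gap (∈-resp-↭ T-items (∈-concat⁺′ v∈ (∈-tabulate⁺ k)))
      progress : ∃[ σ ] (stages prev (u ∷ us) ∷ [] , C) ⟶ σ
      progress with allSettledFrom? u C
      ... | yes all-settled = _ , stage-skip all-settled
      ... | no ¬all = _ , stage-act ¬all (proj₂ (stageMap-exists {prev} separate-u n≡m gapC gapT (proj₂ starting)))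

-- Reconfiguration sequences

reconfiguration-legal : ∀ {κ C D} → ReconfigurationSequence κ C D → Legal κ C
reconfiguration-legal (stop l _)   = l
reconfiguration-legal (step l _ _) = l

legal-≋ : ∀ {κ C D} → C ≋ D → Legal κ C → Legal κ D
legal-≋ {κ} p = ≋.All-resp-↭ (λ q → subst (_≤ κ) (sum-↭ q)) p

reconfiguration-resp : ∀ {κ C C′ D} → C ≋ C′ → ReconfigurationSequence κ C′ D → ReconfigurationSequence κ C D
reconfiguration-resp p (stop l q)     = stop (legal-≋ (≋.↭-sym p) l) (≋.trans p q)
reconfiguration-resp p (step l adj r) with Adjacent.differences adj
... | common , q , q′ , disjoint = step (legal-≋ (≋.↭-sym p) l)
  (record { differences = common , ≋.trans p q , q′ , disjoint ; removed = Adjacent.removed adj ; added = Adjacent.added adj }) r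

module _ {κ n m : ℕ} {T : Vector Bunch m} where
  open SettleItems κ {n} T

  -- Follows a single run, namely the steps that the progress proofs supply. Steps that only
  -- rearrange equal bunches are absorbed into the next configuration.
  run⇒reconfiguration : ∀ {ks C} → AlwaysReconfigures (ks , C) → ReconfigurationSequence κ (toList C) (toList T)
  run⇒reconfiguration (finished l p) = stop l p
  run⇒reconfiguration (continue l (_ , st) next) with proj₁ (next st)
  ... | inj₁ same = reconfiguration-resp same (run⇒reconfiguration (proj₂ (next st)))
  ... | inj₂ adj  = step l adj (run⇒reconfiguration (proj₂ (next st)))

module _ {κ : ℕ} {C D : Configuration} (legal-C : Legal κ C) (legal-D : Legal κ D) (adj : Adjacent C D) where
  open Adjacent adj

  private
    common = proj₁ differences
    C≋ : C ≋ Bd ∷ Br ∷ common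
    C≋ = proj₁ (proj₂ differences)
    D≋ : D ≋ Bd′ ∷ Br′ ∷ common
    D≋ = proj₁ (proj₂ (proj₂ differences))

  adjacent-underlying : underlying C ↭ underlying D
  adjacent-underlying = begin
    underlying C                            ↭⟨ concat-≋ C≋ ⟩
    Bd ++ Br ++ underlying common           ↭⟨ ++⁺ʳ _ removed ⟩
    item ∷ Bd′ ++ Br ++ underlying common   ↭⟨ shift item Bd′ _ ⟨
    Bd′ ++ item ∷ Br ++ underlying common   ↭⟨ ++⁺ˡ Bd′ (++⁺ʳ _ added) ⟨
    Bd′ ++ Br′ ++ underlying common         ↭⟨ concat-≋ D≋ ⟨
    underlying D                            ∎
    where open PermutationReasoning

  adjacent-totalSlack : totalSlack κ C ≡ totalSlack κ D
  adjacent-totalSlack = totalSlack-cong legal-C legal-D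
    (trans (≋.xs↭ys⇒|xs|≡|ys| C≋) (sym (≋.xs↭ys⇒|xs|≡|ys| D≋))) adjacent-underlying

  item≤totalSlack : item ≤ totalSlack κ C
  item≤totalSlack = begin
    item                                                   ≤⟨ m+n≤o⇒m≤o∸n item (subst (_≤ κ) (sum-↭ added) (All.head (All.tail (legal-≋ D≋ legal-D)))) ⟩
    slack κ Br                                             ≤⟨ m≤m+n (slack κ Br) (totalSlack κ common) ⟩
    slack κ Br + totalSlack κ common                       ≤⟨ m≤n+m _ (slack κ Bd) ⟩
    totalSlack κ (Bd ∷ Br ∷ common)                        ≡⟨ totalSlack-cong legal-C (legal-≋ C≋ legal-C) (≋.xs↭ys⇒|xs|≡|ys| C≋) (concat-≋ C≋) ⟨
    totalSlack κ C                                         ∎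
    where open ≤-Reasoning

  adjacent-atLeast : ∀ {ℓ} → totalSlack κ C < ℓ → map (atLeast ℓ) C ≋ map (atLeast ℓ) D
  adjacent-atLeast {ℓ} small = ≋.trans (≋.map⁺ ↭-setoid (atLeast-↭ ℓ) C≋)
    (≋.trans (≋.prep same-d (≋.prep (↭-sym same-r) ≋.↭-refl)) (≋.↭-sym (≋.map⁺ ↭-setoid (atLeast-↭ ℓ) D≋)))
    where
    drop-item : ∀ B → atLeast ℓ (item ∷ B) ≡ atLeast ℓ B
    drop-item B = filter-reject (ℓ ≤?_) {xs = B} (<⇒≱ (≤-<-trans item≤totalSlack small))
    same-d : atLeast ℓ Bd ↭ atLeast ℓ Bd′
    same-d = ↭-trans (atLeast-↭ ℓ removed) (↭-reflexive (drop-item Bd′))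
    same-r : atLeast ℓ Br′ ↭ atLeast ℓ Br
    same-r = ↭-trans (atLeast-↭ ℓ added) (↭-reflexive (drop-item Br))

-- The slack bound is assumed for the first configuration only; moves preserve the total slack, so
-- it holds along the whole sequence.
reconfiguration-atLeast : ∀ {κ C D ℓ} → ReconfigurationSequence κ C D → totalSlack κ C < ℓ →
  map (atLeast ℓ) C ≋ map (atLeast ℓ) D
reconfiguration-atLeast {ℓ = ℓ} (stop _ p) small = ≋.map⁺ ↭-setoid (atLeast-↭ ℓ) p
reconfiguration-atLeast {ℓ = ℓ} (step l adj r) small = ≋.trans (adjacent-atLeast l l′ adj small)
  (reconfiguration-atLeast r (subst (_< ℓ) (adjacent-totalSlack l l′ adj) small))
  where l′ = reconfiguration-legal r

-- Initial state of the algorithm and both directions of the equivalence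

fromList-atLeast : ∀ s C → toList (atLeast s ∘ fromList C) ≡ map (atLeast s) C
fromList-atLeast s C = trans (sym (map-tabulate (fromList C) (atLeast s))) (cong (map (atLeast s)) (tabulate-lookup C))

∈-sizes⁺ : ∀ {v U} → v ∈ U → v ∈ sizes U
∈-sizes⁺ {U = U} v∈ = ∈-filter⁺ (λ s → any? (s ≟_) U) (∈-downFrom⁺ (s≤s (∈⇒≤sum v∈))) v∈

sizes-⊆ : ∀ U → All (_∈ U) (sizes U)
sizes-⊆ U = All.all-filter (λ s → any? (s ≟_) U) (downFrom (suc (sum U)))

sizes-sorted : ∀ U → AllPairs (λ u v → v < u) (sizes U)
sizes-sorted U = AllPairs.filter⁺ (λ s → any? (s ≟_) U) (AllPairs.applyDownFrom⁺₁ id (suc (sum U)) (λ v<u _ → v<u))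

module _ {κ : ℕ} {C_S C_T : Configuration} {ℓ : ℕ} (κ-power : PowerOfTwo κ) (legal-S : Legal κ C_S) (legal-T : Legal κ C_T)
         (len : length C_S ≡ length C_T) (same : underlying C_T ↭ underlying C_S)
         (U-powers : All PowerOfTwo (underlying C_S)) (isℓ : IsLargestUnsettled C_S C_T ℓ) where
  open IsLargestUnsettled isℓ

  private
    T = fromList C_T
    U = underlying C_S
    T-legal : ∀ j → vol (T j) ≤ κ
    T-legal j = All.lookup legal-T (∈-lookup j)
    T-items : underlying (toList T) ↭ U
    T-items = ↭-trans (↭-reflexive (cong concat (tabulate-lookup C_T))) same
  open Stages {κ} {length C_S} len T {U} κ-power U-powers T-legal T-items

  enough⇒settleItems : ℓ ≤ totalSlack κ C_S → SettleItemsReconfigures κ C_S C_T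
  enough⇒settleItems ℓ≤ = run-stages isItemSize enough nothing (sizes U) record
    { sound    = record { legal = λ k → All.lookup legal-S (∈-lookup k) ; items = ↭-reflexive (cong concat (tabulate-lookup C_S)) }
    ; covered  = inj₂ ∘ ∈-sizes⁺
    ; separate = All.universal (λ _ _ ()) (sizes U)
    ; sorted   = sizes-sorted U
    ; ⊆U       = sizes-⊆ U
    ; starting = (λ _ → nothing) , λ _ → refl
    ; settled  = All.universal (λ u ℓ<u s s∈ u≤s → settled s (<-≤-trans ℓ<u u≤s) s∈) (sizes U)
    }
    where
    enough : ∀ {C} → Sound C → ℓ ≤ totalSlack κ (toList C)
    enough {C} sd = subst (ℓ ≤_) (totalSlack-cong legal-S (Sound.isLegal sd)
      (sym (length-tabulate C)) (↭-sym (Sound.items sd))) ℓ≤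
    settled : ∀ s → ℓ < s → s ∈ underlying (toList (fromList C_S)) → Settled s (fromList C_S) T
    -- `largest` only bounds sizes that are known to be unsettled; decidability turns this into
    -- settledness of all sizes above ℓ.
    settled s ℓ<s s∈ with settled? len s (fromList C_S) T
    ... | yes st = st
    ... | no ¬st = contradiction (largest (subst (λ C → s ∈ underlying C) (tabulate-lookup C_S) s∈) ¬st) (<⇒≱ ℓ<s)

  enough⇒reconfiguration : ℓ ≤ totalSlack κ C_S → ReconfigurationSequence κ C_S C_T
  enough⇒reconfiguration ℓ≤ = subst₂ (ReconfigurationSequence κ) (tabulate-lookup C_S) (tabulate-lookup C_T)
    (run⇒reconfiguration (enough⇒settleItems ℓ≤))

  reconfiguration⇒enough : ReconfigurationSequence κ C_S C_T → ℓ ≤ totalSlack κ C_S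
  reconfiguration⇒enough r = ≮⇒≥ λ small → unsettled (≋⇒settled (subst₂ _≋_
    (sym (fromList-atLeast ℓ C_S)) (sym (fromList-atLeast ℓ C_T)) (reconfiguration-atLeast r small)))

theorem15 : ∀ (κ : ℕ) (C_S C_T : Configuration) (U : List ℕ) (ℓ : ℕ) →
    PowerOfTwo κ →
    Legal κ C_S →
    Legal κ C_T →
    length C_S ≡ length C_T →
    underlying C_S ↭ U →
    underlying C_T ↭ U →
    All PowerOfTwo U →
    IsLargestUnsettled C_S C_T ℓ →
    (ReconfigurationSequence κ C_S C_T ⇔ totalSlack κ C_S ≥ ℓ) ×
    (ReconfigurationSequence κ C_S C_T → SettleItemsReconfigures κ C_S C_T)
theorem15 κ C_S C_T U ℓ κ-power legal-S legal-T len S↭U T↭U U-powers isℓ =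
  mk⇔ necessary (enough⇒reconfiguration κ-power legal-S legal-T len T↭S S-powers isℓ) ,
  enough⇒settleItems κ-power legal-S legal-T len T↭S S-powers isℓ ∘ necessary
  where
  T↭S = ↭-trans T↭U (↭-sym S↭U)
  S-powers = All-resp-↭ (↭-sym S↭U) U-powers
  necessary = reconfiguration⇒enough κ-power legal-S legal-T len T↭S S-powers isℓ
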